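{- There is an absolute constant $C$ such that the following holds. Let $T$ be a finite set of primes, and let either $Y=U_T$ and $H=H(T)$, or $Y=W_T$ and $H=H'(T)$. Let $Z\sim\mathrm{Pois}(H)$. Then for every integer $k\ge 0$, \[ |\mathbb P(Y=k)-\mathbb P(Z=k)|\le\begin{cases} C\,H''(T)\,\dfrac{H^k}{k!}\mathrm{e}^{ -H}\Big(\dfrac1{k+1}+\Big(\dfrac{k-H}{H}\Big)^2\Big) & \text{if } 0\le k\le 1.9H,\\[2mm] C\,H''(T)\,\dfrac{\mathrm{e}^{0.9H}}{(1.9)^k} & \text{if } k>1.9H.\end{cases} \]
   Context: Kubilius model: for each prime $p$, $X_p$ is a random variable on $\{0,1,2,\ldots\}$ with $\mathbb P(X_p=k)=p^{ -k}(1-1/p)$, and the $X_p$ are mutually independent. For a finite set $T$ of primes, $U_T=\#\{p\in T:X_p\ge1\}$ and $W_T=\sum_{p\in T}X_p$. $H(T)=\sum_{p\in T}1/p$, $H'(T)=\sum_{p\in T}1/(p-1)$, $H''(T)=\sum_{p\in T}1/p^2$. $\mathrm{Pois}(\lambda)$ is a Poisson random variable with parameter $\lambda$. -}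

module Defs where

open import Algebra.Definitions.RawSemiring using (_^_)
open import Data.Empty using (⊥-elim)
open import Data.Integer as ℤ using (+_)
import Data.Integer.Properties as ℤ
open import Data.List using (List; []; _∷_; map; foldr; filter; length)
open import Data.List.Membership.Propositional using (_∈_)
import Data.List.Relation.Binary.Subset.Propositional as List
open import Data.List.Relation.Unary.All as All using (All; []; _∷_)
open import Data.List.Relation.Unary.Any using (here; there)
open import Data.List.Relation.Unary.Unique.Propositional using (Unique)
open import Data.Nat as ℕ using (ℕ; zero; suc; _!)
import Data.Nat.Properties as ℕ
open import Data.Nat.ListAction using (sum)
open import Data.Nat.Primality using (Prime)
open import Data.Product using (Σ; ∃; _×_; _,_; proj₁; proj₂)
open import Data.Rational as ℚ using (ℚ; 0ℚ; 1ℚ; ½; _/_; _+_; _*_; _-_; -_; ∣_∣; _≤_; _<_; 1/_; ≢-nonZero; positive; nonNegative)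
open import Data.Rational.Properties
open import Data.Rational.Solver using (module +-*-Solver)
import Data.Rational.Unnormalised as ℚᵘ
import Data.Rational.Unnormalised.Properties as ℚᵘ
open import Data.Sum using (_⊎_; inj₁; inj₂)
open import Level using (0ℓ)
open import Relation.Binary.PropositionalEquality using (_≡_; _≢_; refl; sym; trans; cong; cong₂; subst; subst₂)
open import Relation.Nullary using (yes; no)
open import Relation.Unary using (Pred; U; ∅; ∁; _∩_; _∪_; _⊥_; _≐_; ⋃)

fromℕ : ℕ → ℚ
fromℕ n = + n / 1

infixr 8 _^ℚ_
_^ℚ_ : ℚ → ℕ → ℚ
_^ℚ_ = _^_ ℚ.+-*-rawSemiring

-- With x ÷₀ 0 = 0.  The convention is only ever used for (k - H) / H when T is
-- empty, where that term is multiplied by H″ T = 0.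
infixl 7 _÷₀_
_÷₀_ : ℚ → ℚ → ℚ
x ÷₀ y with y ≟ 0ℚ
... | yes _  = 0ℚ
... | no y≢0 = x * (1/ y) {{≢-nonZero y≢0}}

sumℚ : List ℚ → ℚ
sumℚ = foldr _+_ 0ℚ

÷₀-cancel : ∀ x {y} → y ≢ 0ℚ → (x ÷₀ y) * y ≡ x
÷₀-cancel x {y} y≢0 with y ≟ 0ℚ
... | yes y≡0 = ⊥-elim (y≢0 y≡0)
... | no y≢0′ = trans (*-assoc x (1/ y) y) (trans (cong (x *_) (*-inverseˡ y)) (*-identityʳ x))
  where instance _ = ≢-nonZero y≢0′

fromℕ-toℚᵘ : ∀ n → ℚ.toℚᵘ (fromℕ n) ℚᵘ.≃ ℚᵘ.mkℚᵘ (+ n) 0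
fromℕ-toℚᵘ n = toℚᵘ-fromℚᵘ (ℚᵘ.mkℚᵘ (+ n) 0)

fromℕ-* : ∀ m n → fromℕ (m ℕ.* n) ≡ fromℕ m * fromℕ n
fromℕ-* m n = toℚᵘ-injective (begin
  ℚ.toℚᵘ (fromℕ (m ℕ.* n))                    ≈⟨ fromℕ-toℚᵘ (m ℕ.* n) ⟩
  ℚᵘ.mkℚᵘ (+ (m ℕ.* n)) 0                     ≈⟨ ℚᵘ.*≡* (cong (ℤ._* + 1) (ℤ.pos-* m n)) ⟩
  ℚᵘ.mkℚᵘ (+ m) 0 ℚᵘ.* ℚᵘ.mkℚᵘ (+ n) 0        ≈⟨ ℚᵘ.*-cong (ℚᵘ.≃-sym (fromℕ-toℚᵘ m)) (ℚᵘ.≃-sym (fromℕ-toℚᵘ n)) ⟩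
  ℚ.toℚᵘ (fromℕ m) ℚᵘ.* ℚ.toℚᵘ (fromℕ n)      ≈⟨ ℚᵘ.≃-sym (toℚᵘ-homo-* (fromℕ m) (fromℕ n)) ⟩
  ℚ.toℚᵘ (fromℕ m * fromℕ n)                  ∎)
  where open ℚᵘ.≃-Reasoning

fromℕ-mono-≤ : ∀ {m n} → m ℕ.≤ n → fromℕ m ≤ fromℕ n
fromℕ-mono-≤ {m} {n} m≤n = toℚᵘ-cancel-≤
  (ℚᵘ.≤-respˡ-≃ (ℚᵘ.≃-sym (fromℕ-toℚᵘ m)) (ℚᵘ.≤-respʳ-≃ (ℚᵘ.≃-sym (fromℕ-toℚᵘ n))
    (ℚᵘ.*≤* (ℤ.*-monoʳ-≤-nonNeg (+ 1) (ℤ.+≤+ m≤n)))))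

0<fromℕ : ∀ n .{{_ : ℕ.NonZero n}} → 0ℚ < fromℕ n
0<fromℕ (suc n) = positive⁻¹ (fromℕ (suc n)) {{normalize-pos (suc n) 1}}

fromℕ-suc : ∀ n → fromℕ (suc n) ≡ 1ℚ + fromℕ n
fromℕ-suc n = toℚᵘ-injective (begin
  ℚ.toℚᵘ (fromℕ (suc n))                   ≈⟨ fromℕ-toℚᵘ (suc n) ⟩
  ℚᵘ.mkℚᵘ (+ suc n) 0                      ≈⟨ ℚᵘ.*≡* (cong (λ z → (+ 1 ℤ.+ z) ℤ.* + 1) (sym (ℤ.*-identityʳ (+ n)))) ⟩
  ℚᵘ.1ℚᵘ ℚᵘ.+ ℚᵘ.mkℚᵘ (+ n) 0              ≈⟨ ℚᵘ.+-congʳ ℚᵘ.1ℚᵘ (ℚᵘ.≃-sym (fromℕ-toℚᵘ n)) ⟩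
  ℚᵘ.1ℚᵘ ℚᵘ.+ ℚ.toℚᵘ (fromℕ n)             ≈⟨ ℚᵘ.≃-sym (toℚᵘ-homo-+ 1ℚ (fromℕ n)) ⟩
  ℚ.toℚᵘ (1ℚ + fromℕ n)                    ∎)
  where open ℚᵘ.≃-Reasoning

archimedean : ∀ q → ∃ λ n → q ≤ fromℕ n
archimedean q@(ℚ.mkℚ num d-1 _) = ℤ.∣ num ∣ , toℚᵘ-cancel-≤
  (ℚᵘ.≤-respʳ-≃ (ℚᵘ.≃-sym (fromℕ-toℚᵘ ℤ.∣ num ∣)) (ℚᵘ.*≤* bound))
  where
  i≤∣i∣ : ∀ i → i ℤ.≤ + ℤ.∣ i ∣
  i≤∣i∣ (+ n)       = ℤ.≤-refl
  i≤∣i∣ (ℤ.-[1+ n ]) = ℤ.-≤+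
  bound : num ℤ.* + 1 ℤ.≤ + ℤ.∣ num ∣ ℤ.* + suc d-1
  bound = ℤ.≤-trans (ℤ.≤-reflexive (ℤ.*-identityʳ num))
    (ℤ.≤-trans (i≤∣i∣ num)
      (ℤ.≤-trans (ℤ.+≤+ (ℕ.m≤m*n ℤ.∣ num ∣ (suc d-1))) (ℤ.≤-reflexive (ℤ.pos-* ℤ.∣ num ∣ (suc d-1)))))

half-pos : ∀ {ε} → 0ℚ < ε → 0ℚ < ½ * ε
half-pos {ε} 0<ε = subst (_< ½ * ε) (*-zeroʳ ½) (*-monoʳ-<-pos ½ 0<ε)

half+half : ∀ ε → ½ * ε + ½ * ε ≡ ε
half+half ε = trans (sym (*-distribʳ-+ ε ½ ½)) (*-identityˡ ε)

∣-∣-swap : ∀ x y → ∣ x - y ∣ ≡ ∣ y - x ∣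
∣-∣-swap x y = trans (sym (∣-p∣≡∣p∣ (x - y))) (cong ∣_∣ (solve 2 (λ a b → :- (a :- b) := b :- a) refl x y))
  where open +-*-Solver

triangle : ∀ x y z → ∣ x - z ∣ ≤ ∣ x - y ∣ + ∣ y - z ∣
triangle x y z = subst (λ w → ∣ w ∣ ≤ ∣ x - y ∣ + ∣ y - z ∣)
  (solve 3 (λ a b c → (a :- b) :+ (b :- c) := a :- c) refl x y z) (∣p+q∣≤∣p∣+∣q∣ (x - y) (y - z))
  where open +-*-Solver

∣x∣≤∣y∣+∣x-y∣ : ∀ x y → ∣ x ∣ ≤ ∣ y ∣ + ∣ x - y ∣
∣x∣≤∣y∣+∣x-y∣ x y = subst (λ w → ∣ w ∣ ≤ ∣ y ∣ + ∣ x - y ∣)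
  (solve 2 (λ a b → b :+ (a :- b) := a) refl x y) (∣p+q∣≤∣p∣+∣q∣ y (x - y))
  where open +-*-Solver

∣x∣-∣y∣≤∣x-y∣ : ∀ x y → ∣ x ∣ - ∣ y ∣ ≤ ∣ x - y ∣
∣x∣-∣y∣≤∣x-y∣ x y = subst (∣ x ∣ - ∣ y ∣ ≤_)
  (solve 2 (λ a b → (a :+ b) :- a := b) refl ∣ y ∣ ∣ x - y ∣) (+-monoˡ-≤ (- ∣ y ∣) (∣x∣≤∣y∣+∣x-y∣ x y))
  where open +-*-Solver

reverse-triangle : ∀ x y → ∣ ∣ x ∣ - ∣ y ∣ ∣ ≤ ∣ x - y ∣
reverse-triangle x y with ∣p∣≡p∨∣p∣≡-p (∣ x ∣ - ∣ y ∣)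
... | inj₁ eq = subst (_≤ ∣ x - y ∣) (sym eq) (∣x∣-∣y∣≤∣x-y∣ x y)
... | inj₂ eq = subst₂ _≤_
  (trans (solve 2 (λ a b → b :- a := :- (a :- b)) refl ∣ x ∣ ∣ y ∣) (sym eq)) (∣-∣-swap y x) (∣x∣-∣y∣≤∣x-y∣ y x)
  where open +-*-Solver

-- The Cauchy moduli of the operations are abstract, so that terms
-- containing reals stay small under normalisation.

IsCauchy : (ℕ → ℚ) → Set
IsCauchy x = ∀ ε → 0ℚ < ε → ∃ λ N → ∀ m n → N ℕ.≤ m → N ℕ.≤ n → ∣ x m - x n ∣ ≤ ε

record ℝ : Set where
  constructor mkℝ
  field
    seq    : ℕ → ℚ
    cauchy : IsCauchy seq
open ℝ public

infix 4 _≈ᴿ_ _≤ᴿ_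
_≈ᴿ_ : ℝ → ℝ → Set
x ≈ᴿ y = ∀ ε → 0ℚ < ε → ∃ λ N → ∀ n → N ℕ.≤ n → ∣ seq x n - seq y n ∣ ≤ ε

_≤ᴿ_ : ℝ → ℝ → Set
x ≤ᴿ y = ∀ ε → 0ℚ < ε → ∃ λ N → ∀ n → N ℕ.≤ n → seq x n ≤ seq y n + ε

abstract
  fromℚ-cauchy : ∀ q → IsCauchy (λ _ → q)
  fromℚ-cauchy q = λ ε 0<ε → 0 , λ _ _ _ _ →
    subst (λ w → ∣ w ∣ ≤ ε) (sym (+-inverseʳ q)) (<⇒≤ 0<ε)

fromℚ : ℚ → ℝ
fromℚ q = mkℝ (λ _ → q) (fromℚ-cauchy q)

infixl 6 _+ᴿ_ _-ᴿ_
infixl 7 _*ᴿ_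
infix  8 -ᴿ_

abstract
  +-cauchy : ∀ x y → IsCauchy (λ n → seq x n + seq y n)
  +-cauchy x y = λ ε 0<ε →
    let (M , hx) = cauchy x (½ * ε) (half-pos 0<ε)
        (N , hy) = cauchy y (½ * ε) (half-pos 0<ε)
    in M ℕ.⊔ N , λ m n m≥ n≥ →
      subst₂ _≤_
        (cong ∣_∣ (solve 4 (λ a b c d → (a :- b) :+ (c :- d) := (a :+ c) :- (b :+ d)) refl
          (seq x m) (seq x n) (seq y m) (seq y n)))
        (half+half ε)
        (≤-trans (∣p+q∣≤∣p∣+∣q∣ (seq x m - seq x n) (seq y m - seq y n))
          (+-mono-≤ (hx m n (ℕ.m⊔n≤o⇒m≤o M N m≥) (ℕ.m⊔n≤o⇒m≤o M N n≥))
                    (hy m n (ℕ.m⊔n≤o⇒n≤o M N m≥) (ℕ.m⊔n≤o⇒n≤o M N n≥))))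
    where open +-*-Solver

_+ᴿ_ : ℝ → ℝ → ℝ
x +ᴿ y = mkℝ (λ n → seq x n + seq y n) (+-cauchy x y)

abstract
  neg-cauchy : ∀ x → IsCauchy (λ n → - seq x n)
  neg-cauchy x = λ ε 0<ε →
    let (N , h) = cauchy x ε 0<ε
    in N , λ m n m≥ n≥ → subst (_≤ ε)
      (trans (∣-∣-swap (seq x m) (seq x n))
        (cong ∣_∣ (solve 2 (λ a b → b :- a := (:- a) :- (:- b)) refl (seq x m) (seq x n))))
      (h m n m≥ n≥)
    where open +-*-Solver

-ᴿ_ : ℝ → ℝ
-ᴿ x = mkℝ (λ n → - seq x n) (neg-cauchy x)

_-ᴿ_ : ℝ → ℝ → ℝ
x -ᴿ y = x +ᴿ (-ᴿ y)

abstract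
  ∣-∣-cauchy : ∀ x → IsCauchy (λ n → ∣ seq x n ∣)
  ∣-∣-cauchy x = λ ε 0<ε →
    let (N , h) = cauchy x ε 0<ε
    in N , λ m n m≥ n≥ → ≤-trans (reverse-triangle (seq x m) (seq x n)) (h m n m≥ n≥)

∣_∣ᴿ : ℝ → ℝ
∣ x ∣ᴿ = mkℝ (λ n → ∣ seq x n ∣) (∣-∣-cauchy x)

eventually-bounded : ∀ x → ∃ λ B → 0ℚ < B × ∃ λ N → ∀ n → N ℕ.≤ n → ∣ seq x n ∣ ≤ B
eventually-bounded x =
  let (N , h) = cauchy x 1ℚ (positive⁻¹ 1ℚ)
  in ∣ seq x N ∣ + 1ℚ
   , subst (_< ∣ seq x N ∣ + 1ℚ) (+-identityʳ 0ℚ) (+-mono-≤-< (0≤∣p∣ (seq x N)) (positive⁻¹ 1ℚ))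
   , N , λ n n≥ → ≤-trans (∣x∣≤∣y∣+∣x-y∣ (seq x n) (seq x N))
                    (+-monoʳ-≤ ∣ seq x N ∣ (h n N n≥ ℕ.≤-refl))

*-bound : ∀ {a b A B} → ∣ a ∣ ≤ A → ∣ b ∣ ≤ B → ∣ a * b ∣ ≤ A * B
*-bound {a} {b} {A} {B} a≤A b≤B = subst (_≤ A * B) (sym (∣p*q∣≡∣p∣*∣q∣ a b))
  (≤-trans (*-monoʳ-≤-nonNeg ∣ b ∣ {{∣-∣-nonNeg b}} a≤A)
           (*-monoˡ-≤-nonNeg A {{nonNegative (≤-trans (0≤∣p∣ a) a≤A)}} b≤B))

÷₀-pos : ∀ {x y} → 0ℚ < x → 0ℚ < y → 0ℚ < x ÷₀ y
÷₀-pos {x} {y} 0<x 0<y = *-cancelʳ-<-nonNeg y {{nonNegative (<⇒≤ 0<y)}}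
  (subst₂ _<_ (sym (*-zeroˡ y)) (sym (÷₀-cancel x (λ y≡0 → <⇒≢ 0<y (sym y≡0)))) 0<x)

abstract
  *-cauchy : ∀ x y → IsCauchy (λ n → seq x n * seq y n)
  *-cauchy x y = λ ε 0<ε →
    let (A , 0<A , M₁ , bx) = eventually-bounded x
        (B , 0<B , M₂ , by) = eventually-bounded y
        (N₁ , hx) = cauchy x ((½ * ε) ÷₀ B) (÷₀-pos (half-pos 0<ε) 0<B)
        (N₂ , hy) = cauchy y ((½ * ε) ÷₀ A) (÷₀-pos (half-pos 0<ε) 0<A)
        M = M₁ ℕ.⊔ M₂
        N = N₁ ℕ.⊔ N₂
    in M ℕ.⊔ N , λ m n m≥ n≥ →
      subst₂ _≤_
        (cong ∣_∣ (solve 4 (λ a b c d → (a :- b) :* d :+ (c :- d) :* a := (a :* c) :- (b :* d)) refl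
          (seq x m) (seq x n) (seq y m) (seq y n)))
        (trans (cong₂ _+_ (÷₀-cancel (½ * ε) (λ e → <⇒≢ 0<B (sym e)))
                          (÷₀-cancel (½ * ε) (λ e → <⇒≢ 0<A (sym e))))
               (half+half ε))
        (≤-trans (∣p+q∣≤∣p∣+∣q∣ ((seq x m - seq x n) * seq y n) ((seq y m - seq y n) * seq x m))
          (+-mono-≤
            (*-bound (hx m n (ℕ.m⊔n≤o⇒m≤o N₁ N₂ (ℕ.m⊔n≤o⇒n≤o M N m≥)) (ℕ.m⊔n≤o⇒m≤o N₁ N₂ (ℕ.m⊔n≤o⇒n≤o M N n≥)))
                     (by n (ℕ.m⊔n≤o⇒n≤o M₁ M₂ (ℕ.m⊔n≤o⇒m≤o M N n≥))))
            (*-bound (hy m n (ℕ.m⊔n≤o⇒n≤o N₁ N₂ (ℕ.m⊔n≤o⇒n≤o M N m≥)) (ℕ.m⊔n≤o⇒n≤o N₁ N₂ (ℕ.m⊔n≤o⇒n≤o M N n≥)))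
                     (bx m (ℕ.m⊔n≤o⇒m≤o M₁ M₂ (ℕ.m⊔n≤o⇒m≤o M N m≥))))))
    where open +-*-Solver

_*ᴿ_ : ℝ → ℝ → ℝ
x *ᴿ y = mkℝ (λ n → seq x n * seq y n) (*-cauchy x y)

0ᴿ 1ᴿ : ℝ
0ᴿ = fromℚ 0ℚ
1ᴿ = fromℚ 1ℚ

productᴿ : List ℝ → ℝ
productᴿ = foldr _*ᴿ_ 1ᴿ

partialSum : (ℕ → ℝ) → ℕ → ℝ
partialSum a zero    = 0ᴿ
partialSum a (suc n) = partialSum a n +ᴿ a n

SumsTo : (ℕ → ℝ) → ℝ → Set
SumsTo a s = ∀ ε → 0ℚ < ε → ∃ λ N → ∀ n → N ℕ.≤ n → ∣ partialSum a n -ᴿ s ∣ᴿ ≤ᴿ fromℚ ε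

expTerm : ℚ → ℕ → ℚ
expTerm q n = q ^ℚ n ÷₀ fromℕ (n !)

expSum : ℚ → ℕ → ℚ
expSum q zero    = 0ℚ
expSum q (suc n) = expSum q n + expTerm q n

fromℕ-≢0 : ∀ n .{{_ : ℕ.NonZero n}} → fromℕ n ≢ 0ℚ
fromℕ-≢0 n e = <⇒≢ (0<fromℕ n) (sym e)

*-cancelʳ : ∀ {x y} z → 0ℚ < z → x * z ≡ y * z → x ≡ y
*-cancelʳ z 0<z eq = ≤-antisym
  (*-cancelʳ-≤-pos z {{positive 0<z}} (≤-reflexive eq))
  (*-cancelʳ-≤-pos z {{positive 0<z}} (≤-reflexive (sym eq)))

expTerm-suc : ∀ q n → expTerm q (suc n) * fromℕ (suc n) ≡ expTerm q n * q
expTerm-suc q n = *-cancelʳ (fromℕ (n !)) (0<fromℕ (n !) {{n!≢0}}) (begin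
  expTerm q (suc n) * fromℕ (suc n) * fromℕ (n !)    ≡⟨ *-assoc (expTerm q (suc n)) _ _ ⟩
  expTerm q (suc n) * (fromℕ (suc n) * fromℕ (n !))  ≡⟨ cong (expTerm q (suc n) *_) (sym (fromℕ-* (suc n) (n !))) ⟩
  expTerm q (suc n) * fromℕ (suc n !)                ≡⟨ ÷₀-cancel (q ^ℚ suc n) (fromℕ-≢0 (suc n !) {{ℕ._!≢0 (suc n)}}) ⟩
  q * q ^ℚ n                                         ≡⟨ cong (q *_) (sym (÷₀-cancel (q ^ℚ n) (fromℕ-≢0 (n !) {{n!≢0}}))) ⟩
  q * (expTerm q n * fromℕ (n !))                    ≡⟨ solve 3 (λ a b c → a :* (b :* c) := b :* a :* c) refl q (expTerm q n) (fromℕ (n !)) ⟩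
  expTerm q n * q * fromℕ (n !)                      ∎)
  where
  open Relation.Binary.PropositionalEquality.≡-Reasoning
  open +-*-Solver
  n!≢0 = ℕ._!≢0 n

expTerm-halves : ∀ q n → ∣ q ∣ + ∣ q ∣ ≤ fromℕ (suc n) →
                 ∣ expTerm q (suc n) ∣ + ∣ expTerm q (suc n) ∣ ≤ ∣ expTerm q n ∣
expTerm-halves q n 2q≤c = *-cancelʳ-≤-pos c {{positive 0<c}}
  (subst (_≤ ∣ t ∣ * c) eq (*-monoˡ-≤-nonNeg ∣ t ∣ {{∣-∣-nonNeg t}} 2q≤c))
  where
  c t t′ : ℚ
  c  = fromℕ (suc n)
  t  = expTerm q n
  t′ = expTerm q (suc n)
  0<c : 0ℚ < c
  0<c = 0<fromℕ (suc n)
  step : ∣ t ∣ * ∣ q ∣ ≡ ∣ t′ ∣ * c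
  step = trans (sym (∣p*q∣≡∣p∣*∣q∣ t q)) (trans (cong ∣_∣ (sym (expTerm-suc q n)))
    (trans (∣p*q∣≡∣p∣*∣q∣ t′ c) (cong (∣ t′ ∣ *_) (0≤p⇒∣p∣≡p (<⇒≤ 0<c)))))
  eq : ∣ t ∣ * (∣ q ∣ + ∣ q ∣) ≡ (∣ t′ ∣ + ∣ t′ ∣) * c
  eq = trans (*-distribˡ-+ (∣ t ∣) (∣ q ∣) (∣ q ∣)) (trans (cong₂ _+_ step step) (sym (*-distribʳ-+ c (∣ t′ ∣) (∣ t′ ∣))))

module ExpCauchy (q : ℚ) where
  private
    K : ℕ
    K = proj₁ (archimedean (∣ q ∣ + ∣ q ∣))

    a : ℕ → ℚ
    a n = ∣ expTerm q n ∣

    halves : ∀ n → K ℕ.≤ n → a (suc n) + a (suc n) ≤ a n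
    halves n K≤n = expTerm-halves q n
      (≤-trans (proj₂ (archimedean (∣ q ∣ + ∣ q ∣))) (fromℕ-mono-≤ (ℕ.m≤n⇒m≤1+n K≤n)))

    tail : ∀ n → K ℕ.≤ n → ∀ d →
           ∣ expSum q (d ℕ.+ n) - expSum q n ∣ + (a (d ℕ.+ n) + a (d ℕ.+ n)) ≤ a n + a n
    tail n K≤n zero = ≤-reflexive (trans (cong (λ w → ∣ w ∣ + (a n + a n)) (+-inverseʳ (expSum q n)))
                                          (+-identityˡ (a n + a n)))
    tail n K≤n (suc d) = ≤-trans
      (+-mono-≤
        (subst (λ w → ∣ w ∣ ≤ ∣ S - s ∣ + a m)
          (solve 3 (λ x y z → (x :- y) :+ z := (x :+ z) :- y) refl S s (expTerm q m))
          (∣p+q∣≤∣p∣+∣q∣ (S - s) (expTerm q m)))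
        (halves m (ℕ.≤-trans K≤n (ℕ.m≤n+m n d))))
      (subst (_≤ a n + a n) (sym (+-assoc ∣ S - s ∣ (a m) (a m))) (tail n K≤n d))
      where
      open +-*-Solver
      m : ℕ
      m = d ℕ.+ n
      S s : ℚ
      S = expSum q m
      s = expSum q n

    decay : ∀ j → fromℕ (suc j) * a (j ℕ.+ K) ≤ a K
    decay zero    = ≤-reflexive (*-identityˡ (a K))
    decay (suc j) = ≤-trans (subst₂ _≤_ e₁ e₂ (*-monoʳ-≤-nonNeg t′ {{∣-∣-nonNeg (expTerm q (suc j ℕ.+ K))}}
                                                 (+-monoˡ-≤ c (fromℕ-mono-≤ {1} {suc j} (ℕ.s≤s ℕ.z≤n)))))
      (≤-trans (*-monoˡ-≤-nonNeg c {{normalize-nonNeg (suc j) 1}} (halves (j ℕ.+ K) (ℕ.m≤n+m K j))) (decay j))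
      where
      c t′ : ℚ
      c  = fromℕ (suc j)
      t′ = a (suc j ℕ.+ K)
      e₁ : (1ℚ + c) * t′ ≡ fromℕ (suc (suc j)) * t′
      e₁ = cong (_* t′) (sym (fromℕ-suc (suc j)))
      e₂ : (c + c) * t′ ≡ c * (t′ + t′)
      e₂ = trans (*-distribʳ-+ t′ c c) (sym (*-distribˡ-+ c t′ t′))

    small : ∀ δ → 0ℚ < δ → ∃ λ n → K ℕ.≤ n × a n ≤ δ
    small δ 0<δ = j ℕ.+ K , ℕ.m≤n+m K j ,
      *-cancelˡ-≤-pos c {{positive (0<fromℕ (suc j))}} (≤-trans (decay j) aK≤cδ)
      where
      j : ℕ
      j = proj₁ (archimedean (a K ÷₀ δ))
      c : ℚ
      c = fromℕ (suc j)
      aK≤cδ : a K ≤ c * δ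
      aK≤cδ = subst (_≤ c * δ) (÷₀-cancel (a K) (λ e → <⇒≢ 0<δ (sym e)))
        (*-monoʳ-≤-nonNeg δ {{nonNegative (<⇒≤ 0<δ)}}
          (≤-trans (proj₂ (archimedean (a K ÷₀ δ))) (fromℕ-mono-≤ (ℕ.n≤1+n j))))

  cauchyProof : IsCauchy (expSum q)
  cauchyProof ε 0<ε = n , λ k l n≤k n≤l →
    subst (∣ expSum q k - expSum q l ∣ ≤_) (half+half ε)
      (≤-trans (triangle (expSum q k) (expSum q n) (expSum q l))
        (+-mono-≤ (close k n≤k) (subst (_≤ ½ * ε) (∣-∣-swap (expSum q l) (expSum q n)) (close l n≤l))))
    where
    found = small (½ * (½ * ε)) (half-pos (half-pos 0<ε))
    n : ℕ
    n = proj₁ found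
    close′ : ∀ d → ∣ expSum q (d ℕ.+ n) - expSum q n ∣ ≤ ½ * ε
    close′ d = ≤-trans
      (subst (_≤ D + (A + A)) (+-identityʳ D)
        (+-monoʳ-≤ D (+-mono-≤ (0≤∣p∣ (expTerm q (d ℕ.+ n))) (0≤∣p∣ (expTerm q (d ℕ.+ n))))))
      (≤-trans (tail n (proj₁ (proj₂ found)) d)
        (subst (a n + a n ≤_) (half+half (½ * ε)) (+-mono-≤ (proj₂ (proj₂ found)) (proj₂ (proj₂ found)))))
      where
      D A : ℚ
      D = ∣ expSum q (d ℕ.+ n) - expSum q n ∣
      A = a (d ℕ.+ n)
    close : ∀ k → n ℕ.≤ k → ∣ expSum q k - expSum q n ∣ ≤ ½ * ε
    close k n≤k = subst (λ l → ∣ expSum q l - expSum q n ∣ ≤ ½ * ε) (ℕ.m∸n+n≡m n≤k) (close′ (k ℕ.∸ n))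

abstract
  expSum-cauchy : ∀ q → IsCauchy (expSum q)
  expSum-cauchy q = ExpCauchy.cauchyProof q

exp : ℚ → ℝ
exp q = mkℝ (expSum q) (expSum-cauchy q)

-- Classically this is exactly a probability space: the partial sums of
-- the probabilities of disjoint events are monotone and bounded by 1, so
-- `event-⋃` gives closure under all countable disjoint unions, hence (with
-- complements and finite intersections) under all countable unions.
-- Constructively such a series need not converge, and asking for a
-- Cauchy real as the probability of every countable union would make even
-- discrete spaces imply the limited principle of omniscience.
-- For the same reason ∩ and finite additivity are listed as axioms although
-- they are classically redundant.
record ProbabilitySpace : Set₁ where
  field
    Ω     : Set
    Event : Pred Ω 0ℓ → Set
    ℙ     : (A : Pred Ω 0ℓ) → Event A → ℝ

    event-≐ : ∀ {A B} → A ≐ B → Event A → Event B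
    event-U : Event U
    event-∁ : ∀ {A} → Event A → Event (∁ A)
    event-∩ : ∀ {A B} → Event A → Event B → Event (A ∩ B)
    event-∪ : ∀ {A B} → Event A → Event B → Event (A ∪ B)

    ℙ-≐      : ∀ {A B} → A ≐ B → (a : Event A) (b : Event B) → ℙ A a ≈ᴿ ℙ B b
    ℙ-nonNeg : ∀ {A} (a : Event A) → 0ᴿ ≤ᴿ ℙ A a
    ℙ-U      : ℙ U event-U ≈ᴿ 1ᴿ
    ℙ-∪      : ∀ {A B} (a : Event A) (b : Event B) → A ⊥ B →
               ℙ (A ∪ B) (event-∪ a b) ≈ᴿ ℙ A a +ᴿ ℙ B b

    event-⋃ : (A : ℕ → Pred Ω 0ℓ) (a : ∀ n → Event (A n)) →
              (∀ m n → m ≢ n → A m ⊥ A n) →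
              ∀ s → SumsTo (λ n → ℙ (A n) (a n)) s →
              Σ (Event (⋃ ℕ A)) λ e → ℙ (⋃ ℕ A) e ≈ᴿ s

module _ (S : ProbabilitySpace) where
  open ProbabilitySpace S

  record RandomVariable : Set where
    constructor mkRV
    field
      value      : Ω → ℕ
      measurable : ∀ k → Event (λ ω → value ω ≡ k)

module _ {S : ProbabilitySpace} where
  open ProbabilitySpace S
  open RandomVariable

  ℙ[_≡_] : RandomVariable S → ℕ → ℝ
  ℙ[ Y ≡ k ] = ℙ (λ ω → value Y ω ≡ k) (measurable Y k)

  HasLaw : RandomVariable S → (ℕ → ℝ) → Set
  HasLaw Y f = ∀ k → ℙ[ Y ≡ k ] ≈ᴿ f k

  event-All : (X : ℕ → RandomVariable S) (x : ℕ → ℕ) (I : List ℕ) →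
              Event (λ ω → All (λ i → value (X i) ω ≡ x i) I)
  event-All X x []      = event-≐ ((λ _ → []) , (λ _ → _)) event-U
  event-All X x (i ∷ I) = event-≐ ((λ (e , es) → e ∷ es) , λ { (e ∷ es) → e , es })
    (event-∩ (measurable (X i) (x i)) (event-All X x I))

  MutuallyIndependent : (ℕ → RandomVariable S) → List ℕ → Set
  MutuallyIndependent X T = ∀ I → Unique I → I List.⊆ T → ∀ (x : ℕ → ℕ) →
    ℙ (λ ω → All (λ i → value (X i) ω ≡ x i) I) (event-All X x I)
      ≈ᴿ productᴿ (map (λ i → ℙ[ X i ≡ x i ]) I)

geometricLaw : ℕ → ℕ → ℝ
geometricLaw p k = fromℚ ((1ℚ ÷₀ fromℕ p) ^ℚ k * (1ℚ - 1ℚ ÷₀ fromℕ p))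

poissonLaw : ℚ → ℕ → ℝ
poissonLaw H k = fromℚ (H ^ℚ k ÷₀ fromℕ (k !)) *ᴿ exp (- H)

-- Only the X p with p ∈ T are constrained; a family of X p over all primes
-- restricts to such a model for every T.
record KubiliusModel (S : ProbabilitySpace) (T : List ℕ) : Set where
  field
    X           : ℕ → RandomVariable S
    law         : ∀ p → p ∈ T → HasLaw (X p) (geometricLaw p)
    independent : MutuallyIndependent X T

-- A finite set of primes is a duplicate-free list of primes.
record IsPrimeSet (T : List ℕ) : Set where
  field
    primes   : All Prime T
    distinct : Unique T

module _ {S : ProbabilitySpace} {T : List ℕ} (M : KubiliusModel S T) where
  open ProbabilitySpace S
  open RandomVariable
  open KubiliusModel M

  private
    x : ℕ → Ω → ℕ
    x p = value (X p)

    count : List ℕ → Ω → ℕ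
    count L ω = length (filter (λ p → 1 ℕ.≤? x p ω) L)

    event-∅ : Event ∅
    event-∅ = event-≐ ((λ ¬u → ¬u _) , λ ()) (event-∁ event-U)

    const-measurable : ∀ c k → Event (λ _ → c ≡ k)
    const-measurable c k with c ℕ.≟ k
    ... | yes c≡k = event-≐ ((λ _ → c≡k) , (λ _ → _)) event-U
    ... | no  c≢k = event-≐ ((λ ()) , c≢k) event-∅

    count-measurable : ∀ L k → Event (λ ω → count L ω ≡ k)
    count-measurable []      k = const-measurable 0 k
    count-measurable (p ∷ L) k = event-≐ (to , from)
        (event-∪ (event-∩ (measurable (X p) 0) (count-measurable L k))
                 (event-∩ (event-∁ (measurable (X p) 0)) (pred-measurable k)))
      where
      pred-measurable : ∀ k → Event (λ ω → suc (count L ω) ≡ k)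
      pred-measurable zero    = event-≐ ((λ ()) , λ ()) event-∅
      pred-measurable (suc k) = event-≐ (cong suc , ℕ.suc-injective) (count-measurable L k)
      Split : Pred Ω 0ℓ
      Split ω = ((x p ω ≡ 0) × (count L ω ≡ k)) ⊎ ((x p ω ≢ 0) × (suc (count L ω) ≡ k))
      to : ∀ {ω} → Split ω → count (p ∷ L) ω ≡ k
      to {ω} s with x p ω | s
      ... | zero  | inj₁ (_ , e)   = e
      ... | zero  | inj₂ (n≢0 , _) = ⊥-elim (n≢0 refl)
      ... | suc _ | inj₂ (_ , e)   = e
      from : ∀ {ω} → count (p ∷ L) ω ≡ k → Split ω
      from {ω} e with x p ω
      ... | zero  = inj₁ (refl , e)
      ... | suc _ = inj₂ ((λ ()) , e)

    total : List ℕ → Ω → ℕ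
    total L ω = sum (map (λ p → x p ω) L)

    total-measurable : ∀ L k → Event (λ ω → total L ω ≡ k)
    total-measurable []      k = const-measurable 0 k
    total-measurable (p ∷ L) k = event-≐
        ((λ { (i , _ , e₁ , e₂) → trans (cong (ℕ._+ _) e₁) e₂ })
        , λ {ω} e → x p ω , ℕ.s≤s (ℕ.≤-trans (ℕ.m≤m+n (x p ω) (total L ω)) (ℕ.≤-reflexive e)) , refl , e)
        (upto (suc k))
      where
      shifted : ∀ i k → Event (λ ω → i ℕ.+ total L ω ≡ k)
      shifted zero    k       = total-measurable L k
      shifted (suc i) zero    = event-≐ ((λ ()) , λ ()) event-∅
      shifted (suc i) (suc k) = event-≐ (cong suc , ℕ.suc-injective) (shifted i k)
      upto : ∀ n → Event (λ ω → ∃ λ i → (i ℕ.< n) × (x p ω ≡ i) × (i ℕ.+ total L ω ≡ k))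
      upto zero    = event-≐ ((λ ()) , λ ()) event-∅
      upto (suc n) = event-≐
        ((λ { (inj₁ (i , i<n , r)) → i , ℕ.m<n⇒m<1+n i<n , r
            ; (inj₂ r)             → n , ℕ.n<1+n n , r })
        , λ { (i , i<1+n , r) → split i i<1+n r })
        (event-∪ (upto n) (event-∩ (measurable (X p) n) (shifted n k)))
        where
        split : ∀ {ω} i → i ℕ.< suc n → (x p ω ≡ i) × (i ℕ.+ total L ω ≡ k) →
                (∃ λ i → (i ℕ.< n) × (x p ω ≡ i) × (i ℕ.+ total L ω ≡ k)) ⊎
                ((x p ω ≡ n) × (n ℕ.+ total L ω ≡ k))
        split i i<1+n r with ℕ.m<1+n⇒m<n∨m≡n i<1+n
        ... | inj₁ i<n  = inj₁ (i , i<n , r)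
        ... | inj₂ refl = inj₂ r

  Uᵀ : RandomVariable S
  Uᵀ = mkRV (λ ω → length (filter (λ p → 1 ℕ.≤? value (X p) ω) T)) (count-measurable T)

  Wᵀ : RandomVariable S
  Wᵀ = mkRV (λ ω → sum (map (λ p → value (X p) ω) T)) (total-measurable T)

H H′ H″ : List ℕ → ℚ
H  T = sumℚ (map (λ p → 1ℚ ÷₀ fromℕ p) T)
H′ T = sumℚ (map (λ p → 1ℚ ÷₀ (fromℕ p - 1ℚ)) T)
H″ T = sumℚ (map (λ p → 1ℚ ÷₀ fromℕ p ^ℚ 2) T)

{-# OPTIONS --safe #-}

-- Write λ for the rate of a prime and t = λ(z - 1).  Its probability generating
-- function f is 1 + t (for U) or 1/(1 - t) (for W), so f(z) e^{-λz} agrees with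
-- the constant e^{-λ} up to (1 - z)² times a power series whose coefficients are
-- absolutely summable with total O(λ²), even against the weights (j + 1)² 1.9ʲ.
-- These weights define a submultiplicative norm, and ∑ λ² converges over the
-- primes, so multiplying over T gives
--     ∏ f(z) · e^{-Hz} = e^{-H} (1 + (1 - z)² S(z)),   ‖S‖ = O(H″),
-- with an absolute implied constant.  Multiplying back by e^{Hz}, the error in the
-- k-th coefficient is that of e^{-H} S(z) (1 - z)² e^{Hz}.  The m-th coefficient of
-- (1 - z)² e^{Hz} is Hᵐ/m! · (((m - H)/H)² - m/H²), which gives the first case; the
-- trivial bound for coefficients in terms of the norm at radius 1.9 gives the second.
--
-- To stay within ℚ, each e^{-λ} is replaced by a partial sum of order N > k, which
-- leaves coefficients up to k exact; N → ∞ is taken only at the end.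
module Submission where

open import Algebra.Bundles using (CommutativeSemigroup)
import Algebra.Properties.CommutativeSemigroup as CommutativeSemigroupProperties
open import Data.Empty using (⊥-elim)
open import Data.Integer using (+_)
open import Data.List using (List; []; _∷_; map; downFrom; filter; length; _++_)
open import Data.List.Membership.Propositional using (_∈_)
open import Data.List.Membership.Propositional.Properties using (∈-∃++; ∈-++⁻; ∈-++⁺ˡ; ∈-++⁺ʳ; ∈-map⁺; ∈-downFrom⁺)
open import Data.List.Properties using (filter-accept; filter-reject)
open import Data.List.Relation.Binary.Subset.Propositional using (_⊆_)
open import Data.List.Relation.Unary.All as All using (All; []; _∷_)
open import Data.List.Relation.Unary.AllPairs using ([]; _∷_)
open import Data.List.Relation.Unary.Any using (here; there)
open import Data.List.Relation.Unary.Unique.Propositional using (Unique)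
open import Data.Nat as ℕ using (ℕ; zero; suc; _!)
open import Data.Nat.ListAction using (sum)
open import Data.Nat.Primality using (prime⇒nonTrivial)
import Data.Nat.Properties as ℕ
open import Data.Product using (Σ; _×_; _,_; proj₁; proj₂)
open import Data.Rational using (ℚ; 0ℚ; 1ℚ; ½; _/_; _+_; _*_; _-_; -_; ∣_∣; _≤_; _<_; positive; nonNegative)
open import Data.Rational.Properties
open import Data.Rational.Solver using (module +-*-Solver)
open import Data.Sum using (_⊎_; inj₁; inj₂)
open import Function using (_∘_)
open import Level using (0ℓ)
open import Relation.Binary.PropositionalEquality using (_≡_; _≢_; _≗_; refl; sym; trans; cong; cong₂; subst; subst₂; module ≡-Reasoning)
open import Relation.Nullary using (yes; no)
open import Relation.Unary using (Pred; Decidable; U; ∅; ∁; _∩_; _∪_; _⊥_; _≐_)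
open import Defs

open +-*-Solver using (solve; _:=_; _:+_; _:*_; _:-_; :-_; con)

-- Rational inequalities

-- Each rate is the mean of its variable, 1/p for the indicator of X_p ≥ 1 and 1/(p - 1) for X_p
-- itself, so f(z) and e^{λ(z - 1)} agree in value and first derivative at z = 1. This is why a full
-- factor (1 - z)² splits off and only λ² remains.
--
-- The radius 1.9 serves both ranges: it lies below 2, the pole of the geometric factor at p = 2,
-- and k ≤ 1.9 H says that consecutive Poisson weights up to k have ratio at most 1.9, so the
-- weights of the norm also control the passage from index k to index k - i.
--
-- The corrections 1 + Kλ² multiply to at most a power of ∏ (1 + 1/n²), whatever T is.
--
-- All identities between series hold for every truncation order N; only the estimates ask for N to
-- be large.

p≤p+q : ∀ p {q} → 0ℚ ≤ q → p ≤ p + q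
p≤p+q p {q} 0≤q = subst (_≤ p + q) (+-identityʳ p) (+-monoʳ-≤ p 0≤q)

p≤q+p : ∀ p {q} → 0ℚ ≤ q → p ≤ q + p
p≤q+p p {q} 0≤q = subst (_≤ q + p) (+-identityˡ p) (+-monoˡ-≤ p 0≤q)

≤-by : ∀ {p q} d → 0ℚ ≤ d → q ≡ p + d → p ≤ q
≤-by {p} d 0≤d refl = p≤p+q p 0≤d

0≤+ : ∀ {p q} → 0ℚ ≤ p → 0ℚ ≤ q → 0ℚ ≤ p + q
0≤+ {p} 0≤p 0≤q = ≤-trans 0≤p (p≤p+q p 0≤q)

*-monoˡ : ∀ {r p q} → 0ℚ ≤ r → p ≤ q → r * p ≤ r * q
*-monoˡ {r} 0≤r = *-monoˡ-≤-nonNeg r {{nonNegative 0≤r}}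

*-monoʳ : ∀ {r p q} → 0ℚ ≤ r → p ≤ q → p * r ≤ q * r
*-monoʳ {r} 0≤r = *-monoʳ-≤-nonNeg r {{nonNegative 0≤r}}

0≤* : ∀ {p q} → 0ℚ ≤ p → 0ℚ ≤ q → 0ℚ ≤ p * q
0≤* {p} {q} 0≤p 0≤q = subst (_≤ p * q) (*-zeroʳ p) (*-monoˡ 0≤p 0≤q)

*-mono : ∀ {p q r s} → 0ℚ ≤ p → 0ℚ ≤ s → p ≤ q → r ≤ s → p * r ≤ q * s
*-mono 0≤p 0≤s p≤q r≤s = ≤-trans (*-monoˡ 0≤p r≤s) (*-monoʳ 0≤s p≤q)

0≤p*p : ∀ p → 0ℚ ≤ p * p
0≤p*p p with ≤-total 0ℚ p
... | inj₁ 0≤p = 0≤* 0≤p 0≤p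
... | inj₂ p≤0 = subst (0ℚ ≤_) (solve 1 (λ x → (:- x) :* (:- x) := x :* x) refl p) (0≤* 0≤-p 0≤-p)
  where
  0≤-p : 0ℚ ≤ - p
  0≤-p = neg-antimono-≤ p≤0

p≤q⇒0≤q-p : ∀ {p q} → p ≤ q → 0ℚ ≤ q - p
p≤q⇒0≤q-p {p} {q} p≤q = subst (_≤ q - p) (+-inverseʳ p) (+-monoˡ-≤ (- p) p≤q)

p≤∣p∣ : ∀ p → p ≤ ∣ p ∣
p≤∣p∣ p with ≤-total 0ℚ p
... | inj₁ 0≤p = ≤-reflexive (sym (0≤p⇒∣p∣≡p 0≤p))
... | inj₂ p≤0 = ≤-trans p≤0 (0≤∣p∣ p)

-p≤∣p∣ : ∀ p → - p ≤ ∣ p ∣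
-p≤∣p∣ p = subst (- p ≤_) (∣-p∣≡∣p∣ p) (p≤∣p∣ (- p))

0≤fromℕ : ∀ n → 0ℚ ≤ fromℕ n
0≤fromℕ n = fromℕ-mono-≤ {0} {n} ℕ.z≤n

0≤1 : 0ℚ ≤ 1ℚ
0≤1 = 0≤fromℕ 1

^ℚ-nonNeg : ∀ {q} n → 0ℚ ≤ q → 0ℚ ≤ q ^ℚ n
^ℚ-nonNeg zero    0≤q = 0≤1
^ℚ-nonNeg (suc n) 0≤q = 0≤* 0≤q (^ℚ-nonNeg n 0≤q)

^ℚ-mono-≤ : ∀ {p q} n → 0ℚ ≤ p → p ≤ q → p ^ℚ n ≤ q ^ℚ n
^ℚ-mono-≤ zero    0≤p p≤q = ≤-refl
^ℚ-mono-≤ (suc n) 0≤p p≤q = *-mono 0≤p (^ℚ-nonNeg n (≤-trans 0≤p p≤q)) p≤q (^ℚ-mono-≤ n 0≤p p≤q)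

^ℚ-distrib-* : ∀ p q n → (p * q) ^ℚ n ≡ p ^ℚ n * q ^ℚ n
^ℚ-distrib-* p q zero    = refl
^ℚ-distrib-* p q (suc n) = trans (cong (p * q *_) (^ℚ-distrib-* p q n))
  (solve 4 (λ a b c d → a :* b :* (c :* d) := a :* c :* (b :* d)) refl p q (p ^ℚ n) (q ^ℚ n))

-- Power series

Series : Set
Series = ℕ → ℚ

tail : Series → Series
tail a = a ∘ suc

δ : Series
δ zero    = 1ℚ
δ (suc _) = 0ℚ

infixl 6 _⊕_
_⊕_ : Series → Series → Series
(a ⊕ b) n = a n + b n

infixr 8 _·_
_·_ : ℚ → Series → Series
(q · a) n = q * a n

infixl 7 _⊛_
_⊛_ : Series → Series → Series
(a ⊛ b) zero    = a 0 * b 0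
(a ⊛ b) (suc n) = a 0 * b (suc n) + (tail a ⊛ b) n

⊛-cong : ∀ {a a′ b b′} → a ≗ a′ → b ≗ b′ → a ⊛ b ≗ a′ ⊛ b′
⊛-cong p q zero    = cong₂ _*_ (p 0) (q 0)
⊛-cong p q (suc n) = cong₂ _+_ (cong₂ _*_ (p 0) (q (suc n))) (⊛-cong (p ∘ suc) q n)

⊛-distribʳ : ∀ a b c → (a ⊕ b) ⊛ c ≗ a ⊛ c ⊕ b ⊛ c
⊛-distribʳ a b c zero    = *-distribʳ-+ (c 0) (a 0) (b 0)
⊛-distribʳ a b c (suc n) = trans (cong (_+_ ((a 0 + b 0) * c (suc n))) (⊛-distribʳ (tail a) (tail b) c n))
  (solve 5 (λ x y z u v → (x :+ y) :* z :+ (u :+ v) := (x :* z :+ u) :+ (y :* z :+ v)) refl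
    (a 0) (b 0) (c (suc n)) ((tail a ⊛ c) n) ((tail b ⊛ c) n))

⊛-scaleˡ : ∀ q a b → (q · a) ⊛ b ≗ q · (a ⊛ b)
⊛-scaleˡ q a b zero    = *-assoc q (a 0) (b 0)
⊛-scaleˡ q a b (suc n) = trans (cong (_+_ (q * a 0 * b (suc n))) (⊛-scaleˡ q (tail a) b n))
  (solve 4 (λ x y z u → x :* y :* z :+ x :* u := x :* (y :* z :+ u)) refl q (a 0) (b (suc n)) ((tail a ⊛ b) n))

-- The defining recursion strips the head of the left factor; stripping that of the right factor
-- instead is what commutativity needs.
⊛-suc′ : ∀ a b n → (a ⊛ b) (suc n) ≡ (a ⊛ tail b) n + a (suc n) * b 0
⊛-suc′ a b zero    = refl
⊛-suc′ a b (suc n) = trans (cong (_+_ (a 0 * b (suc (suc n)))) (⊛-suc′ (tail a) b n))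
  (sym (+-assoc (a 0 * b (suc (suc n))) ((tail a ⊛ tail b) n) (a (suc (suc n)) * b 0)))

⊛-comm : ∀ a b → a ⊛ b ≗ b ⊛ a
⊛-comm a b zero    = *-comm (a 0) (b 0)
⊛-comm a b (suc n) = trans (⊛-suc′ a b n) (trans (cong₂ _+_ (⊛-comm a (tail b) n) (*-comm (a (suc n)) (b 0)))
  (+-comm ((tail b ⊛ a) n) (b 0 * a (suc n))))

⊛-assoc : ∀ a b c → (a ⊛ b) ⊛ c ≗ a ⊛ (b ⊛ c)
⊛-assoc a b c zero    = *-assoc (a 0) (b 0) (c 0)
⊛-assoc a b c (suc n) = begin
  a 0 * b 0 * c (suc n) + ((a 0 · tail b ⊕ tail a ⊛ b) ⊛ c) n
    ≡⟨ cong (_+_ (a 0 * b 0 * c (suc n))) (⊛-distribʳ (a 0 · tail b) (tail a ⊛ b) c n) ⟩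
  a 0 * b 0 * c (suc n) + (((a 0 · tail b) ⊛ c) n + ((tail a ⊛ b) ⊛ c) n)
    ≡⟨ cong (_+_ (a 0 * b 0 * c (suc n))) (cong₂ _+_ (⊛-scaleˡ (a 0) (tail b) c n) (⊛-assoc (tail a) b c n)) ⟩
  a 0 * b 0 * c (suc n) + (a 0 * (tail b ⊛ c) n + (tail a ⊛ (b ⊛ c)) n)
    ≡⟨ solve 5 (λ x y z u v → x :* y :* z :+ (x :* u :+ v) := x :* (y :* z :+ u) :+ v) refl
         (a 0) (b 0) (c (suc n)) ((tail b ⊛ c) n) ((tail a ⊛ (b ⊛ c)) n) ⟩
  a 0 * (b ⊛ c) (suc n) + (tail a ⊛ (b ⊛ c)) n ∎
  where open ≡-Reasoning

⊛-zeroˡ : ∀ b n → ((λ _ → 0ℚ) ⊛ b) n ≡ 0ℚ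
⊛-zeroˡ b zero    = *-zeroˡ (b 0)
⊛-zeroˡ b (suc n) = cong₂ _+_ (*-zeroˡ (b (suc n))) (⊛-zeroˡ b n)

⊛-identityˡ : ∀ b → δ ⊛ b ≗ b
⊛-identityˡ b zero    = *-identityˡ (b 0)
⊛-identityˡ b (suc n) = trans (cong₂ _+_ (*-identityˡ (b (suc n))) (⊛-zeroˡ b n)) (+-identityʳ (b (suc n)))

⊛-identityʳ : ∀ b → b ⊛ δ ≗ b
⊛-identityʳ b n = trans (⊛-comm b δ n) (⊛-identityˡ b n)

⊛-commutativeSemigroup : CommutativeSemigroup _ _
⊛-commutativeSemigroup = record
  { Carrier = Series ; _≈_ = _≗_ ; _∙_ = _⊛_
  ; isCommutativeSemigroup = record
    { isSemigroup = record
      { isMagma = record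
        { isEquivalence = record { refl = λ _ → refl ; sym = λ p n → sym (p n) ; trans = λ p q n → trans (p n) (q n) }
        ; ∙-cong = ⊛-cong }
      ; assoc = ⊛-assoc }
    ; comm = ⊛-comm } }

⊛-interchange : ∀ a b c d → (a ⊛ b) ⊛ (c ⊛ d) ≗ (a ⊛ c) ⊛ (b ⊛ d)
⊛-interchange = CommutativeSemigroupProperties.interchange ⊛-commutativeSemigroup

⊛-distribˡ : ∀ a b c → a ⊛ (b ⊕ c) ≗ a ⊛ b ⊕ a ⊛ c
⊛-distribˡ a b c n = trans (⊛-comm a (b ⊕ c) n) (trans (⊛-distribʳ b c a n) (cong₂ _+_ (⊛-comm b a n) (⊛-comm c a n)))

⊛-scaleʳ : ∀ q a b → a ⊛ (q · b) ≗ q · (a ⊛ b)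
⊛-scaleʳ q a b n = trans (⊛-comm a (q · b) n) (trans (⊛-scaleˡ q b a n) (cong (q *_) (⊛-comm b a n)))

-- Multiplication by 1 - z.
∇ : Series → Series
∇ a zero    = a 0
∇ a (suc n) = a (suc n) - a n

∇-cong : ∀ {a b} → a ≗ b → ∇ a ≗ ∇ b
∇-cong p zero    = p 0
∇-cong p (suc n) = cong₂ _-_ (p (suc n)) (p n)

∇-⊕ : ∀ a b → ∇ (a ⊕ b) ≗ ∇ a ⊕ ∇ b
∇-⊕ a b zero    = refl
∇-⊕ a b (suc n) = solve 4 (λ x y u v → (x :+ y) :- (u :+ v) := (x :- u) :+ (y :- v)) refl (a (suc n)) (b (suc n)) (a n) (b n)

∇-· : ∀ q a → ∇ (q · a) ≗ q · ∇ a
∇-· q a zero    = refl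
∇-· q a (suc n) = solve 3 (λ x y z → x :* y :- x :* z := x :* (y :- z)) refl q (a (suc n)) (a n)

⊛-∇ : ∀ a b → a ⊛ ∇ b ≗ ∇ (a ⊛ b)
⊛-∇ a b zero          = refl
⊛-∇ a b (suc zero)    = solve 4 (λ x y u v → x :* (u :- v) :+ y :* v := (x :* u :+ y :* v) :- x :* v) refl (a 0) (a 1) (b 1) (b 0)
⊛-∇ a b (suc (suc n)) = trans (cong (_+_ (a 0 * (b (suc (suc n)) - b (suc n)))) (⊛-∇ (tail a) b (suc n)))
  (solve 5 (λ x u v s t → x :* (u :- v) :+ (s :- t) := (x :* u :+ s) :- (x :* v :+ t)) refl
    (a 0) (b (suc (suc n))) (b (suc n)) ((tail a ⊛ b) (suc n)) ((tail a ⊛ b) n))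

⊛-∇∇ : ∀ a b → a ⊛ ∇ (∇ b) ≗ ∇ (∇ (a ⊛ b))
⊛-∇∇ a b n = trans (⊛-∇ a (∇ b) n) (∇-cong (⊛-∇ a b) n)

-- Partial sums and the Cauchy product

∑ : Series → ℕ → ℚ
∑ a zero    = 0ℚ
∑ a (suc n) = a 0 + ∑ (tail a) n

∑-suc′ : ∀ a n → ∑ a (suc n) ≡ ∑ a n + a n
∑-suc′ a zero    = +-comm (a 0) 0ℚ
∑-suc′ a (suc n) = trans (cong (_+_ (a 0)) (∑-suc′ (tail a) n)) (sym (+-assoc (a 0) (∑ (tail a) n) (a (suc n))))

∑-mono : ∀ {a b} n → (∀ i → i ℕ.< n → a i ≤ b i) → ∑ a n ≤ ∑ b n
∑-mono zero    p = ≤-refl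
∑-mono (suc n) p = +-mono-≤ (p 0 ℕ.z<s) (∑-mono n (λ i i<n → p (suc i) (ℕ.s<s i<n)))

∑-· : ∀ q a n → ∑ (q · a) n ≡ q * ∑ a n
∑-· q a zero    = sym (*-zeroʳ q)
∑-· q a (suc n) = trans (cong (_+_ (q * a 0)) (∑-· q (tail a) n)) (sym (*-distribˡ-+ q (a 0) (∑ (tail a) n)))

∑-⊕ : ∀ a b n → ∑ (a ⊕ b) n ≡ ∑ a n + ∑ b n
∑-⊕ a b zero    = refl
∑-⊕ a b (suc n) = trans (cong (_+_ (a 0 + b 0)) (∑-⊕ (tail a) (tail b) n))
  (solve 4 (λ x y u v → (x :+ y) :+ (u :+ v) := (x :+ u) :+ (y :+ v)) refl (a 0) (b 0) (∑ (tail a) n) (∑ (tail b) n))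

∑-nonNeg : ∀ {a} n → (∀ i → 0ℚ ≤ a i) → 0ℚ ≤ ∑ a n
∑-nonNeg zero    p = ≤-refl
∑-nonNeg (suc n) p = 0≤+ (p 0) (∑-nonNeg n (p ∘ suc))

∑-monoˡ : ∀ {a} → (∀ i → 0ℚ ≤ a i) → ∀ {m n} → m ℕ.≤ n → ∑ a m ≤ ∑ a n
∑-monoˡ p {n = n} ℕ.z≤n = ∑-nonNeg n p
∑-monoˡ {a} p (ℕ.s≤s m≤n) = +-monoʳ-≤ (a 0) (∑-monoˡ (p ∘ suc) m≤n)

∣∑∣≤∑∣∣ : ∀ a n → ∣ ∑ a n ∣ ≤ ∑ (∣_∣ ∘ a) n
∣∑∣≤∑∣∣ a zero    = ≤-refl
∣∑∣≤∑∣∣ a (suc n) = ≤-trans (∣p+q∣≤∣p∣+∣q∣ (a 0) (∑ (tail a) n)) (+-monoʳ-≤ ∣ a 0 ∣ (∣∑∣≤∑∣∣ (tail a) n))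

⊛-nonNeg : ∀ {a b} → (∀ i → 0ℚ ≤ a i) → (∀ i → 0ℚ ≤ b i) → ∀ n → 0ℚ ≤ (a ⊛ b) n
⊛-nonNeg p q zero    = 0≤* (p 0) (q 0)
⊛-nonNeg p q (suc n) = 0≤+ (0≤* (p 0) (q (suc n))) (⊛-nonNeg (p ∘ suc) q n)

∑-⊛-suc : ∀ a b n → ∑ (a ⊛ b) (suc n) ≡ a 0 * ∑ b (suc n) + ∑ (tail a ⊛ b) n
∑-⊛-suc a b n = begin
  a 0 * b 0 + ∑ (a 0 · tail b ⊕ tail a ⊛ b) n                ≡⟨ cong (_+_ (a 0 * b 0)) (∑-⊕ (a 0 · tail b) (tail a ⊛ b) n) ⟩
  a 0 * b 0 + (∑ (a 0 · tail b) n + ∑ (tail a ⊛ b) n)        ≡⟨ cong (λ w → a 0 * b 0 + (w + ∑ (tail a ⊛ b) n)) (∑-· (a 0) (tail b) n) ⟩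
  a 0 * b 0 + (a 0 * ∑ (tail b) n + ∑ (tail a ⊛ b) n)        ≡⟨ solve 4 (λ x y u v → x :* y :+ (x :* u :+ v) := x :* (y :+ u) :+ v) refl (a 0) (b 0) (∑ (tail b) n) (∑ (tail a ⊛ b) n) ⟩
  a 0 * ∑ b (suc n) + ∑ (tail a ⊛ b) n ∎
  where open ≡-Reasoning

-- The triangle i + j < n of index pairs lies in the square i, j < n.
∑-⊛-≤ : ∀ {a b} → (∀ i → 0ℚ ≤ a i) → (∀ i → 0ℚ ≤ b i) → ∀ n → ∑ (a ⊛ b) n ≤ ∑ a n * ∑ b n
∑-⊛-≤ p q zero = ≤-refl
∑-⊛-≤ {a} {b} p q (suc n) = begin
  ∑ (a ⊛ b) (suc n)                                       ≡⟨ ∑-⊛-suc a b n ⟩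
  a 0 * ∑ b (suc n) + ∑ (tail a ⊛ b) n                    ≤⟨ +-monoʳ-≤ (a 0 * ∑ b (suc n)) (∑-⊛-≤ (p ∘ suc) q n) ⟩
  a 0 * ∑ b (suc n) + ∑ (tail a) n * ∑ b n                ≤⟨ +-monoʳ-≤ (a 0 * ∑ b (suc n)) (*-monoˡ (∑-nonNeg n (p ∘ suc)) (∑-monoˡ q (ℕ.n≤1+n n))) ⟩
  a 0 * ∑ b (suc n) + ∑ (tail a) n * ∑ b (suc n)          ≡⟨ sym (*-distribʳ-+ (∑ b (suc n)) (a 0) (∑ (tail a) n)) ⟩
  ∑ a (suc n) * ∑ b (suc n)                               ∎
  where open ≤-Reasoning

-- The rectangle i < m, j < n of index pairs lies in the triangle i + j < m + n.
∑-⊛-≥ : ∀ {a b} → (∀ i → 0ℚ ≤ a i) → (∀ i → 0ℚ ≤ b i) → ∀ m n → ∑ a m * ∑ b n ≤ ∑ (a ⊛ b) (m ℕ.+ n)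
∑-⊛-≥ {a} {b} p q zero n = subst (_≤ ∑ (a ⊛ b) n) (sym (*-zeroˡ (∑ b n))) (∑-nonNeg n (⊛-nonNeg p q))
∑-⊛-≥ {a} {b} p q (suc m) n = begin
  (a 0 + ∑ (tail a) m) * ∑ b n                               ≡⟨ *-distribʳ-+ (∑ b n) (a 0) (∑ (tail a) m) ⟩
  a 0 * ∑ b n + ∑ (tail a) m * ∑ b n                         ≤⟨ +-mono-≤ (*-monoˡ (p 0) (∑-monoˡ q (ℕ.m≤n⇒m≤1+n (ℕ.m≤n+m n m)))) (∑-⊛-≥ (p ∘ suc) q m n) ⟩
  a 0 * ∑ b (suc m ℕ.+ n) + ∑ (tail a ⊛ b) (m ℕ.+ n)         ≡⟨ sym (∑-⊛-suc a b (m ℕ.+ n)) ⟩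
  ∑ (a ⊛ b) (suc m ℕ.+ n)                                    ∎
  where open ≤-Reasoning

Δ⊛ : Series → Series → ℕ → ℚ
Δ⊛ a b n = ∑ a n * ∑ b n - ∑ (a ⊛ b) n

-- `Δ⊛ a b n` collects the products a i * b j with i, j < n and i + j ≥ n. This recursion describes
-- that corner without subtraction, so the triangle inequality can be applied to it term by term.
Δ⊛-suc : ∀ a b n → Δ⊛ a b (suc n) ≡ Δ⊛ (tail a) b n + ∑ (tail a) n * b n
Δ⊛-suc a b n = begin
  ∑ a (suc n) * ∑ b (suc n) - ∑ (a ⊛ b) (suc n)
    ≡⟨ cong₂ (λ u v → ∑ a (suc n) * u - v) (∑-suc′ b n) (trans (∑-⊛-suc a b n) (cong (λ u → a 0 * u + ∑ (tail a ⊛ b) n) (∑-suc′ b n))) ⟩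
  (a 0 + ∑ (tail a) n) * (∑ b n + b n) - (a 0 * (∑ b n + b n) + ∑ (tail a ⊛ b) n)
    ≡⟨ solve 5 (λ x u v w s → (x :+ u) :* (v :+ w) :- (x :* (v :+ w) :+ s) := (u :* v :- s) :+ u :* w) refl
         (a 0) (∑ (tail a) n) (∑ b n) (b n) (∑ (tail a ⊛ b) n) ⟩
  Δ⊛ (tail a) b n + ∑ (tail a) n * b n ∎
  where open ≡-Reasoning

∣Δ⊛∣≤ : ∀ a b n → ∣ Δ⊛ a b n ∣ ≤ Δ⊛ (∣_∣ ∘ a) (∣_∣ ∘ b) n
∣Δ⊛∣≤ a b zero    = ≤-refl
∣Δ⊛∣≤ a b (suc n) = begin
  ∣ Δ⊛ a b (suc n) ∣                                      ≡⟨ cong ∣_∣ (Δ⊛-suc a b n) ⟩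
  ∣ Δ⊛ (tail a) b n + ∑ (tail a) n * b n ∣                ≤⟨ ∣p+q∣≤∣p∣+∣q∣ (Δ⊛ (tail a) b n) (∑ (tail a) n * b n) ⟩
  ∣ Δ⊛ (tail a) b n ∣ + ∣ ∑ (tail a) n * b n ∣            ≤⟨ +-mono-≤ (∣Δ⊛∣≤ (tail a) b n) (*-bound (∣∑∣≤∑∣∣ (tail a) n) ≤-refl) ⟩
  Δ⊛ (∣_∣ ∘ tail a) (∣_∣ ∘ b) n + ∑ (∣_∣ ∘ tail a) n * ∣ b n ∣ ≡⟨ sym (Δ⊛-suc (∣_∣ ∘ a) (∣_∣ ∘ b) n) ⟩
  Δ⊛ (∣_∣ ∘ a) (∣_∣ ∘ b) (suc n)                          ∎
  where open ≤-Reasoning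

-- The exponential series and the reals

∑-cong : ∀ {a b} → a ≗ b → ∀ n → ∑ a n ≡ ∑ b n
∑-cong p zero    = refl
∑-cong p (suc n) = cong₂ _+_ (p 0) (∑-cong (p ∘ suc) n)

-- The Euler operator z d/dz. It is a derivation, which gives the addition law of the exponential
-- through its differential equation and avoids binomial coefficients.
θ : Series → Series
θ a n = fromℕ n * a n

tail-θ : ∀ a → tail (θ a) ≗ tail a ⊕ θ (tail a)
tail-θ a n = trans (cong (_* a (suc n)) (fromℕ-suc n))
  (solve 2 (λ x y → (con 1ℚ :+ x) :* y := y :+ x :* y) refl (fromℕ n) (a (suc n)))

θ-⊛ : ∀ a b → θ (a ⊛ b) ≗ θ a ⊛ b ⊕ a ⊛ θ b
θ-⊛ a b zero = solve 2 (λ x y → con 0ℚ :* (x :* y) := con 0ℚ :* x :* y :+ x :* (con 0ℚ :* y)) refl (a 0) (b 0)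
θ-⊛ a b (suc n) = begin
  fromℕ (suc n) * (a 0 * b (suc n) + (tail a ⊛ b) n)
    ≡⟨ cong (_* (a 0 * b (suc n) + (tail a ⊛ b) n)) (fromℕ-suc n) ⟩
  (1ℚ + fromℕ n) * (a 0 * b (suc n) + (tail a ⊛ b) n)
    ≡⟨ solve 4 (λ m x y t → (con 1ℚ :+ m) :* (x :* y :+ t) := x :* ((con 1ℚ :+ m) :* y) :+ (t :+ m :* t)) refl
         (fromℕ n) (a 0) (b (suc n)) ((tail a ⊛ b) n) ⟩
  a 0 * ((1ℚ + fromℕ n) * b (suc n)) + ((tail a ⊛ b) n + θ (tail a ⊛ b) n)
    ≡⟨ cong₂ (λ u v → a 0 * (u * b (suc n)) + ((tail a ⊛ b) n + v)) (sym (fromℕ-suc n)) (θ-⊛ (tail a) b n) ⟩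
  a 0 * θ b (suc n) + ((tail a ⊛ b) n + ((θ (tail a) ⊛ b) n + (tail a ⊛ θ b) n))
    ≡⟨ solve 6 (λ z y x t u v → x :+ (t :+ (u :+ v)) := (con 0ℚ :* z :* y :+ (t :+ u)) :+ (x :+ v)) refl
         (a 0) (b (suc n)) (a 0 * θ b (suc n)) ((tail a ⊛ b) n) ((θ (tail a) ⊛ b) n) ((tail a ⊛ θ b) n) ⟩
  (θ a 0 * b (suc n) + ((tail a ⊛ b) n + (θ (tail a) ⊛ b) n)) + (a ⊛ θ b) (suc n)
    ≡⟨ cong (λ u → (θ a 0 * b (suc n) + u) + (a ⊛ θ b) (suc n))
         (trans (sym (⊛-distribʳ (tail a) (θ (tail a)) b n)) (⊛-cong (λ i → sym (tail-θ a i)) (λ _ → refl) n)) ⟩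
  (θ a ⊛ b) (suc n) + (a ⊛ θ b) (suc n) ∎
  where open ≡-Reasoning

E : ℚ → Series
E = expTerm

expSum≡∑ : ∀ q n → expSum q n ≡ ∑ (E q) n
expSum≡∑ q zero    = refl
expSum≡∑ q (suc n) = trans (cong (_+ E q n) (expSum≡∑ q n)) (sym (∑-suc′ (E q) n))

-- The recursion is the equation F′ = qF read off in coefficients. The product, absolute value and
-- scaling laws of `E` all follow from this uniqueness.
E-unique : ∀ q a → a 0 ≡ 1ℚ → (∀ n → a (suc n) * fromℕ (suc n) ≡ a n * q) → a ≗ E q
E-unique q a a₀ step zero    = a₀
E-unique q a a₀ step (suc n) = *-cancelʳ (fromℕ (suc n)) (0<fromℕ (suc n))
  (trans (step n) (trans (cong (_* q) (E-unique q a a₀ step n)) (sym (expTerm-suc q n))))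

θ-E : ∀ q n → θ (E q) (suc n) ≡ E q n * q
θ-E q n = trans (*-comm (fromℕ (suc n)) (E q (suc n))) (expTerm-suc q n)

E-⊛ : ∀ a b → E a ⊛ E b ≗ E (a + b)
E-⊛ a b = E-unique (a + b) (E a ⊛ E b) refl λ n → begin
  (E a ⊛ E b) (suc n) * fromℕ (suc n)
    ≡⟨ *-comm ((E a ⊛ E b) (suc n)) (fromℕ (suc n)) ⟩
  θ (E a ⊛ E b) (suc n)
    ≡⟨ θ-⊛ (E a) (E b) (suc n) ⟩
  (θ (E a) ⊛ E b) (suc n) + (E a ⊛ θ (E b)) (suc n)
    ≡⟨ cong₂ _+_ (left n) (trans (⊛-suc′ (E a) (θ (E b)) n) (right n)) ⟩
  a * (E a ⊛ E b) n + b * (E a ⊛ E b) n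
    ≡⟨ solve 3 (λ x y t → x :* t :+ y :* t := t :* (x :+ y)) refl a b ((E a ⊛ E b) n) ⟩
  (E a ⊛ E b) n * (a + b) ∎
  where
  open ≡-Reasoning
  θ-E′ : ∀ q → tail (θ (E q)) ≗ q · E q
  θ-E′ q n = trans (θ-E q n) (*-comm (E q n) q)
  left : ∀ n → (θ (E a) ⊛ E b) (suc n) ≡ a * (E a ⊛ E b) n
  left n = trans (cong₂ _+_ (*-zeroˡ (E b (suc n))) (⊛-cong (θ-E′ a) (λ _ → refl) n))
    (trans (+-identityˡ _) (⊛-scaleˡ a (E a) (E b) n))
  right : ∀ n → (E a ⊛ tail (θ (E b))) n + E a (suc n) * θ (E b) 0 ≡ b * (E a ⊛ E b) n
  right n = trans (cong₂ _+_ (⊛-cong (λ _ → refl) (θ-E′ b) n) (*-zeroʳ (E a (suc n))))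
    (trans (+-identityʳ _) (⊛-scaleʳ b (E a) (E b) n))

E-0 : E 0ℚ ≗ δ
E-0 n = sym (E-unique 0ℚ δ refl (λ n → trans (*-zeroˡ (fromℕ (suc n))) (sym (*-zeroʳ (δ n)))) n)

E-nonNeg : ∀ {q} → 0ℚ ≤ q → ∀ n → 0ℚ ≤ E q n
E-nonNeg 0≤q zero    = 0≤1
E-nonNeg {q} 0≤q (suc n) = *-cancelʳ-≤-pos (fromℕ (suc n)) {{positive (0<fromℕ (suc n))}}
  (subst₂ _≤_ (sym (*-zeroˡ (fromℕ (suc n)))) (sym (expTerm-suc q n)) (0≤* (E-nonNeg 0≤q n) 0≤q))

∣E∣ : ∀ q → ∣_∣ ∘ E q ≗ E ∣ q ∣
∣E∣ q = E-unique ∣ q ∣ (∣_∣ ∘ E q) refl λ n →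
  trans (cong (∣ E q (suc n) ∣ *_) (sym (0≤p⇒∣p∣≡p (0≤fromℕ (suc n)))))
    (trans (sym (∣p*q∣≡∣p∣*∣q∣ (E q (suc n)) (fromℕ (suc n))))
      (trans (cong ∣_∣ (expTerm-suc q n)) (∣p*q∣≡∣p∣*∣q∣ (E q n) q)))

-- The discrepancy of the truncated product is dominated by that for the
-- absolute values, which is squeezed between two partial sums of one
-- exponential series.
exp-+ : ∀ a b → exp a *ᴿ exp b ≈ᴿ exp (a + b)
exp-+ a b ε 0<ε = N , λ n N≤n → begin
  ∣ expSum a n * expSum b n - expSum (a + b) n ∣
    ≡⟨ cong ∣_∣ (cong₂ _-_ (cong₂ _*_ (expSum≡∑ a n) (expSum≡∑ b n))
         (trans (expSum≡∑ (a + b) n) (∑-cong (λ i → sym (E-⊛ a b i)) n))) ⟩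
  ∣ Δ⊛ (E a) (E b) n ∣
    ≤⟨ ∣Δ⊛∣≤ (E a) (E b) n ⟩
  Δ⊛ (∣_∣ ∘ E a) (∣_∣ ∘ E b) n
    ≡⟨ cong₂ _-_ (cong₂ _*_ (∑-cong (∣E∣ a) n) (∑-cong (∣E∣ b) n))
         (∑-cong (λ i → trans (⊛-cong (∣E∣ a) (∣E∣ b) i) (E-⊛ ∣ a ∣ ∣ b ∣ i)) n) ⟩
  ∑ (E ∣ a ∣) n * ∑ (E ∣ b ∣) n - ∑ (E s) n
    ≤⟨ +-monoˡ-≤ (- ∑ (E s) n) (≤-trans (∑-⊛-≥ (E-nonNeg (0≤∣p∣ a)) (E-nonNeg (0≤∣p∣ b)) n n)
         (≤-reflexive (∑-cong (E-⊛ ∣ a ∣ ∣ b ∣) (n ℕ.+ n)))) ⟩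
  ∑ (E s) (n ℕ.+ n) - ∑ (E s) n
    ≡⟨ sym (cong₂ _-_ (expSum≡∑ s (n ℕ.+ n)) (expSum≡∑ s n)) ⟩
  expSum s (n ℕ.+ n) - expSum s n
    ≤⟨ p≤∣p∣ _ ⟩
  ∣ expSum s (n ℕ.+ n) - expSum s n ∣
    ≤⟨ close (n ℕ.+ n) n (ℕ.≤-trans N≤n (ℕ.m≤m+n n n)) N≤n ⟩
  ε ∎
  where
  open ≤-Reasoning
  s = ∣ a ∣ + ∣ b ∣
  N = proj₁ (expSum-cauchy s ε 0<ε)
  close = proj₂ (expSum-cauchy s ε 0<ε)

-- Congruences for the operations on Cauchy reals

≈ᴿ-refl : ∀ x → x ≈ᴿ x
≈ᴿ-refl x ε 0<ε = 0 , λ n _ → subst (_≤ ε) (sym (cong ∣_∣ (+-inverseʳ (seq x n)))) (<⇒≤ 0<ε)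

≈ᴿ-sym : ∀ x y → x ≈ᴿ y → y ≈ᴿ x
≈ᴿ-sym x y p ε 0<ε = proj₁ (p ε 0<ε) , λ n N≤n → subst (_≤ ε) (∣-∣-swap (seq x n) (seq y n)) (proj₂ (p ε 0<ε) n N≤n)

≈ᴿ-trans : ∀ x y z → x ≈ᴿ y → y ≈ᴿ z → x ≈ᴿ z
≈ᴿ-trans x y z p q ε 0<ε = M ℕ.⊔ N , λ n n≥ →
  ≤-trans (triangle (seq x n) (seq y n) (seq z n))
    (subst (∣ seq x n - seq y n ∣ + ∣ seq y n - seq z n ∣ ≤_) (half+half ε)
      (+-mono-≤ (hp n (ℕ.m⊔n≤o⇒m≤o M N n≥)) (hq n (ℕ.m⊔n≤o⇒n≤o M N n≥))))
  where
  M = proj₁ (p (½ * ε) (half-pos 0<ε))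
  hp = proj₂ (p (½ * ε) (half-pos 0<ε))
  N = proj₁ (q (½ * ε) (half-pos 0<ε))
  hq = proj₂ (q (½ * ε) (half-pos 0<ε))

+ᴿ-cong : ∀ x x′ y y′ → x ≈ᴿ x′ → y ≈ᴿ y′ → x +ᴿ y ≈ᴿ x′ +ᴿ y′
+ᴿ-cong x x′ y y′ p q ε 0<ε = M ℕ.⊔ N , λ n n≥ →
  subst₂ _≤_
    (cong ∣_∣ (solve 4 (λ a b c d → (a :- b) :+ (c :- d) := (a :+ c) :- (b :+ d)) refl (seq x n) (seq x′ n) (seq y n) (seq y′ n)))
    (half+half ε)
    (≤-trans (∣p+q∣≤∣p∣+∣q∣ (seq x n - seq x′ n) (seq y n - seq y′ n))
      (+-mono-≤ (hp n (ℕ.m⊔n≤o⇒m≤o M N n≥)) (hq n (ℕ.m⊔n≤o⇒n≤o M N n≥))))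
  where
  M = proj₁ (p (½ * ε) (half-pos 0<ε))
  hp = proj₂ (p (½ * ε) (half-pos 0<ε))
  N = proj₁ (q (½ * ε) (half-pos 0<ε))
  hq = proj₂ (q (½ * ε) (half-pos 0<ε))

-ᴿ-cong : ∀ x x′ → x ≈ᴿ x′ → -ᴿ x ≈ᴿ -ᴿ x′
-ᴿ-cong x x′ p ε 0<ε = proj₁ (p ε 0<ε) , λ n N≤n → subst (_≤ ε)
  (trans (∣-∣-swap (seq x n) (seq x′ n)) (cong ∣_∣ (solve 2 (λ a b → b :- a := :- a :- :- b) refl (seq x n) (seq x′ n))))
  (proj₂ (p ε 0<ε) n N≤n)

∣∣ᴿ-cong : ∀ x x′ → x ≈ᴿ x′ → ∣ x ∣ᴿ ≈ᴿ ∣ x′ ∣ᴿ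
∣∣ᴿ-cong x x′ p ε 0<ε = proj₁ (p ε 0<ε) , λ n N≤n →
  ≤-trans (reverse-triangle (seq x n) (seq x′ n)) (proj₂ (p ε 0<ε) n N≤n)

*ᴿ-congˡ : ∀ x y y′ → y ≈ᴿ y′ → x *ᴿ y ≈ᴿ x *ᴿ y′
*ᴿ-congˡ x y y′ p ε 0<ε =
  let (A , 0<A , M , bx) = eventually-bounded x
      (N , h) = p (ε ÷₀ A) (÷₀-pos 0<ε 0<A)
  in M ℕ.⊔ N , λ n n≥ → subst₂ _≤_
      (cong ∣_∣ (solve 3 (λ a b c → (b :- c) :* a := a :* b :- a :* c) refl (seq x n) (seq y n) (seq y′ n)))
      (÷₀-cancel ε (λ e → <⇒≢ 0<A (sym e)))
      (*-bound (h n (ℕ.m⊔n≤o⇒n≤o M N n≥)) (bx n (ℕ.m⊔n≤o⇒m≤o M N n≥)))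

*ᴿ-comm : ∀ x y → x *ᴿ y ≈ᴿ y *ᴿ x
*ᴿ-comm x y ε 0<ε = 0 , λ n _ → subst (_≤ ε)
  (sym (cong ∣_∣ (solve 2 (λ a b → a :* b :- b :* a := con 0ℚ) refl (seq x n) (seq y n)))) (<⇒≤ 0<ε)

*ᴿ-cong : ∀ x x′ y y′ → x ≈ᴿ x′ → y ≈ᴿ y′ → x *ᴿ y ≈ᴿ x′ *ᴿ y′
*ᴿ-cong x x′ y y′ p q = ≈ᴿ-trans (x *ᴿ y) (x *ᴿ y′) (x′ *ᴿ y′) (*ᴿ-congˡ x y y′ q)
  (≈ᴿ-trans (x *ᴿ y′) (y′ *ᴿ x) (x′ *ᴿ y′) (*ᴿ-comm x y′)
    (≈ᴿ-trans (y′ *ᴿ x) (y′ *ᴿ x′) (x′ *ᴿ y′) (*ᴿ-congˡ y′ x x′ p) (*ᴿ-comm y′ x′)))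

≤ᴿ-resp-≈ᴿ : ∀ x x′ y y′ → x ≈ᴿ x′ → y ≈ᴿ y′ → x ≤ᴿ y → x′ ≤ᴿ y′
≤ᴿ-resp-≈ᴿ x x′ y y′ p q r ε 0<ε =
  let ε₁ = ½ * ε
      ε₂ = ½ * ε₁
      (L , hp) = p ε₂ (half-pos (half-pos 0<ε))
      (M , hq) = q ε₂ (half-pos (half-pos 0<ε))
      (N , hr) = r ε₁ (half-pos 0<ε)
  in L ℕ.⊔ (M ℕ.⊔ N) , λ n n≥ →
    let MN≤n = ℕ.m⊔n≤o⇒n≤o L (M ℕ.⊔ N) n≥
        a = seq x n ; a′ = seq x′ n ; b = seq y n ; b′ = seq y′ n
        a′≤ : a′ - a ≤ ε₂
        a′≤ = ≤-trans (p≤∣p∣ (a′ - a)) (subst (_≤ ε₂) (∣-∣-swap a a′) (hp n (ℕ.m⊔n≤o⇒m≤o L (M ℕ.⊔ N) n≥)))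
        b≤ : b - b′ ≤ ε₂
        b≤ = ≤-trans (p≤∣p∣ (b - b′)) (hq n (ℕ.m⊔n≤o⇒m≤o M N MN≤n))
        a≤ : a ≤ b + ε₁
        a≤ = hr n (ℕ.m⊔n≤o⇒n≤o M N MN≤n)
        b≤b′ : b ≤ ε₂ + b′
        b≤b′ = subst (_≤ ε₂ + b′) (solve 2 (λ u v → (u :- v) :+ v := u) refl b b′) (+-monoˡ-≤ b′ b≤)
    in subst₂ _≤_
         (solve 2 (λ u v → (u :- v) :+ v := u) refl a′ a)
         (trans (solve 3 (λ e f u → e :+ ((e :+ u) :+ f) := u :+ (f :+ (e :+ e))) refl ε₂ ε₁ b′)
           (trans (cong (λ w → b′ + (ε₁ + w)) (half+half ε₁)) (cong (_+_ b′) (half+half ε))))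
         (+-mono-≤ a′≤ (≤-trans a≤ (+-monoˡ-≤ ε₁ b≤b′)))

eventually-≤⇒≤ᴿ : ∀ x y N → (∀ n → N ℕ.≤ n → seq x n ≤ seq y n) → x ≤ᴿ y
eventually-≤⇒≤ᴿ x y N p ε 0<ε = N , λ n N≤n → ≤-trans (p n N≤n) (p≤p+q (seq y n) (<⇒≤ 0<ε))

-- The weighted norm

^ℚ-+ : ∀ q m n → q ^ℚ (m ℕ.+ n) ≡ q ^ℚ m * q ^ℚ n
^ℚ-+ q zero    n = sym (*-identityˡ (q ^ℚ n))
^ℚ-+ q (suc m) n = trans (cong (q *_) (^ℚ-+ q m n)) (sym (*-assoc q (q ^ℚ m) (q ^ℚ n)))

ρ : ℚ
ρ = + 19 / 10

0≤ρ : 0ℚ ≤ ρ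
0≤ρ = nonNegative⁻¹ ρ

-- The factor (j + 1)² absorbs the polynomial losses incurred in comparing
-- neighbouring Poisson weights, and keeps the weight submultiplicative.
w : Series
w j = fromℕ (suc j) * fromℕ (suc j) * ρ ^ℚ j

0≤w : ∀ j → 0ℚ ≤ w j
0≤w j = 0≤* (0≤* (0≤fromℕ (suc j)) (0≤fromℕ (suc j))) (^ℚ-nonNeg j 0≤ρ)

w-+ : ∀ i j → w (i ℕ.+ j) ≤ w i * w j
w-+ i j = begin
  m * m * ρ ^ℚ (i ℕ.+ j)                   ≤⟨ *-monoʳ (^ℚ-nonNeg (i ℕ.+ j) 0≤ρ) (*-mono {m} {a * b} {m} {a * b} 0≤m (≤-trans 0≤m m≤) m≤ m≤) ⟩
  a * b * (a * b) * ρ ^ℚ (i ℕ.+ j)         ≡⟨ cong (a * b * (a * b) *_) (^ℚ-+ ρ i j) ⟩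
  a * b * (a * b) * (ρ ^ℚ i * ρ ^ℚ j)      ≡⟨ solve 4 (λ a b x y → a :* b :* (a :* b) :* (x :* y) := a :* a :* x :* (b :* b :* y)) refl a b (ρ ^ℚ i) (ρ ^ℚ j) ⟩
  w i * w j                                ∎
  where
  open ≤-Reasoning
  m = fromℕ (suc (i ℕ.+ j))
  a = fromℕ (suc i)
  b = fromℕ (suc j)
  0≤m : 0ℚ ≤ m
  0≤m = 0≤fromℕ (suc (i ℕ.+ j))
  m≤ : m ≤ a * b
  m≤ = subst (m ≤_) (fromℕ-* (suc i) (suc j)) (fromℕ-mono-≤ (ℕ.s≤s
    (ℕ.≤-trans (ℕ.≤-reflexive (ℕ.+-comm i j)) (ℕ.+-monoʳ-≤ j (ℕ.m≤m*n i (suc j))))))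

weigh : Series → Series → Series
weigh u a j = ∣ a j ∣ * u j

weigh-nonNeg : ∀ {u} → (∀ j → 0ℚ ≤ u j) → ∀ a j → 0ℚ ≤ weigh u a j
weigh-nonNeg 0≤u a j = 0≤* (0≤∣p∣ (a j)) (0≤u j)

-- Three separate weights are allowed because the induction strips the head of `a`: this shifts `u`
-- and `u′` but leaves `v` in place.
weigh-⊛ : ∀ {u u′ v} → (∀ j → 0ℚ ≤ u j) → (∀ i j → u (i ℕ.+ j) ≤ u′ i * v j) →
          ∀ a b n → weigh u (a ⊛ b) n ≤ (weigh u′ a ⊛ weigh v b) n
weigh-⊛ {u} {u′} {v} 0≤u u≤ a b n = go n
  where
  open ≤-Reasoning
  head : ∀ n → ∣ a 0 * b n ∣ * u n ≤ weigh u′ a 0 * weigh v b n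
  head n = begin
    ∣ a 0 * b n ∣ * u n                ≡⟨ cong (_* u n) (∣p*q∣≡∣p∣*∣q∣ (a 0) (b n)) ⟩
    ∣ a 0 ∣ * ∣ b n ∣ * u n            ≤⟨ *-monoˡ (0≤* (0≤∣p∣ (a 0)) (0≤∣p∣ (b n))) (u≤ 0 n) ⟩
    ∣ a 0 ∣ * ∣ b n ∣ * (u′ 0 * v n)   ≡⟨ solve 4 (λ x y s t → x :* y :* (s :* t) := x :* s :* (y :* t)) refl ∣ a 0 ∣ ∣ b n ∣ (u′ 0) (v n) ⟩
    weigh u′ a 0 * weigh v b n         ∎
  go : ∀ n → weigh u (a ⊛ b) n ≤ (weigh u′ a ⊛ weigh v b) n
  go zero    = head 0
  go (suc n) = begin
    ∣ a 0 * b (suc n) + (tail a ⊛ b) n ∣ * u (suc n)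
      ≤⟨ *-monoʳ (0≤u (suc n)) (∣p+q∣≤∣p∣+∣q∣ (a 0 * b (suc n)) ((tail a ⊛ b) n)) ⟩
    (∣ a 0 * b (suc n) ∣ + ∣ (tail a ⊛ b) n ∣) * u (suc n)
      ≡⟨ *-distribʳ-+ (u (suc n)) ∣ a 0 * b (suc n) ∣ ∣ (tail a ⊛ b) n ∣ ⟩
    ∣ a 0 * b (suc n) ∣ * u (suc n) + weigh (tail u) (tail a ⊛ b) n
      ≤⟨ +-mono-≤ (head (suc n)) (weigh-⊛ {tail u} {tail u′} {v} (0≤u ∘ suc) (u≤ ∘ suc) (tail a) b n) ⟩
    (weigh u′ a ⊛ weigh v b) (suc n) ∎

-- A weighted ℓ¹ norm cut off after n terms: its values are rational, and coefficients beyond the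
-- truncation order, where no estimate is available, never enter.
∥_∥ : Series → ℕ → ℚ
∥ a ∥ n = ∑ (weigh w a) n

∥∥-nonNeg : ∀ a n → 0ℚ ≤ ∥ a ∥ n
∥∥-nonNeg a n = ∑-nonNeg n (weigh-nonNeg 0≤w a)

∥∥-cong : ∀ {a b} → a ≗ b → ∀ n → ∥ a ∥ n ≡ ∥ b ∥ n
∥∥-cong p = ∑-cong (λ j → cong (λ x → ∣ x ∣ * w j) (p j))

∥⊛∥ : ∀ a b n → ∥ a ⊛ b ∥ n ≤ ∥ a ∥ n * ∥ b ∥ n
∥⊛∥ a b n = ≤-trans (∑-mono n (λ j _ → weigh-⊛ {w} {w} {w} 0≤w w-+ a b j))
  (∑-⊛-≤ (weigh-nonNeg 0≤w a) (weigh-nonNeg 0≤w b) n)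

∥⊕∥ : ∀ a b n → ∥ a ⊕ b ∥ n ≤ ∥ a ∥ n + ∥ b ∥ n
∥⊕∥ a b n = subst (∥ a ⊕ b ∥ n ≤_) (∑-⊕ (weigh w a) (weigh w b) n) (∑-mono n λ j _ →
  subst (∣ a j + b j ∣ * w j ≤_) (*-distribʳ-+ (w j) ∣ a j ∣ ∣ b j ∣) (*-monoʳ (0≤w j) (∣p+q∣≤∣p∣+∣q∣ (a j) (b j))))

∥·∥ : ∀ q a n → ∥ q · a ∥ n ≡ ∣ q ∣ * ∥ a ∥ n
∥·∥ q a n = trans (∑-cong (λ j → trans (cong (_* w j) (∣p*q∣≡∣p∣*∣q∣ q (a j))) (*-assoc ∣ q ∣ ∣ a j ∣ (w j))) n)
  (∑-· ∣ q ∣ (weigh w a) n)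

∥δ∥≤1 : ∀ n → ∥ δ ∥ n ≤ 1ℚ
∥δ∥≤1 zero    = 0≤1
∥δ∥≤1 (suc n) = ≤-reflexive (cong (_+_ 1ℚ) (trans (∑-· 0ℚ (tail w) n) (*-zeroˡ (∑ (tail w) n))))

-- The polynomial 1 - z has norm w 0 + w 1 = 1 + 7.6, rounded up to 9.
∥∇∥ : ∀ a n → ∥ ∇ a ∥ n ≤ fromℕ 9 * ∥ a ∥ n
∥∇∥ a zero    = ≤-refl
∥∇∥ a (suc n) = begin
  ∣ a 0 ∣ * w 0 + ∑ (tail (weigh w (∇ a))) n
    ≤⟨ +-monoʳ-≤ (∣ a 0 ∣ * w 0) (∑-mono n λ j _ → step j) ⟩
  ∣ a 0 ∣ * w 0 + ∑ (tail (weigh w a) ⊕ w 1 · weigh w a) n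
    ≡⟨ cong (_+_ (∣ a 0 ∣ * w 0)) (trans (∑-⊕ (tail (weigh w a)) (w 1 · weigh w a) n) (cong (_+_ (∑ (tail (weigh w a)) n)) (∑-· (w 1) (weigh w a) n))) ⟩
  ∣ a 0 ∣ * w 0 + (∑ (tail (weigh w a)) n + w 1 * ∥ a ∥ n)
    ≡⟨ sym (+-assoc (∣ a 0 ∣ * w 0) (∑ (tail (weigh w a)) n) (w 1 * ∥ a ∥ n)) ⟩
  ∥ a ∥ (suc n) + w 1 * ∥ a ∥ n
    ≤⟨ +-monoʳ-≤ (∥ a ∥ (suc n)) (*-mono (0≤w 1) (∥∥-nonNeg a (suc n)) w₁≤8 (∑-monoˡ (weigh-nonNeg 0≤w a) (ℕ.n≤1+n n))) ⟩
  ∥ a ∥ (suc n) + fromℕ 8 * ∥ a ∥ (suc n)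
    ≡⟨ solve 1 (λ x → x :+ con (fromℕ 8) :* x := con (fromℕ 9) :* x) refl (∥ a ∥ (suc n)) ⟩
  fromℕ 9 * ∥ a ∥ (suc n) ∎
  where
  open ≤-Reasoning
  w₁≤8 : w 1 ≤ fromℕ 8
  w₁≤8 = ≤-by (+ 2 / 5) (nonNegative⁻¹ (+ 2 / 5)) refl
  step : ∀ j → ∣ a (suc j) - a j ∣ * w (suc j) ≤ ∣ a (suc j) ∣ * w (suc j) + w 1 * (∣ a j ∣ * w j)
  step j = begin
    ∣ a (suc j) - a j ∣ * w (suc j)                         ≤⟨ *-monoʳ (0≤w (suc j)) (∣p-q∣≤∣p∣+∣q∣ (a (suc j)) (a j)) ⟩
    (∣ a (suc j) ∣ + ∣ a j ∣) * w (suc j)                   ≡⟨ *-distribʳ-+ (w (suc j)) ∣ a (suc j) ∣ ∣ a j ∣ ⟩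
    ∣ a (suc j) ∣ * w (suc j) + ∣ a j ∣ * w (suc j)         ≤⟨ +-monoʳ-≤ (∣ a (suc j) ∣ * w (suc j)) (*-monoˡ (0≤∣p∣ (a j)) (w-+ 1 j)) ⟩
    ∣ a (suc j) ∣ * w (suc j) + ∣ a j ∣ * (w 1 * w j)       ≡⟨ cong (_+_ (∣ a (suc j) ∣ * w (suc j))) (solve 3 (λ x y z → x :* (y :* z) := y :* (x :* z)) refl ∣ a j ∣ (w 1) (w j)) ⟩
    ∣ a (suc j) ∣ * w (suc j) + w 1 * (∣ a j ∣ * w j)       ∎

-- The polynomial G(m) = 20m² + 760m + 14820 solves G(m) - (19/20) G(m + 1) = m²,
-- so that the sum of the series ∑ (j + 1)² (19/20)ʲ is G(1) = 15600.
geometricBound : ℚ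
geometricBound = fromℕ 15600

∑½w≤ : ∀ n → ∑ (λ j → ½ ^ℚ j * w j) n ≤ geometricBound
∑½w≤ n = ≤-by (y ^ℚ n * G n) (0≤* (^ℚ-nonNeg n (nonNegative⁻¹ y)) 0≤G) (sym (exact n))
  where
  open ≡-Reasoning
  y : ℚ
  y = + 19 / 20
  poly : ℚ → ℚ
  poly m = fromℕ 20 * (m * m) + fromℕ 760 * m + fromℕ 14820
  G : ℕ → ℚ
  G n = poly (fromℕ (suc n))
  0≤G : 0ℚ ≤ G n
  0≤G = 0≤+ (0≤+ (0≤* (0≤fromℕ 20) (0≤p*p (fromℕ (suc n)))) (0≤* (0≤fromℕ 760) (0≤fromℕ (suc n)))) (0≤fromℕ 14820)
  exact : ∀ n → ∑ (λ j → ½ ^ℚ j * w j) n + y ^ℚ n * G n ≡ geometricBound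
  exact zero    = refl
  exact (suc n) = begin
    ∑ (λ j → ½ ^ℚ j * w j) (suc n) + y * y ^ℚ n * G (suc n)
      ≡⟨ cong₂ (λ s t → s + y * y ^ℚ n * poly t) (∑-suc′ (λ j → ½ ^ℚ j * w j) n) (fromℕ-suc (suc n)) ⟩
    S + ½ ^ℚ n * (m * m * ρ ^ℚ n) + y * y ^ℚ n * poly (1ℚ + m)
      ≡⟨ cong (λ t → S + t + y * y ^ℚ n * poly (1ℚ + m)) (trans (solve 3 (λ a b c → a :* (b :* c) := b :* (a :* c)) refl (½ ^ℚ n) (m * m) (ρ ^ℚ n)) (cong (m * m *_) (sym (^ℚ-distrib-* ½ ρ n)))) ⟩
    S + m * m * y ^ℚ n + y * y ^ℚ n * poly (1ℚ + m)
      ≡⟨ solve 3 (λ s m z → s :+ m :* m :* z :+ con y :* z :* (con (fromℕ 20) :* ((con 1ℚ :+ m) :* (con 1ℚ :+ m)) :+ con (fromℕ 760) :* (con 1ℚ :+ m) :+ con (fromℕ 14820))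
                         := s :+ z :* (con (fromℕ 20) :* (m :* m) :+ con (fromℕ 760) :* m :+ con (fromℕ 14820))) refl S m (y ^ℚ n) ⟩
    S + y ^ℚ n * G n
      ≡⟨ exact n ⟩
    geometricBound ∎
    where
    S = ∑ (λ j → ½ ^ℚ j * w j) n
    m = fromℕ (suc n)

-- Decay like 2⁻ʲ is what the prime 2 permits. Against the radius 1.9 it leaves the ratio 19/20,
-- hence a finite bound.
∥∥-geometric : ∀ q {a} n → 0ℚ ≤ q → (∀ j → j ℕ.< n → ∣ a j ∣ ≤ q * ½ ^ℚ j) → ∥ a ∥ n ≤ q * geometricBound
∥∥-geometric q {a} n 0≤q a≤ = begin
  ∥ a ∥ n                                ≤⟨ ∑-mono n (λ j j<n → ≤-trans (*-monoʳ (0≤w j) (a≤ j j<n)) (≤-reflexive (*-assoc q (½ ^ℚ j) (w j)))) ⟩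
  ∑ (q · (λ j → ½ ^ℚ j * w j)) n         ≡⟨ ∑-· q (λ j → ½ ^ℚ j * w j) n ⟩
  q * ∑ (λ j → ½ ^ℚ j * w j) n           ≤⟨ *-monoˡ 0≤q (∑½w≤ n) ⟩
  q * geometricBound                     ∎
  where open ≤-Reasoning

-- The pairing of a weighted ℓ¹ norm with the dual supremum norm, seen from index k. Both ranges of
-- the theorem go through it, with different values of M.
∣⊛∣≤∥∥* : ∀ a b k M → (∀ i j → i ℕ.+ j ≡ k → ∣ b j ∣ ≤ w i * M) → ∣ (a ⊛ b) k ∣ ≤ ∥ a ∥ (suc k) * M
∣⊛∣≤∥∥* a b k M h = go w a k h
  where
  open ≤-Reasoning
  -- The weight is generalised, since stripping the head of `a` replaces `w` by its tail.
  go : ∀ u a k → (∀ i j → i ℕ.+ j ≡ k → ∣ b j ∣ ≤ u i * M) → ∣ (a ⊛ b) k ∣ ≤ ∑ (weigh u a) (suc k) * M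
  head : ∀ u (a : Series) k → ∣ b k ∣ ≤ u 0 * M → ∣ a 0 * b k ∣ ≤ weigh u a 0 * M
  head u a k h₀ = begin
    ∣ a 0 * b k ∣         ≤⟨ *-bound {a 0} {b k} ≤-refl h₀ ⟩
    ∣ a 0 ∣ * (u 0 * M)   ≡⟨ sym (*-assoc ∣ a 0 ∣ (u 0) M) ⟩
    weigh u a 0 * M       ∎
  go u a zero    h = ≤-trans (head u a 0 (h 0 0 refl)) (≤-reflexive (cong (_* M) (sym (+-identityʳ (weigh u a 0)))))
  go u a (suc k) h = begin
    ∣ a 0 * b (suc k) + (tail a ⊛ b) k ∣                        ≤⟨ ∣p+q∣≤∣p∣+∣q∣ (a 0 * b (suc k)) ((tail a ⊛ b) k) ⟩
    ∣ a 0 * b (suc k) ∣ + ∣ (tail a ⊛ b) k ∣                    ≤⟨ +-mono-≤ (head u a (suc k) (h 0 (suc k) refl)) (go (tail u) (tail a) k (λ i j e → h (suc i) j (cong suc e))) ⟩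
    weigh u a 0 * M + ∑ (weigh (tail u) (tail a)) (suc k) * M   ≡⟨ sym (*-distribʳ-+ M (weigh u a 0) (∑ (weigh (tail u) (tail a)) (suc k))) ⟩
    ∑ (weigh u a) (suc (suc k)) * M                             ∎

-- One prime

-- In terms of t = λ(z - 1) the equation says f·(1 - t) = 1 - κt²: the Bernoulli
-- factor f = 1 + t has κ = 1 and the geometric factor f = 1/(1 - t) has κ = 0.
record Factor : Set where
  field
    rate        : ℚ
    gf          : Series
    κ           : ℚ
    rate-pos    : 0ℚ < rate
    rate≤1      : rate ≤ 1ℚ
    κ-nonNeg    : 0ℚ ≤ κ
    κ≤1         : κ ≤ 1ℚ
    gf-bound    : ∀ j → ∣ gf j ∣ ≤ ½ ^ℚ j
    gf-equation : gf ⊕ rate · ∇ gf ≗ δ ⊕ (- (κ * (rate * rate))) · ∇ (∇ δ)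

  rate-nonNeg : 0ℚ ≤ rate
  rate-nonNeg = <⇒≤ rate-pos

E₁ : ∀ q → E q 1 ≡ q
E₁ q = *-cancelʳ (fromℕ 1) (0<fromℕ 1) (trans (expTerm-suc q 0) (solve 1 (λ q → con 1ℚ :* q := q :* con 1ℚ) refl q))

E₂ : ∀ q → E q 2 ≡ ½ * (q * q)
E₂ q = *-cancelʳ (fromℕ 2) (0<fromℕ 2) (trans (expTerm-suc q 1) (trans (cong (_* q) (E₁ q))
  (solve 1 (λ q → q :* q := con ½ :* (q :* q) :* con (fromℕ 2)) refl q)))

E₃ : ∀ q → E q 3 ≡ (+ 1 / 6) * (q * (q * q))
E₃ q = *-cancelʳ (fromℕ 3) (0<fromℕ 3) (trans (expTerm-suc q 2) (trans (cong (_* q) (E₂ q))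
  (solve 1 (λ q → con ½ :* (q :* q) :* q := con (+ 1 / 6) :* (q :* (q :* q)) :* con (fromℕ 3)) refl q)))

E₄ : ∀ q → E q 4 ≡ (+ 1 / 24) * (q * (q * (q * q)))
E₄ q = *-cancelʳ (fromℕ 4) (0<fromℕ 4) (trans (expTerm-suc q 3) (trans (cong (_* q) (E₃ q))
  (solve 1 (λ q → con (+ 1 / 6) :* (q :* (q :* q)) :* q := con (+ 1 / 24) :* (q :* (q :* (q :* q))) :* con (fromℕ 4)) refl q)))

-- Partial sums of exp(-l) for 0 ≤ l ≤ 1

module _ {l : ℚ} (0≤l : 0ℚ ≤ l) (l≤1 : l ≤ 1ℚ) where

  ∣E-∣ : ∀ n → ∣ E (- l) n ∣ ≡ E l n
  ∣E-∣ n = trans (∣E∣ (- l) n) (cong (λ x → E x n) (trans (∣-p∣≡∣p∣ l) (0≤p⇒∣p∣≡p 0≤l)))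

  E-halves : ∀ n → E l (suc (suc n)) + E l (suc (suc n)) ≤ E l (suc n)
  E-halves n = subst₂ _≤_ (cong₂ _+_ (∣E-∣ (suc (suc n))) (∣E-∣ (suc (suc n)))) (∣E-∣ (suc n))
    (expTerm-halves (- l) (suc n) (≤-trans (+-mono-≤ ∣-l∣≤1 ∣-l∣≤1) (fromℕ-mono-≤ {2} {suc (suc n)} (ℕ.s≤s (ℕ.s≤s ℕ.z≤n)))))
    where
    ∣-l∣≤1 : ∣ - l ∣ ≤ 1ℚ
    ∣-l∣≤1 = subst (_≤ 1ℚ) (sym (trans (∣-p∣≡∣p∣ l) (0≤p⇒∣p∣≡p 0≤l))) l≤1

  E-decay : ∀ j → E l (suc j) ≤ l * ½ ^ℚ j
  E-decay zero    = ≤-reflexive (trans (E₁ l) (sym (*-identityʳ l)))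
  E-decay (suc j) = begin
    E l (suc (suc j))                                  ≡⟨ solve 1 (λ x → x := con ½ :* (x :+ x)) refl (E l (suc (suc j))) ⟩
    ½ * (E l (suc (suc j)) + E l (suc (suc j)))        ≤⟨ *-monoˡ (nonNegative⁻¹ ½) (≤-trans (E-halves j) (E-decay j)) ⟩
    ½ * (l * ½ ^ℚ j)                                   ≡⟨ solve 3 (λ h l x → h :* (l :* x) := l :* (h :* x)) refl ½ l (½ ^ℚ j) ⟩
    l * ½ ^ℚ suc j                                     ∎
    where open ≤-Reasoning

  private
    -- The doubled last term drives the induction: one copy pays for the summand being added, and
    -- the other, by `E-halves`, for two copies of the term after it.
    tail≤ : ∀ n d → ∣ expSum (- l) (d ℕ.+ suc n) - expSum (- l) (suc n) ∣ + (E l (d ℕ.+ suc n) + E l (d ℕ.+ suc n))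
                    ≤ E l (suc n) + E l (suc n)
    tail≤ n zero = ≤-reflexive (trans (cong (λ x → ∣ x ∣ + (E l (suc n) + E l (suc n))) (+-inverseʳ (expSum (- l) (suc n))))
                                       (+-identityˡ (E l (suc n) + E l (suc n))))
    tail≤ n (suc d) = begin
      ∣ (S + e) - s ∣ + (E l (suc m) + E l (suc m))
        ≡⟨ cong (λ x → ∣ x ∣ + (E l (suc m) + E l (suc m))) (solve 3 (λ x y z → (x :+ z) :- y := (x :- y) :+ z) refl S s e) ⟩
      ∣ (S - s) + e ∣ + (E l (suc m) + E l (suc m))
        ≤⟨ +-mono-≤ (∣p+q∣≤∣p∣+∣q∣ (S - s) e) (subst (λ m → E l (suc m) + E l (suc m) ≤ E l m) (sym (ℕ.+-suc d n)) (E-halves (d ℕ.+ n))) ⟩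
      ∣ S - s ∣ + ∣ e ∣ + E l m
        ≡⟨ trans (cong (λ x → ∣ S - s ∣ + x + E l m) (∣E-∣ m)) (+-assoc ∣ S - s ∣ (E l m) (E l m)) ⟩
      ∣ S - s ∣ + (E l m + E l m)
        ≤⟨ tail≤ n d ⟩
      E l (suc n) + E l (suc n) ∎
      where
      open ≤-Reasoning
      m : ℕ
      m = d ℕ.+ suc n
      S s e : ℚ
      S = expSum (- l) m
      s = expSum (- l) (suc n)
      e = E (- l) m

  -- The comparison starts at order at least 1, because the term of index 1 is at most half of that
  -- of index 0 only for l ≤ 1/2.
  expSum-tail : ∀ n N → suc n ℕ.≤ N → ∣ expSum (- l) N - expSum (- l) (suc n) ∣ ≤ E l (suc n) + E l (suc n)
  expSum-tail n N n<N = ≤-trans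
    (subst (λ m → ∣ expSum (- l) N - expSum (- l) (suc n) ∣ ≤ ∣ expSum (- l) m - expSum (- l) (suc n) ∣ + (E l m + E l m)) (sym m≡N)
      (p≤p+q _ (0≤+ (E-nonNeg 0≤l N) (E-nonNeg 0≤l N))))
    (tail≤ n (N ℕ.∸ suc n))
    where
    m≡N : N ℕ.∸ suc n ℕ.+ suc n ≡ N
    m≡N = ℕ.m∸n+n≡m n<N

  module _ {N : ℕ} (4≤N : 4 ℕ.≤ N) where
    private
      c : ℚ
      c = expSum (- l) N

    expSum-≤3 : c ≤ fromℕ 3
    expSum-≤3 = begin
      c                                                          ≡⟨ solve 1 (λ c → c := (c :- con 1ℚ) :+ con 1ℚ) refl c ⟩
      (c - 1ℚ) + 1ℚ                                              ≤⟨ +-monoˡ-≤ 1ℚ (≤-trans (p≤∣p∣ (c - 1ℚ)) (expSum-tail 0 N (ℕ.≤-trans (ℕ.s≤s ℕ.z≤n) 4≤N))) ⟩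
      E l 1 + E l 1 + 1ℚ                                         ≤⟨ +-monoˡ-≤ 1ℚ (+-mono-≤ E₁≤1 E₁≤1) ⟩
      fromℕ 3                                                    ∎
      where
      open ≤-Reasoning
      E₁≤1 : E l 1 ≤ 1ℚ
      E₁≤1 = subst (_≤ 1ℚ) (sym (E₁ l)) l≤1

    -- The partial sum of order 4 exceeds the tail bound 2 l⁴/24 by at least 1/4, with equality at l
    -- = 1. A lower bound on the mass is what turns additive errors O(λ²) into relative ones.
    expSum-≥¼ : + 1 / 4 ≤ c
    expSum-≥¼ = ≤-by (d₁ + d₂ + d₃) (0≤+ (0≤+ 0≤d₁ 0≤d₂) 0≤d₃) (begin
        c
          ≡⟨ solve 3 (λ c s e → c := (s :- (e :+ e)) :+ ((e :+ e) :+ (c :- s))) refl c (expSum (- l) 4) (E l 4) ⟩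
        (expSum (- l) 4 - (E l 4 + E l 4)) + d₃
          ≡⟨ cong (_+ d₃) (cong₂ _-_ s₄ (cong₂ _+_ (E₄ l) (E₄ l))) ⟩
        (((0ℚ + 1ℚ + - l) + ½ * (- l * - l)) + (+ 1 / 6) * (- l * (- l * - l)) - ((+ 1 / 24) * (l * (l * (l * l))) + (+ 1 / 24) * (l * (l * (l * l))))) + d₃
          ≡⟨ solve 2 (λ l d → (((con 0ℚ :+ con 1ℚ :+ :- l) :+ con ½ :* (:- l :* :- l)) :+ con (+ 1 / 6) :* (:- l :* (:- l :* :- l)) :- (con (+ 1 / 24) :* (l :* (l :* (l :* l))) :+ con (+ 1 / 24) :* (l :* (l :* (l :* l))))) :+ d
               := con (+ 1 / 4) :+ (con (+ 1 / 4) :* ((con 1ℚ :- l) :* (con (fromℕ 2) :+ (con 1ℚ :- l))) :+ con (+ 1 / 12) :* ((l :* l) :* ((con 1ℚ :- l) :* (con (fromℕ 3) :+ l))) :+ d)) refl l d₃ ⟩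
        + 1 / 4 + (d₁ + d₂ + d₃) ∎)
      where
      open ≡-Reasoning
      -- Up to the slack `d₃` of the tail, the excess over 1/4 is a polynomial vanishing at l = 1;
      -- `d₁` and `d₂` are its two parts with the root divided out.
      d₁ d₂ d₃ : ℚ
      d₁ = (+ 1 / 4) * ((1ℚ - l) * (fromℕ 2 + (1ℚ - l)))
      d₂ = (+ 1 / 12) * ((l * l) * ((1ℚ - l) * (fromℕ 3 + l)))
      d₃ = (E l 4 + E l 4) + (c - expSum (- l) 4)
      0≤1-l : 0ℚ ≤ 1ℚ - l
      0≤1-l = p≤q⇒0≤q-p l≤1
      0≤d₁ : 0ℚ ≤ d₁
      0≤d₁ = 0≤* (nonNegative⁻¹ (+ 1 / 4)) (0≤* 0≤1-l (0≤+ (0≤fromℕ 2) 0≤1-l))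
      0≤d₂ : 0ℚ ≤ d₂
      0≤d₂ = 0≤* (nonNegative⁻¹ (+ 1 / 12)) (0≤* (0≤p*p l) (0≤* 0≤1-l (0≤+ (0≤fromℕ 3) 0≤l)))
      0≤d₃ : 0ℚ ≤ d₃
      0≤d₃ = subst (_≤ d₃) (+-inverseˡ (c - expSum (- l) 4)) (+-monoˡ-≤ (c - expSum (- l) 4)
        (≤-trans (-p≤∣p∣ (c - expSum (- l) 4)) (expSum-tail 3 N 4≤N)))
      s₄ : expSum (- l) 4 ≡ ((0ℚ + 1ℚ + - l) + ½ * (- l * - l)) + (+ 1 / 6) * (- l * (- l * - l))
      s₄ = cong₂ _+_ (cong₂ _+_ (cong (_+_ 1ℚ) (E₁ (- l))) (E₂ (- l))) (E₃ (- l))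

    expSum-nonNeg : 0ℚ ≤ c
    expSum-nonNeg = ≤-trans (nonNegative⁻¹ (+ 1 / 4)) expSum-≥¼

-- For c = e^{-l} this is (c(1 - l(z - 1)) - e^{-lz}) / (1 - z)².
remainder : ℚ → ℚ → Series
remainder l c j = fromℕ (suc j) * (c - expSum (- l) (suc j)) + l * (c - expSum (- l) j)

module _ (l c : ℚ) where
  private
    v u : Series
    v = remainder l c
    u j = (c - expSum (- l) (suc j)) + l * c * δ j

    ∇v : ∇ v ≗ u
    ∇v zero    = solve 2 (λ l c → con 1ℚ :* (c :- con 1ℚ) :+ l :* (c :- con 0ℚ) := (c :- con 1ℚ) :+ l :* c :* con 1ℚ) refl l c
    ∇v (suc j) = begin
      (fromℕ (suc (suc j)) * (c - ((B + e) + e′)) + l * (c - (B + e))) - (m * (c - (B + e)) + l * (c - B))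
        ≡⟨ cong (λ x → (x * (c - ((B + e) + e′)) + l * (c - (B + e))) - (m * (c - (B + e)) + l * (c - B))) (fromℕ-suc (suc j)) ⟩
      ((1ℚ + m) * (c - ((B + e) + e′)) + l * (c - (B + e))) - (m * (c - (B + e)) + l * (c - B))
        ≡⟨ solve 6 (λ m c B e e′ l → ((con 1ℚ :+ m) :* (c :- ((B :+ e) :+ e′)) :+ l :* (c :- (B :+ e))) :- (m :* (c :- (B :+ e)) :+ l :* (c :- B))
             := (c :- ((B :+ e) :+ e′)) :+ (:- (e′ :* m :- e :* :- l))) refl m c B e e′ l ⟩
      (c - ((B + e) + e′)) + - (e′ * m - e * - l)
        ≡⟨ cong (λ x → (c - ((B + e) + e′)) + - (x - e * - l)) (expTerm-suc (- l) j) ⟩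
      (c - ((B + e) + e′)) + - (e * - l - e * - l)
        ≡⟨ solve 4 (λ x y l c → x :+ :- (y :- y) := x :+ l :* c :* con 0ℚ) refl (c - ((B + e) + e′)) (e * - l) l c ⟩
      u (suc j) ∎
      where
      open ≡-Reasoning
      m B e e′ : ℚ
      m  = fromℕ (suc j)
      B  = expSum (- l) j
      e  = E (- l) j
      e′ = E (- l) (suc j)

    ∇u : ∀ n → E (- l) n ≡ c * (δ n + l * ∇ δ n) + - 1ℚ * ∇ u n
    ∇u zero    = solve 2 (λ l c → con 1ℚ := c :* (con 1ℚ :+ l :* con 1ℚ) :+ con (- 1ℚ) :* ((c :- con 1ℚ) :+ l :* c :* con 1ℚ)) refl l c
    ∇u (suc j) = solve 5 (λ l c A e d → e := c :* (con 0ℚ :+ l :* (con 0ℚ :- d)) :+ con (- 1ℚ) :* (((c :- (A :+ e)) :+ l :* c :* con 0ℚ) :- ((c :- A) :+ l :* c :* d)))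
      refl l c (expSum (- l) (suc j)) (E (- l) (suc j)) (δ j)

  -- As an identity of formal series this holds for every c, since 1 - z is invertible there. The
  -- choice of c only decides how small the remainder is.
  E-expansion : E (- l) ≗ c · (δ ⊕ l · ∇ δ) ⊕ (- 1ℚ) · ∇ (∇ v)
  E-expansion n = trans (∇u n) (cong (λ x → c * (δ n + l * ∇ δ n) + - 1ℚ * x) (sym (∇-cong ∇v n)))

remainder-bound : ∀ {l} → 0ℚ ≤ l → l ≤ 1ℚ → ∀ {N} → 2 ℕ.≤ N → ∀ j → j ℕ.< N →
                  ∣ remainder l (expSum (- l) N) j ∣ ≤ fromℕ 8 * (l * l) * ½ ^ℚ j
remainder-bound {l} 0≤l l≤1 {N} 2≤N zero _ = begin
  -- At index 0 neither summand is O(l²) by itself, as c is close to 1 - l; regrouping cancels the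
  -- linear terms.
  ∣ 1ℚ * (c - 1ℚ) + l * (c - 0ℚ) ∣                ≡⟨ cong ∣_∣ (solve 2 (λ l c → con 1ℚ :* (c :- con 1ℚ) :+ l :* (c :- con 0ℚ) := (c :- (con 1ℚ :+ :- l)) :+ l :* (c :- con 1ℚ)) refl l c) ⟩
  ∣ (c - (1ℚ + - l)) + l * (c - 1ℚ) ∣             ≤⟨ ∣p+q∣≤∣p∣+∣q∣ (c - (1ℚ + - l)) (l * (c - 1ℚ)) ⟩
  ∣ c - (1ℚ + - l) ∣ + ∣ l * (c - 1ℚ) ∣           ≤⟨ +-mono-≤ b₂ (*-bound {l} {c - 1ℚ} (≤-reflexive (0≤p⇒∣p∣≡p 0≤l)) b₁) ⟩
  (½ * (l * l) + ½ * (l * l)) + l * (l + l)       ≤⟨ ≤-by (fromℕ 5 * (l * l)) (0≤* (0≤fromℕ 5) (0≤p*p l))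
      (solve 1 (λ l → con (fromℕ 8) :* (l :* l) :* con 1ℚ := (con ½ :* (l :* l) :+ con ½ :* (l :* l)) :+ l :* (l :+ l) :+ con (fromℕ 5) :* (l :* l)) refl l) ⟩
  fromℕ 8 * (l * l) * 1ℚ                          ∎
  where
  open ≤-Reasoning
  c : ℚ
  c = expSum (- l) N
  b₁ : ∣ c - 1ℚ ∣ ≤ l + l
  b₁ = subst (∣ c - 1ℚ ∣ ≤_) (cong₂ _+_ (E₁ l) (E₁ l)) (expSum-tail 0≤l l≤1 0 N (ℕ.≤-trans (ℕ.s≤s ℕ.z≤n) 2≤N))
  b₂ : ∣ c - (1ℚ + - l) ∣ ≤ ½ * (l * l) + ½ * (l * l)
  b₂ = subst₂ (λ x y → ∣ c - (1ℚ + x) ∣ ≤ y) (E₁ (- l)) (cong₂ _+_ (E₂ l) (E₂ l)) (expSum-tail 0≤l l≤1 1 N 2≤N)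
remainder-bound {l} 0≤l l≤1 {N} 2≤N (suc j) j<N = begin
  ∣ m * x + l * y ∣                                       ≤⟨ ∣p+q∣≤∣p∣+∣q∣ (m * x) (l * y) ⟩
  ∣ m * x ∣ + ∣ l * y ∣                                   ≤⟨ +-mono-≤ (*-bound {m} {x} (≤-reflexive (0≤p⇒∣p∣≡p (0≤fromℕ (suc (suc j))))) (expSum-tail 0≤l l≤1 (suc j) N j<N))
                                                                      (*-bound {l} {y} (≤-reflexive (0≤p⇒∣p∣≡p 0≤l)) (expSum-tail 0≤l l≤1 j N (ℕ.<⇒≤ j<N))) ⟩
  m * (e′ + e′) + l * (e + e)                             ≡⟨ solve 4 (λ m a l e → m :* (a :+ a) :+ l :* (e :+ e) := (a :* m :+ a :* m) :+ l :* (e :+ e)) refl m e′ l e ⟩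
  (e′ * m + e′ * m) + l * (e + e)                         ≡⟨ cong (λ t → (t + t) + l * (e + e)) (expTerm-suc l (suc j)) ⟩
  (e * l + e * l) + l * (e + e)                           ≡⟨ solve 2 (λ l e → (e :* l :+ e :* l) :+ l :* (e :+ e) := con (fromℕ 4) :* l :* e) refl l e ⟩
  fromℕ 4 * l * e                                         ≤⟨ *-monoˡ (0≤* (0≤fromℕ 4) 0≤l) (E-decay 0≤l l≤1 j) ⟩
  fromℕ 4 * l * (l * ½ ^ℚ j)                              ≡⟨ solve 2 (λ l h → con (fromℕ 4) :* l :* (l :* h) := con (fromℕ 8) :* (l :* l) :* (con ½ :* h)) refl l (½ ^ℚ j) ⟩
  fromℕ 8 * (l * l) * ½ ^ℚ suc j                          ∎
  where
  open ≤-Reasoning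
  c m x y e e′ : ℚ
  c  = expSum (- l) N
  m  = fromℕ (suc (suc j))
  x  = c - expSum (- l) (suc (suc j))
  y  = c - expSum (- l) (suc j)
  e  = E l (suc j)
  e′ = E l (suc (suc j))

module _ (d : Factor) (N : ℕ) where
  open Factor d

  mass : ℚ
  mass = expSum (- rate) N

  damped : Series
  damped = gf ⊛ E (- rate)

  defect : Series
  defect = (- 1ℚ) · (gf ⊛ remainder rate mass) ⊕ (- (mass * (κ * (rate * rate)))) · δ

  -- Multiplying `E-expansion` by `gf` produces f·(1 - t), which `gf-equation` evaluates to 1 - κt².
  -- As t² = λ²(1 - z)², the κ term joins the defect as a constant.
  damped-expansion : damped ≗ mass · δ ⊕ ∇ (∇ defect)
  damped-expansion n = begin
    (gf ⊛ E (- rate)) n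
      ≡⟨ ⊛-cong {gf} (λ _ → refl) (E-expansion rate mass) n ⟩
    (gf ⊛ (mass · (δ ⊕ rate · ∇ δ) ⊕ (- 1ℚ) · ∇ (∇ v))) n
      ≡⟨ ⊛-distribˡ gf (mass · (δ ⊕ rate · ∇ δ)) ((- 1ℚ) · ∇ (∇ v)) n ⟩
    (gf ⊛ (mass · (δ ⊕ rate · ∇ δ))) n + (gf ⊛ ((- 1ℚ) · ∇ (∇ v))) n
      ≡⟨ cong₂ _+_ main (trans (⊛-scaleʳ (- 1ℚ) gf (∇ (∇ v)) n) (cong (- 1ℚ *_) (⊛-∇∇ gf v n))) ⟩
    mass * (δ n + - (κ * (rate * rate)) * ∇ (∇ δ) n) + - 1ℚ * ∇ (∇ (gf ⊛ v)) n
      ≡⟨ solve 5 (λ c d k D V → c :* (d :+ :- k :* D) :+ con (- 1ℚ) :* V := c :* d :+ (con (- 1ℚ) :* V :+ :- (c :* k) :* D)) refl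
           mass (δ n) (κ * (rate * rate)) (∇ (∇ δ) n) (∇ (∇ (gf ⊛ v)) n) ⟩
    mass * δ n + (- 1ℚ * ∇ (∇ (gf ⊛ v)) n + - (mass * (κ * (rate * rate))) * ∇ (∇ δ) n)
      ≡⟨ cong (_+_ (mass * δ n)) (sym (∇∇-linear n)) ⟩
    mass * δ n + ∇ (∇ defect) n ∎
    where
    open ≡-Reasoning
    v = remainder rate mass
    main : (gf ⊛ (mass · (δ ⊕ rate · ∇ δ))) n ≡ mass * (δ n + - (κ * (rate * rate)) * ∇ (∇ δ) n)
    main = begin
      (gf ⊛ (mass · (δ ⊕ rate · ∇ δ))) n                ≡⟨ ⊛-scaleʳ mass gf (δ ⊕ rate · ∇ δ) n ⟩
      mass * (gf ⊛ (δ ⊕ rate · ∇ δ)) n                  ≡⟨ cong (mass *_) (⊛-distribˡ gf δ (rate · ∇ δ) n) ⟩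
      mass * ((gf ⊛ δ) n + (gf ⊛ (rate · ∇ δ)) n)       ≡⟨ cong (mass *_) (cong₂ _+_ (⊛-identityʳ gf n)
                                                             (trans (⊛-scaleʳ rate gf (∇ δ) n) (cong (rate *_) (trans (⊛-∇ gf δ n) (∇-cong (⊛-identityʳ gf) n))))) ⟩
      mass * (gf n + rate * ∇ gf n)                     ≡⟨ cong (mass *_) (gf-equation n) ⟩
      mass * (δ n + - (κ * (rate * rate)) * ∇ (∇ δ) n)  ∎
    ∇∇-linear : ∇ (∇ defect) ≗ (- 1ℚ) · ∇ (∇ (gf ⊛ v)) ⊕ (- (mass * (κ * (rate * rate)))) · ∇ (∇ δ)
    ∇∇-linear n = trans (∇-cong (λ i → trans (∇-⊕ ((- 1ℚ) · (gf ⊛ v)) (y · δ) i) (cong₂ _+_ (∇-· (- 1ℚ) (gf ⊛ v) i) (∇-· y δ i))) n)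
      (trans (∇-⊕ ((- 1ℚ) · ∇ (gf ⊛ v)) (y · ∇ δ) n) (cong₂ _+_ (∇-· (- 1ℚ) (∇ (gf ⊛ v)) n) (∇-· y (∇ δ) n)))
      where y = - (mass * (κ * (rate * rate)))

  module _ (4≤N : 4 ℕ.≤ N) where

    mass-nonNeg : 0ℚ ≤ mass
    mass-nonNeg = expSum-nonNeg rate-nonNeg rate≤1 4≤N

    mass-≥¼ : + 1 / 4 ≤ mass
    mass-≥¼ = expSum-≥¼ rate-nonNeg rate≤1 4≤N

    -- The product of geometric bounds comes from `gf` times the remainder, and the 3 from the κ
    -- term, where the mass is at most 3 and κ at most 1.
    defect-bound : ∀ n → n ℕ.≤ N →
      ∥ defect ∥ n ≤ (geometricBound * (fromℕ 8 * geometricBound) + fromℕ 3) * (rate * rate)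
    defect-bound n n≤N = begin
      ∥ defect ∥ n
        ≤⟨ ∥⊕∥ ((- 1ℚ) · (gf ⊛ v)) ((- x) · δ) n ⟩
      ∥ (- 1ℚ) · (gf ⊛ v) ∥ n + ∥ (- x) · δ ∥ n
        ≡⟨ cong₂ _+_ (trans (∥·∥ (- 1ℚ) (gf ⊛ v) n) (*-identityˡ (∥ gf ⊛ v ∥ n))) (∥·∥ (- x) δ n) ⟩
      ∥ gf ⊛ v ∥ n + ∣ - x ∣ * ∥ δ ∥ n
        ≤⟨ +-mono-≤ (≤-trans (∥⊛∥ gf v n) (*-mono (∥∥-nonNeg gf n) 0≤V ∥gf∥ ∥v∥)) (*-mono (0≤∣p∣ (- x)) 0≤1 ∣x∣≤ (∥δ∥≤1 n)) ⟩
      geometricBound * (fromℕ 8 * (rate * rate) * geometricBound) + fromℕ 3 * (rate * rate) * 1ℚ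
        ≡⟨ solve 3 (λ g e r → g :* (e :* r :* g) :+ con (fromℕ 3) :* r :* con 1ℚ := (g :* (e :* g) :+ con (fromℕ 3)) :* r) refl geometricBound (fromℕ 8) (rate * rate) ⟩
      (geometricBound * (fromℕ 8 * geometricBound) + fromℕ 3) * (rate * rate) ∎
      where
      open ≤-Reasoning
      v = remainder rate mass
      x = mass * (κ * (rate * rate))
      0≤8r : 0ℚ ≤ fromℕ 8 * (rate * rate)
      0≤8r = 0≤* (0≤fromℕ 8) (0≤p*p rate)
      0≤V : 0ℚ ≤ fromℕ 8 * (rate * rate) * geometricBound
      0≤V = 0≤* 0≤8r (0≤fromℕ 15600)
      ∥gf∥ : ∥ gf ∥ n ≤ geometricBound
      ∥gf∥ = subst (∥ gf ∥ n ≤_) (*-identityˡ geometricBound) (∥∥-geometric 1ℚ n 0≤1 (λ j _ → subst (∣ gf j ∣ ≤_) (sym (*-identityˡ (½ ^ℚ j))) (gf-bound j)))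
      ∥v∥ : ∥ v ∥ n ≤ fromℕ 8 * (rate * rate) * geometricBound
      ∥v∥ = ∥∥-geometric (fromℕ 8 * (rate * rate)) n 0≤8r (λ j j<n →
        remainder-bound rate-nonNeg rate≤1 (ℕ.≤-trans (ℕ.s≤s (ℕ.s≤s ℕ.z≤n)) 4≤N) j (ℕ.≤-trans j<n n≤N))
      ∣x∣≤ : ∣ - x ∣ ≤ fromℕ 3 * (rate * rate)
      ∣x∣≤ = begin
        ∣ - x ∣                       ≡⟨ trans (∣-p∣≡∣p∣ x) (0≤p⇒∣p∣≡p (0≤* mass-nonNeg (0≤* κ-nonNeg (0≤p*p rate)))) ⟩
        mass * (κ * (rate * rate))    ≤⟨ *-mono mass-nonNeg (0≤p*p rate) (expSum-≤3 rate-nonNeg rate≤1 4≤N) (subst (κ * (rate * rate) ≤_) (*-identityˡ (rate * rate)) (*-monoʳ (0≤p*p rate) κ≤1)) ⟩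
        fromℕ 3 * (rate * rate)       ∎

-- Products of factors

genFun : List Factor → Series
genFun []       = δ
genFun (d ∷ ds) = Factor.gf d ⊛ genFun ds

totalRate : List Factor → ℚ
totalRate []       = 0ℚ
totalRate (d ∷ ds) = Factor.rate d + totalRate ds

squares : List Factor → ℚ
squares []       = 0ℚ
squares (d ∷ ds) = Factor.rate d * Factor.rate d + squares ds

totalMass : List Factor → ℕ → ℚ
totalMass []       N = 1ℚ
totalMass (d ∷ ds) N = mass d N * totalMass ds N

-- The product rule with D = (1 - z)²: if q = c + D s, then q (C + D S) = c C + D (q S + C s).
totalDefect : List Factor → ℕ → Series
totalDefect []       N = λ _ → 0ℚ
totalDefect (d ∷ ds) N = damped d N ⊛ totalDefect ds N ⊕ totalMass ds N · defect d N

totalRate-nonNeg : ∀ ds → 0ℚ ≤ totalRate ds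
totalRate-nonNeg []       = ≤-refl
totalRate-nonNeg (d ∷ ds) = 0≤+ (Factor.rate-nonNeg d) (totalRate-nonNeg ds)

squares-nonNeg : ∀ ds → 0ℚ ≤ squares ds
squares-nonNeg []       = ≤-refl
squares-nonNeg (d ∷ ds) = 0≤+ (0≤p*p (Factor.rate d)) (squares-nonNeg ds)

totalMass-nonNeg : ∀ ds {N} → 4 ℕ.≤ N → 0ℚ ≤ totalMass ds N
totalMass-nonNeg []       4≤N = 0≤1
totalMass-nonNeg (d ∷ ds) 4≤N = 0≤* (mass-nonNeg d _ 4≤N) (totalMass-nonNeg ds 4≤N)

total-expansion : ∀ ds N → E (- totalRate ds) ⊛ genFun ds ≗ totalMass ds N · δ ⊕ ∇ (∇ (totalDefect ds N))
total-expansion [] N n = trans (⊛-identityʳ (E 0ℚ) n) (trans (E-0 n)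
  (sym (trans (cong₂ _+_ (*-identityˡ (δ n)) (zeros n)) (+-identityʳ (δ n)))))
  where
  ∇0 : ∇ (λ _ → 0ℚ) ≗ λ _ → 0ℚ
  ∇0 zero    = refl
  ∇0 (suc _) = refl
  zeros : ∇ (∇ (λ _ → 0ℚ)) ≗ λ _ → 0ℚ
  zeros n = trans (∇-cong ∇0 n) (∇0 n)
total-expansion (d ∷ ds) N n = begin
  (E (- (rate + h)) ⊛ (gf ⊛ F)) n
    ≡⟨ ⊛-cong {b = gf ⊛ F} (λ i → trans (cong (λ q → E q i) (neg-distrib-+ rate h)) (sym (E-⊛ (- rate) (- h) i))) (λ _ → refl) n ⟩
  ((E (- rate) ⊛ E (- h)) ⊛ (gf ⊛ F)) n
    ≡⟨ ⊛-interchange (E (- rate)) (E (- h)) gf F n ⟩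
  ((E (- rate) ⊛ gf) ⊛ (E (- h) ⊛ F)) n
    ≡⟨ ⊛-cong (⊛-comm (E (- rate)) gf) (total-expansion ds N) n ⟩
  (q ⊛ (C · δ ⊕ ∇ (∇ S))) n
    ≡⟨ ⊛-distribˡ q (C · δ) (∇ (∇ S)) n ⟩
  (q ⊛ (C · δ)) n + (q ⊛ ∇ (∇ S)) n
    ≡⟨ cong₂ _+_ (trans (⊛-scaleʳ C q δ n) (cong (C *_) (trans (⊛-identityʳ q n) (damped-expansion d N n)))) (⊛-∇∇ q S n) ⟩
  C * (c * δ n + ∇ (∇ s) n) + ∇ (∇ (q ⊛ S)) n
    ≡⟨ solve 5 (λ C c e x y → C :* (c :* e :+ x) :+ y := c :* C :* e :+ (y :+ C :* x)) refl C c (δ n) (∇ (∇ s) n) (∇ (∇ (q ⊛ S)) n) ⟩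
  c * C * δ n + (∇ (∇ (q ⊛ S)) n + C * ∇ (∇ s) n)
    ≡⟨ cong (_+_ (c * C * δ n)) (sym (trans (∇-cong (λ i → trans (∇-⊕ (q ⊛ S) (C · s) i) (cong (_+_ (∇ (q ⊛ S) i)) (∇-· C s i))) n)
         (trans (∇-⊕ (∇ (q ⊛ S)) (C · ∇ s) n) (cong (_+_ (∇ (∇ (q ⊛ S)) n)) (∇-· C (∇ s) n))))) ⟩
  c * C * δ n + ∇ (∇ (q ⊛ S ⊕ C · s)) n ∎
  where
  open ≡-Reasoning
  open Factor d
  F = genFun ds
  h = totalRate ds
  q = damped d N
  s = defect d N
  c = mass d N
  C = totalMass ds N
  S = totalDefect ds N

-- `E h` is the inverse of `E (- h)`. The double difference is moved onto `E h`, whose differences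
-- are explicit, leaving on the other side a series that is only known in norm.
genFun-expansion : ∀ ds N k →
  genFun ds k - totalMass ds N * E (totalRate ds) k ≡ (totalDefect ds N ⊛ ∇ (∇ (E (totalRate ds)))) k
genFun-expansion ds N k = begin
  F k - C * E h k
    ≡⟨ cong (_- C * E h k) (sym (⊛-identityˡ F k)) ⟩
  (δ ⊛ F) k - C * E h k
    ≡⟨ cong (_- C * E h k) (⊛-cong {b = F} (λ i → sym (trans (E-⊛ h (- h) i) (trans (cong (λ q → E q i) (+-inverseʳ h)) (E-0 i)))) (λ _ → refl) k) ⟩
  ((E h ⊛ E (- h)) ⊛ F) k - C * E h k
    ≡⟨ cong (_- C * E h k) (trans (⊛-assoc (E h) (E (- h)) F k) (⊛-cong {E h} (λ _ → refl) (total-expansion ds N) k)) ⟩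
  (E h ⊛ (C · δ ⊕ ∇ (∇ S))) k - C * E h k
    ≡⟨ cong (_- C * E h k) (trans (⊛-distribˡ (E h) (C · δ) (∇ (∇ S)) k)
         (cong₂ _+_ (trans (⊛-scaleʳ C (E h) δ k) (cong (C *_) (⊛-identityʳ (E h) k))) (⊛-∇∇ (E h) S k))) ⟩
  C * E h k + ∇ (∇ (E h ⊛ S)) k - C * E h k
    ≡⟨ solve 2 (λ x y → (x :+ y) :- x := y) refl (C * E h k) (∇ (∇ (E h ⊛ S)) k) ⟩
  ∇ (∇ (E h ⊛ S)) k
    ≡⟨ trans (∇-cong (∇-cong (⊛-comm (E h) S)) k) (sym (⊛-∇∇ S (E h) k)) ⟩
  (S ⊛ ∇ (∇ (E h))) k ∎
  where
  open ≡-Reasoning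
  F = genFun ds
  h = totalRate ds
  C = totalMass ds N
  S = totalDefect ds N

-- Abstract because K occurs below as an exponent, where its numeral would be unfolded.
abstract
  K₀ : ℚ
  K₀ = geometricBound * (fromℕ 8 * geometricBound) + fromℕ 3

  0≤K₀ : 0ℚ ≤ K₀
  0≤K₀ = nonNegative⁻¹ K₀

  ∥defect∥ : ∀ d {N} → 4 ℕ.≤ N → ∀ n → n ℕ.≤ N → ∥ defect d N ∥ n ≤ K₀ * (Factor.rate d * Factor.rate d)
  ∥defect∥ d {N} = defect-bound d N

  K : ℕ
  K = proj₁ (archimedean (fromℕ 324 * K₀))

  324K₀≤K : fromℕ 324 * K₀ ≤ fromℕ K
  324K₀≤K = proj₂ (archimedean (fromℕ 324 * K₀))

amplifier : Factor → ℚ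
amplifier d = 1ℚ + fromℕ K * (Factor.rate d * Factor.rate d)

amplification : List Factor → ℚ
amplification []       = 1ℚ
amplification (d ∷ ds) = amplifier d * amplification ds

1≤amplifier : ∀ d → 1ℚ ≤ amplifier d
1≤amplifier d = p≤p+q 1ℚ (0≤* (0≤fromℕ K) (0≤p*p (Factor.rate d)))

1≤amplification : ∀ ds → 1ℚ ≤ amplification ds
1≤amplification []       = ≤-refl
1≤amplification (d ∷ ds) = *-mono 0≤1 (≤-trans 0≤1 (1≤amplification ds)) (1≤amplifier d) (1≤amplification ds)

∥damped∥ : ∀ d {N} → 4 ℕ.≤ N → ∀ n → n ℕ.≤ N → ∥ damped d N ∥ n ≤ mass d N * amplifier d
∥damped∥ d {N} 4≤N n n≤N = begin
  ∥ damped d N ∥ n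
    ≡⟨ ∥∥-cong (damped-expansion d N) n ⟩
  ∥ c · δ ⊕ ∇ (∇ s) ∥ n
    ≤⟨ ∥⊕∥ (c · δ) (∇ (∇ s)) n ⟩
  ∥ c · δ ∥ n + ∥ ∇ (∇ s) ∥ n
    ≤⟨ +-mono-≤ ∥cδ∥ (≤-trans (∥∇∥ (∇ s) n) (*-monoˡ (0≤fromℕ 9) (≤-trans (∥∇∥ s n) (*-monoˡ (0≤fromℕ 9) (∥defect∥ d 4≤N n n≤N))))) ⟩
  c + fromℕ 9 * (fromℕ 9 * (K₀ * r²))
    ≡⟨ cong (_+_ c) (solve 2 (λ k r → con (fromℕ 9) :* (con (fromℕ 9) :* (k :* r)) := con (+ 1 / 4) :* (con (fromℕ 324) :* k :* r)) refl K₀ r²) ⟩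
  c + (+ 1 / 4) * (fromℕ 324 * K₀ * r²)
    ≤⟨ +-monoʳ-≤ c (*-mono (nonNegative⁻¹ (+ 1 / 4)) (0≤* (0≤fromℕ K) (0≤p*p (Factor.rate d))) (mass-≥¼ d N 4≤N) (*-monoʳ (0≤p*p (Factor.rate d)) 324K₀≤K)) ⟩
  c + c * (fromℕ K * r²)
    ≡⟨ solve 2 (λ c x → c :+ c :* x := c :* (con 1ℚ :+ x)) refl c (fromℕ K * r²) ⟩
  c * amplifier d ∎
  where
  open ≤-Reasoning
  c = mass d N
  s = defect d N
  r² = Factor.rate d * Factor.rate d
  ∥cδ∥ : ∥ c · δ ∥ n ≤ c
  ∥cδ∥ = begin
    ∥ c · δ ∥ n       ≡⟨ trans (∥·∥ c δ n) (cong (_* ∥ δ ∥ n) (0≤p⇒∣p∣≡p (mass-nonNeg d N 4≤N))) ⟩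
    c * ∥ δ ∥ n       ≤⟨ *-monoˡ (mass-nonNeg d N 4≤N) (∥δ∥≤1 n) ⟩
    c * 1ℚ            ≡⟨ *-identityʳ c ⟩
    c                 ∎

-- In the induction the summand C · s lacks the new mass c and the amplifications a and A. The
-- leading 4 makes up for them, since c ≥ 1/4 and a, A ≥ 1 give 4 c a A ≥ 1.
∥totalDefect∥ : ∀ ds {N} → 4 ℕ.≤ N → ∀ n → n ℕ.≤ N →
  ∥ totalDefect ds N ∥ n ≤ fromℕ 4 * K₀ * (totalMass ds N * (amplification ds * squares ds))
∥totalDefect∥ [] {N} 4≤N n n≤N = ≤-reflexive (trans (trans (∑-· 0ℚ w n) (*-zeroˡ (∑ w n)))
  (solve 1 (λ k → con 0ℚ := con (fromℕ 4) :* k :* (con 1ℚ :* (con 1ℚ :* con 0ℚ))) refl K₀))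
∥totalDefect∥ (d ∷ ds) {N} 4≤N n n≤N = begin
  ∥ q ⊛ S ⊕ C · s ∥ n
    ≤⟨ ∥⊕∥ (q ⊛ S) (C · s) n ⟩
  ∥ q ⊛ S ∥ n + ∥ C · s ∥ n
    ≤⟨ +-mono-≤ (≤-trans (∥⊛∥ q S n) (*-mono (∥∥-nonNeg q n) 0≤X (∥damped∥ d 4≤N n n≤N) (∥totalDefect∥ ds 4≤N n n≤N)))
         (≤-trans (≤-reflexive (trans (∥·∥ C s n) (cong (_* ∥ s ∥ n) (0≤p⇒∣p∣≡p 0≤C)))) (*-monoˡ 0≤C (∥defect∥ d 4≤N n n≤N))) ⟩
  c * a * (fromℕ 4 * K₀ * (C * (A * Q))) + C * (K₀ * r²)
    ≤⟨ ≤-by (C * (K₀ * r²) * (fromℕ 4 * (c * (a * A)) - 1ℚ)) (0≤* (0≤* 0≤C (0≤* 0≤K₀ (0≤p*p (Factor.rate d)))) (p≤q⇒0≤q-p 1≤4caA))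
         (solve 7 (λ c C a A Q k r → con (fromℕ 4) :* k :* (c :* C :* (a :* A :* (r :+ Q)))
             := c :* a :* (con (fromℕ 4) :* k :* (C :* (A :* Q))) :+ C :* (k :* r) :+ C :* (k :* r) :* (con (fromℕ 4) :* (c :* (a :* A)) :- con 1ℚ)) refl c C a A Q K₀ r²) ⟩
  fromℕ 4 * K₀ * (c * C * (a * A * (r² + Q))) ∎
  where
  open ≤-Reasoning
  q = damped d N
  s = defect d N
  S = totalDefect ds N
  c = mass d N
  C = totalMass ds N
  a = amplifier d
  A = amplification ds
  Q = squares ds
  r² = Factor.rate d * Factor.rate d
  0≤C : 0ℚ ≤ C
  0≤C = totalMass-nonNeg ds 4≤N
  0≤X : 0ℚ ≤ fromℕ 4 * K₀ * (C * (A * Q))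
  0≤X = 0≤* (0≤* (0≤fromℕ 4) 0≤K₀) (0≤* 0≤C (0≤* (≤-trans 0≤1 (1≤amplification ds)) (squares-nonNeg ds)))
  1≤4caA : 1ℚ ≤ fromℕ 4 * (c * (a * A))
  1≤4caA = *-monoˡ (0≤fromℕ 4) (*-mono {+ 1 / 4} {c} {1ℚ} {a * A} (nonNegative⁻¹ (+ 1 / 4)) (≤-trans 0≤1 (1≤amplification (d ∷ ds))) (mass-≥¼ d N 4≤N) (1≤amplification (d ∷ ds)))

-- Sums and products over primes

recip : ℕ → ℚ
recip p = 1ℚ ÷₀ fromℕ p

recipSq : ℕ → ℚ
recipSq p = 1ℚ ÷₀ fromℕ p ^ℚ 2

recipPred : ℕ → ℚ
recipPred p = 1ℚ ÷₀ (fromℕ p - 1ℚ)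

÷₀-cancel-pos : ∀ x {y} → 0ℚ < y → (x ÷₀ y) * y ≡ x
÷₀-cancel-pos x 0<y = ÷₀-cancel x (λ e → <⇒≢ 0<y (sym e))

module _ (p : ℕ) (2≤p : 2 ℕ.≤ p) where
  private
    P x : ℚ
    P = fromℕ p
    x = recip p
    2≤P : fromℕ 2 ≤ P
    2≤P = fromℕ-mono-≤ 2≤p
    0<P : 0ℚ < P
    0<P = <-≤-trans (0<fromℕ 2) 2≤P
    1≤P-1 : 1ℚ ≤ P - 1ℚ
    1≤P-1 = +-monoˡ-≤ (- 1ℚ) 2≤P
    0<P-1 : 0ℚ < P - 1ℚ
    0<P-1 = <-≤-trans (0<fromℕ 1) 1≤P-1

  recip-cancel : recip p * P ≡ 1ℚ
  recip-cancel = ÷₀-cancel-pos 1ℚ 0<P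

  recipPred-cancel : recipPred p * (P - 1ℚ) ≡ 1ℚ
  recipPred-cancel = ÷₀-cancel-pos 1ℚ 0<P-1

  recip-pos : 0ℚ < recip p
  recip-pos = ÷₀-pos (0<fromℕ 1) 0<P

  recip-nonNeg : 0ℚ ≤ recip p
  recip-nonNeg = <⇒≤ recip-pos

  recipPred-pos : 0ℚ < recipPred p
  recipPred-pos = ÷₀-pos (0<fromℕ 1) 0<P-1

  recip≤½ : recip p ≤ ½
  recip≤½ = *-cancelʳ-≤-pos (fromℕ 2) {{positive (0<fromℕ 2)}}
    (≤-trans (*-monoˡ recip-nonNeg 2≤P) (≤-reflexive recip-cancel))

  recip≤1 : recip p ≤ 1ℚ
  recip≤1 = ≤-trans recip≤½ (≤-by ½ (nonNegative⁻¹ ½) refl)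

  recipPred≤1 : recipPred p ≤ 1ℚ
  recipPred≤1 = subst₂ _≤_ (*-identityʳ (recipPred p)) recipPred-cancel (*-monoˡ (<⇒≤ recipPred-pos) 1≤P-1)

  -- With λ = 1/(p - 1) and x = 1/p, the relation λ = (1 + λ) x is what makes (1 - x)/(1 - xz) equal
  -- to 1/(1 - λ(z - 1)); it also yields λ ≤ 2x.
  recipPred≡ : recipPred p ≡ (1ℚ + recipPred p) * x
  recipPred≡ = *-cancelʳ P 0<P (begin
    l * P                          ≡⟨ solve 2 (λ l P → l :* P := l :* (P :- con 1ℚ) :+ l) refl l P ⟩
    l * (P - 1ℚ) + l               ≡⟨ cong (_+ l) recipPred-cancel ⟩
    1ℚ + l                         ≡⟨ sym (*-identityʳ (1ℚ + l)) ⟩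
    (1ℚ + l) * 1ℚ                  ≡⟨ cong ((1ℚ + l) *_) (sym recip-cancel) ⟩
    (1ℚ + l) * (x * P)             ≡⟨ sym (*-assoc (1ℚ + l) x P) ⟩
    (1ℚ + l) * x * P               ∎)
    where
    open ≡-Reasoning
    l = recipPred p

  recipSq≡ : recipSq p ≡ x * x
  recipSq≡ = *-cancelʳ (P ^ℚ 2) 0<P² (begin
    recipSq p * P ^ℚ 2          ≡⟨ ÷₀-cancel-pos 1ℚ 0<P² ⟩
    1ℚ * 1ℚ                     ≡⟨ cong₂ _*_ (sym recip-cancel) (sym recip-cancel) ⟩
    (x * P) * (x * P)           ≡⟨ solve 2 (λ x P → (x :* P) :* (x :* P) := x :* x :* (P :* (P :* con 1ℚ))) refl x P ⟩
    x * x * P ^ℚ 2              ∎)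
    where
    open ≡-Reasoning
    0<P² : 0ℚ < P ^ℚ 2
    0<P² = subst (0ℚ <_) (sym (cong (P *_) (*-identityʳ P))) (positive⁻¹ (P * P) {{pos*pos⇒pos P {{positive 0<P}} P {{positive 0<P}}}})

  -- The constant 4 is chosen for `recipPred²≤`, where it is attained at p = 2, so that both kinds
  -- of factor satisfy one common bound.
  recip²≤ : recip p * recip p ≤ fromℕ 4 * recipSq p
  recip²≤ = ≤-by (fromℕ 3 * (x * x)) (0≤* (0≤fromℕ 3) (0≤p*p x))
    (trans (cong (fromℕ 4 *_) recipSq≡) (solve 1 (λ y → con (fromℕ 4) :* y := y :+ con (fromℕ 3) :* y) refl (x * x)))

  recipPred²≤ : recipPred p * recipPred p ≤ fromℕ 4 * recipSq p
  recipPred²≤ = ≤-trans (*-mono (<⇒≤ recipPred-pos) (0≤* (0≤fromℕ 2) recip-nonNeg) l≤2x l≤2x)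
    (≤-reflexive (trans (solve 1 (λ x → con (fromℕ 2) :* x :* (con (fromℕ 2) :* x) := con (fromℕ 4) :* (x :* x)) refl x) (cong (fromℕ 4 *_) (sym recipSq≡))))
    where
    l≤2x : recipPred p ≤ fromℕ 2 * x
    l≤2x = subst (_≤ fromℕ 2 * x) (sym recipPred≡) (*-monoʳ recip-nonNeg (+-monoʳ-≤ 1ℚ recipPred≤1))

  bernoulliGF : Series
  bernoulliGF zero          = 1ℚ - x
  bernoulliGF (suc zero)    = x
  bernoulliGF (suc (suc _)) = 0ℚ

  geometricGF : Series
  geometricGF j = x ^ℚ j * (1ℚ - x)

  private
    0≤1-x : 0ℚ ≤ 1ℚ - x
    0≤1-x = p≤q⇒0≤q-p recip≤1
    1-x≤1 : 1ℚ - x ≤ 1ℚ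
    1-x≤1 = ≤-by x recip-nonNeg (solve 1 (λ x → con 1ℚ := (con 1ℚ :- x) :+ x) refl x)

  bernoulliFactor : Factor
  bernoulliFactor = record
    { rate = x ; gf = bernoulliGF ; κ = 1ℚ
    ; rate-pos = recip-pos ; rate≤1 = recip≤1 ; κ-nonNeg = 0≤1 ; κ≤1 = ≤-refl
    ; gf-bound = bound ; gf-equation = equation }
    where
    bound : ∀ j → ∣ bernoulliGF j ∣ ≤ ½ ^ℚ j
    bound zero          = subst (_≤ 1ℚ) (sym (0≤p⇒∣p∣≡p 0≤1-x)) 1-x≤1
    bound (suc zero)    = subst (_≤ ½) (sym (0≤p⇒∣p∣≡p recip-nonNeg)) recip≤½
    bound (suc (suc j)) = ^ℚ-nonNeg (suc (suc j)) (nonNegative⁻¹ ½)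
    equation : bernoulliGF ⊕ x · ∇ bernoulliGF ≗ δ ⊕ (- (1ℚ * (x * x))) · ∇ (∇ δ)
    -- The cases follow the coefficients 1, -2, 1, 0, ... of (1 - z)².
    equation 0 = solve 1 (λ x → (con 1ℚ :- x) :+ x :* (con 1ℚ :- x) := con 1ℚ :+ :- (con 1ℚ :* (x :* x)) :* con 1ℚ) refl x
    equation 1 = solve 1 (λ x → x :+ x :* (x :- (con 1ℚ :- x)) := con 0ℚ :+ :- (con 1ℚ :* (x :* x)) :* con (- fromℕ 2)) refl x
    equation 2 = solve 1 (λ x → con 0ℚ :+ x :* (con 0ℚ :- x) := con 0ℚ :+ :- (con 1ℚ :* (x :* x)) :* con 1ℚ) refl x
    equation (suc (suc (suc n))) = solve 1 (λ x → con 0ℚ :+ x :* con 0ℚ := con 0ℚ :+ :- (con 1ℚ :* (x :* x)) :* con 0ℚ) refl x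

  geometricFactor : Factor
  geometricFactor = record
    { rate = l ; gf = geometricGF ; κ = 0ℚ
    ; rate-pos = recipPred-pos ; rate≤1 = recipPred≤1 ; κ-nonNeg = ≤-refl ; κ≤1 = 0≤1
    ; gf-bound = bound ; gf-equation = equation }
    where
    l = recipPred p
    bound : ∀ j → ∣ geometricGF j ∣ ≤ ½ ^ℚ j
    bound j = subst₂ _≤_ (sym (0≤p⇒∣p∣≡p (0≤* (^ℚ-nonNeg j recip-nonNeg) 0≤1-x))) (*-identityʳ (½ ^ℚ j))
      (*-mono (^ℚ-nonNeg j recip-nonNeg) 0≤1 (^ℚ-mono-≤ j recip-nonNeg recip≤½) 1-x≤1)
    equation : geometricGF ⊕ l · ∇ geometricGF ≗ δ ⊕ (- (0ℚ * (l * l))) · ∇ (∇ δ)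
    equation zero = begin
      1ℚ * (1ℚ - x) + l * (1ℚ * (1ℚ - x))   ≡⟨ solve 2 (λ x l → con 1ℚ :* (con 1ℚ :- x) :+ l :* (con 1ℚ :* (con 1ℚ :- x)) := con 1ℚ :+ l :- (con 1ℚ :+ l) :* x) refl x l ⟩
      1ℚ + l - (1ℚ + l) * x                 ≡⟨ cong (λ y → 1ℚ + l - y) (sym recipPred≡) ⟩
      1ℚ + l - l                            ≡⟨ solve 1 (λ l → con 1ℚ :+ l :- l := con 1ℚ :+ :- (con 0ℚ :* (l :* l)) :* con 1ℚ) refl l ⟩
      1ℚ + - (0ℚ * (l * l)) * 1ℚ            ∎
      where open ≡-Reasoning
    equation (suc n) = begin
      x * y * (1ℚ - x) + l * (x * y * (1ℚ - x) - y * (1ℚ - x))  ≡⟨ solve 3 (λ x y l → x :* y :* (con 1ℚ :- x) :+ l :* (x :* y :* (con 1ℚ :- x) :- y :* (con 1ℚ :- x)) := y :* (con 1ℚ :- x) :* ((con 1ℚ :+ l) :* x :- l)) refl x y l ⟩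
      y * (1ℚ - x) * ((1ℚ + l) * x - l)                         ≡⟨ cong (λ u → y * (1ℚ - x) * (u - l)) (sym recipPred≡) ⟩
      y * (1ℚ - x) * (l - l)                                    ≡⟨ solve 3 (λ u l d → u :* (l :- l) := con 0ℚ :+ :- (con 0ℚ :* (l :* l)) :* d) refl (y * (1ℚ - x)) l (∇ (∇ δ) (suc n)) ⟩
      0ℚ + - (0ℚ * (l * l)) * ∇ (∇ δ) (suc n)                   ∎
      where
      open ≡-Reasoning
      y = x ^ℚ n

-- The product of 1 + 1/n² over distinct n

bernoulli-inequality : ∀ {x} → 0ℚ ≤ x → ∀ n → 1ℚ + fromℕ n * x ≤ (1ℚ + x) ^ℚ n
bernoulli-inequality {x} 0≤x zero    = ≤-reflexive (solve 1 (λ x → con 1ℚ :+ con 0ℚ :* x := con 1ℚ) refl x)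
bernoulli-inequality {x} 0≤x (suc n) = begin
  1ℚ + fromℕ (suc n) * x                  ≡⟨ cong (λ m → 1ℚ + m * x) (fromℕ-suc n) ⟩
  1ℚ + (1ℚ + fromℕ n) * x                 ≤⟨ ≤-by (fromℕ n * (x * x)) (0≤* (0≤fromℕ n) (0≤p*p x))
                                              (solve 2 (λ m x → (con 1ℚ :+ x) :* (con 1ℚ :+ m :* x) := con 1ℚ :+ (con 1ℚ :+ m) :* x :+ m :* (x :* x)) refl (fromℕ n) x) ⟩
  (1ℚ + x) * (1ℚ + fromℕ n * x)           ≤⟨ *-monoˡ (0≤+ 0≤1 0≤x) (bernoulli-inequality 0≤x n) ⟩
  (1ℚ + x) ^ℚ suc n                       ∎
  where open ≤-Reasoning

∏ : (ℕ → ℚ) → List ℕ → ℚ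
∏ f []      = 1ℚ
∏ f (x ∷ L) = f x * ∏ f L

∏-++ : ∀ f L M → ∏ f (L ++ M) ≡ ∏ f L * ∏ f M
∏-++ f []      M = sym (*-identityˡ (∏ f M))
∏-++ f (x ∷ L) M = trans (cong (f x *_) (∏-++ f L M)) (sym (*-assoc (f x) (∏ f L) (∏ f M)))

module _ {f : ℕ → ℚ} (1≤f : ∀ n → 1ℚ ≤ f n) where

  1≤∏ : ∀ L → 1ℚ ≤ ∏ f L
  1≤∏ []      = ≤-refl
  1≤∏ (x ∷ L) = *-mono 0≤1 (≤-trans 0≤1 (1≤∏ L)) (1≤f x) (1≤∏ L)

  -- Each element of T is cut out of L in turn; since T has no repetitions, the rest of T still lies
  -- in what remains of L.
  ∏-⊆ : ∀ T L → Unique T → T ⊆ L → ∏ f T ≤ ∏ f L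
  ∏-⊆ []      L _            T⊆L = 1≤∏ L
  ∏-⊆ (x ∷ T) L (x∉T ∷ uniq) T⊆L with ∈-∃++ (T⊆L (here refl))
  ... | A , B , refl = begin
    f x * ∏ f T                 ≤⟨ *-monoˡ (≤-trans 0≤1 (1≤f x)) (∏-⊆ T (A ++ B) uniq T⊆A++B) ⟩
    f x * ∏ f (A ++ B)          ≡⟨ cong (f x *_) (∏-++ f A B) ⟩
    f x * (∏ f A * ∏ f B)       ≡⟨ solve 3 (λ x a b → x :* (a :* b) := a :* (x :* b)) refl (f x) (∏ f A) (∏ f B) ⟩
    ∏ f A * (f x * ∏ f B)       ≡⟨ sym (∏-++ f A (x ∷ B)) ⟩
    ∏ f (A ++ x ∷ B)            ∎
    where
    open ≤-Reasoning
    T⊆A++B : T ⊆ A ++ B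
    T⊆A++B {y} y∈T with ∈-++⁻ A (T⊆L (there y∈T))
    ... | inj₁ y∈A            = ∈-++⁺ˡ y∈A
    ... | inj₂ (here y≡x)     = ⊥-elim (All.lookup x∉T y∈T (sym y≡x))
    ... | inj₂ (there y∈B)    = ∈-++⁺ʳ A y∈B

1+recipSq : ℕ → ℚ
1+recipSq p = 1ℚ + recipSq p

0≤recipSq : ∀ p → 0ℚ ≤ recipSq p
0≤recipSq zero    = ≤-refl
0≤recipSq (suc p) = <⇒≤ (÷₀-pos (0<fromℕ 1) (positive⁻¹ (P ^ℚ 2) {{pos*pos⇒pos P {{pos}} (P * 1ℚ) {{pos*pos⇒pos P {{pos}} 1ℚ}}}}))
  where
  P = fromℕ (suc p)
  pos = positive (0<fromℕ (suc p))

1≤1+recipSq : ∀ p → 1ℚ ≤ 1+recipSq p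
1≤1+recipSq p = p≤p+q 1ℚ (0≤recipSq p)

-- The factor m/(m + 1) makes the induction work: (1 + 1/m²)(1 - 1/m)/(1 - 1/(m + 1)) = 1 - 1/m⁴.
∏-range : ∀ n → ∏ 1+recipSq (map suc (downFrom (suc n))) * (fromℕ (suc n) + 1ℚ) ≤ fromℕ 4 * fromℕ (suc n)
∏-range zero    = ≤-refl
∏-range (suc n) = *-cancelʳ-≤-pos m {{positive (0<fromℕ (suc (suc n)))}} (begin
  (1ℚ + s) * Π * (m + 1ℚ) * m
    ≡⟨ solve 3 (λ s p m → (con 1ℚ :+ s) :* p :* (m :+ con 1ℚ) :* m := (con 1ℚ :+ s) :* (m :+ con 1ℚ) :* (p :* m)) refl s Π m ⟩
  (1ℚ + s) * (m + 1ℚ) * (Π * m)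
    ≤⟨ *-monoˡ (0≤* (0≤+ 0≤1 (0≤recipSq (suc (suc n)))) (0≤+ (0≤fromℕ (suc (suc n))) 0≤1)) ih ⟩
  (1ℚ + s) * (m + 1ℚ) * (fromℕ 4 * (m - 1ℚ))
    ≡⟨ solve 2 (λ s m → (con 1ℚ :+ s) :* (m :+ con 1ℚ) :* (con (fromℕ 4) :* (m :- con 1ℚ)) := con (fromℕ 4) :* (m :* m :- con 1ℚ :+ s :* (m :* (m :* con 1ℚ)) :- s)) refl s m ⟩
  fromℕ 4 * (m * m - 1ℚ + s * m ^ℚ 2 - s)
    ≡⟨ cong (λ y → fromℕ 4 * (m * m - 1ℚ + y - s)) (÷₀-cancel-pos 1ℚ (positive⁻¹ (m ^ℚ 2) {{pos*pos⇒pos m {{pos}} (m * 1ℚ) {{pos*pos⇒pos m {{pos}} 1ℚ}}}})) ⟩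
  fromℕ 4 * (m * m - 1ℚ + 1ℚ - s)
    ≤⟨ ≤-by (fromℕ 4 * s) (0≤* (0≤fromℕ 4) (0≤recipSq (suc (suc n)))) (solve 2 (λ s m → con (fromℕ 4) :* m :* m := con (fromℕ 4) :* (m :* m :- con 1ℚ :+ con 1ℚ :- s) :+ con (fromℕ 4) :* s) refl s m) ⟩
  fromℕ 4 * m * m ∎)
  where
  open ≤-Reasoning
  m s Π : ℚ
  m = fromℕ (suc (suc n))
  s = recipSq (suc (suc n))
  Π = ∏ 1+recipSq (map suc (downFrom (suc n)))
  pos = positive (0<fromℕ (suc (suc n)))
  m≡ : m ≡ 1ℚ + fromℕ (suc n)
  m≡ = fromℕ-suc (suc n)
  ih : Π * m ≤ fromℕ 4 * (m - 1ℚ)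
  ih = subst₂ _≤_ (cong (Π *_) (trans (+-comm (fromℕ (suc n)) 1ℚ) (sym m≡)))
    (cong (fromℕ 4 *_) (trans (solve 1 (λ x → x := (con 1ℚ :+ x) :- con 1ℚ) refl (fromℕ (suc n))) (cong (_- 1ℚ) (sym m≡)))) (∏-range n)

-- The constant 4 makes the base case of `∏-range` an equality; the infinite product is sinh π / π,
-- about 3.68.
∏-range≤4 : ∀ n → ∏ 1+recipSq (map suc (downFrom n)) ≤ fromℕ 4
∏-range≤4 zero    = fromℕ-mono-≤ {1} {4} (ℕ.s≤s ℕ.z≤n)
∏-range≤4 (suc n) = *-cancelʳ-≤-pos (m + 1ℚ) {{pos+pos⇒pos m {{positive (0<fromℕ (suc n))}} 1ℚ}}
  (≤-trans (∏-range n) (*-monoˡ (0≤fromℕ 4) (p≤p+q m 0≤1)))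
  where m = fromℕ (suc n)

∈⇒≤sum : ∀ {n L} → n ∈ L → n ℕ.≤ sum L
∈⇒≤sum {n} (here {xs = L} refl)  = ℕ.m≤m+n n (sum L)
∈⇒≤sum (there {x} {L} n∈L) = ℕ.≤-trans (∈⇒≤sum n∈L) (ℕ.m≤n+m (sum L) x)

-- The sum of T bounds each of its elements, so T lies in the range 1, ..., `sum T`.
∏-unique≤4 : ∀ {T} → Unique T → All (2 ℕ.≤_) T → ∏ 1+recipSq T ≤ fromℕ 4
∏-unique≤4 {T} uniq 2≤T = ≤-trans (∏-⊆ 1≤1+recipSq T (map suc (downFrom (sum T))) uniq inRange) (∏-range≤4 (sum T))
  where
  inRange : T ⊆ map suc (downFrom (sum T))
  inRange {zero}  p∈T with () ← All.lookup 2≤T p∈T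
  inRange {suc p} p∈T = ∈-map⁺ suc (∈-downFrom⁺ (∈⇒≤sum p∈T))

module _ (factor : ∀ p → 2 ℕ.≤ p → Factor) where

  factors : ∀ {T} → All (2 ℕ.≤_) T → List Factor
  factors []           = []
  factors (2≤p ∷ 2≤T) = factor _ 2≤p ∷ factors 2≤T

  module _ (rate²≤ : ∀ p 2≤p → Factor.rate (factor p 2≤p) * Factor.rate (factor p 2≤p) ≤ fromℕ 4 * recipSq p) where

    squares≤ : ∀ {T} (2≤T : All (2 ℕ.≤_) T) → squares (factors 2≤T) ≤ fromℕ 4 * H″ T
    squares≤ []                       = ≤-refl
    squares≤ (_∷_ {p} {T} 2≤p 2≤T) = ≤-trans (+-mono-≤ (rate²≤ p 2≤p) (squares≤ 2≤T)) (≤-reflexive (sym (*-distribˡ-+ (fromℕ 4) (recipSq p) (H″ T))))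

    -- Bernoulli's inequality turns the constant 4K into an exponent, so that a bound for ∏ (1 +
    -- 1/p²) alone suffices.
    amplifier≤ : ∀ p 2≤p → amplifier (factor p 2≤p) ≤ 1+recipSq p ^ℚ (K ℕ.* 4)
    amplifier≤ p 2≤p = begin
      1ℚ + fromℕ K * (rate * rate)            ≤⟨ +-monoʳ-≤ 1ℚ (*-monoˡ (0≤fromℕ K) (rate²≤ p 2≤p)) ⟩
      1ℚ + fromℕ K * (fromℕ 4 * recipSq p)    ≡⟨ cong (_+_ 1ℚ) (trans (sym (*-assoc (fromℕ K) (fromℕ 4) (recipSq p))) (cong (_* recipSq p) (sym (fromℕ-* K 4)))) ⟩
      1ℚ + fromℕ (K ℕ.* 4) * recipSq p        ≤⟨ bernoulli-inequality (0≤recipSq p) (K ℕ.* 4) ⟩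
      1+recipSq p ^ℚ (K ℕ.* 4)                ∎
      where
      open ≤-Reasoning
      open Factor (factor p 2≤p)

    amplification≤∏ : ∀ {T} (2≤T : All (2 ℕ.≤_) T) → amplification (factors 2≤T) ≤ ∏ 1+recipSq T ^ℚ (K ℕ.* 4)
    amplification≤∏ []                       = 1^n (K ℕ.* 4)
      where
      1^n : ∀ n → 1ℚ ≤ 1ℚ ^ℚ n
      1^n zero    = ≤-refl
      1^n (suc n) = subst (1ℚ ≤_) (sym (*-identityˡ (1ℚ ^ℚ n))) (1^n n)
    amplification≤∏ (_∷_ {p} {T} 2≤p 2≤T) = ≤-trans
      (*-mono (≤-trans 0≤1 (1≤amplifier (factor p 2≤p))) (^ℚ-nonNeg (K ℕ.* 4) (≤-trans 0≤1 (1≤∏ 1≤1+recipSq T))) (amplifier≤ p 2≤p) (amplification≤∏ 2≤T))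
      (≤-reflexive (sym (^ℚ-distrib-* (1+recipSq p) (∏ 1+recipSq T) (K ℕ.* 4))))

    amplification≤ : ∀ {T} (2≤T : All (2 ℕ.≤_) T) → Unique T → amplification (factors 2≤T) ≤ fromℕ 4 ^ℚ (K ℕ.* 4)
    amplification≤ {T} 2≤T uniq = ≤-trans (amplification≤∏ 2≤T)
      (^ℚ-mono-≤ (K ℕ.* 4) (≤-trans 0≤1 (1≤∏ 1≤1+recipSq T)) (∏-unique≤4 uniq 2≤T))

totalRate-bernoulli : ∀ {T} (2≤T : All (2 ℕ.≤_) T) → totalRate (factors bernoulliFactor 2≤T) ≡ H T
totalRate-bernoulli []              = refl
totalRate-bernoulli (_∷_ {p} _ 2≤T) = cong (_+_ (recip p)) (totalRate-bernoulli 2≤T)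

totalRate-geometric : ∀ {T} (2≤T : All (2 ℕ.≤_) T) → totalRate (factors geometricFactor 2≤T) ≡ H′ T
totalRate-geometric []              = refl
totalRate-geometric (_∷_ {p} _ 2≤T) = cong (_+_ (recipPred p)) (totalRate-geometric 2≤T)

-- Second differences of the Poisson weights

∇∇E : ∀ h m → h * h * ∇ (∇ (E h)) m ≡ E h m * ((fromℕ m - h) * (fromℕ m - h) - fromℕ m)
∇∇E h 0 = solve 1 (λ h → h :* h :* con 1ℚ := con 1ℚ :* ((con 0ℚ :- h) :* (con 0ℚ :- h) :- con 0ℚ)) refl h
∇∇E h 1 = begin
  h * h * ((E h 1 - 1ℚ) - 1ℚ)                          ≡⟨ cong (λ e → h * h * ((e - 1ℚ) - 1ℚ)) (E₁ h) ⟩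
  h * h * ((h - 1ℚ) - 1ℚ)                              ≡⟨ solve 1 (λ h → h :* h :* ((h :- con 1ℚ) :- con 1ℚ) := h :* ((con 1ℚ :- h) :* (con 1ℚ :- h) :- con 1ℚ)) refl h ⟩
  h * ((1ℚ - h) * (1ℚ - h) - 1ℚ)                       ≡⟨ cong (_* ((1ℚ - h) * (1ℚ - h) - 1ℚ)) (sym (E₁ h)) ⟩
  E h 1 * ((1ℚ - h) * (1ℚ - h) - 1ℚ)                   ∎
  where open ≡-Reasoning
∇∇E h (suc (suc n)) = begin
  h * h * ((a₂ - a₁) - (a₁ - a₀))
    ≡⟨ solve 4 (λ h a b c → h :* h :* ((c :- b) :- (b :- a)) := h :* h :* c :- (h :+ h) :* (b :* h) :+ h :* (a :* h)) refl h a₀ a₁ a₂ ⟩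
  h * h * a₂ - (h + h) * (a₁ * h) + h * (a₀ * h)
    ≡⟨ cong (λ t → h * h * a₂ - (h + h) * (a₁ * h) + h * t) (sym (expTerm-suc h n)) ⟩
  h * h * a₂ - (h + h) * (a₁ * h) + h * (a₁ * m)
    ≡⟨ solve 4 (λ h c b m → h :* h :* c :- (h :+ h) :* (b :* h) :+ h :* (b :* m) := h :* h :* c :- (h :+ h) :* (b :* h) :+ m :* (b :* h)) refl h a₂ a₁ m ⟩
  h * h * a₂ - (h + h) * (a₁ * h) + m * (a₁ * h)
    ≡⟨ cong (λ t → h * h * a₂ - (h + h) * t + m * t) (sym (trans (cong (a₂ *_) (sym (fromℕ-suc (suc n)))) (expTerm-suc h (suc n)))) ⟩
  h * h * a₂ - (h + h) * (a₂ * (1ℚ + m)) + m * (a₂ * (1ℚ + m))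
    ≡⟨ solve 3 (λ h c m → h :* h :* c :- (h :+ h) :* (c :* (con 1ℚ :+ m)) :+ m :* (c :* (con 1ℚ :+ m))
                       := c :* (((con 1ℚ :+ m) :- h) :* ((con 1ℚ :+ m) :- h) :- (con 1ℚ :+ m))) refl h a₂ m ⟩
  a₂ * (((1ℚ + m) - h) * ((1ℚ + m) - h) - (1ℚ + m))
    ≡⟨ cong (λ t → a₂ * ((t - h) * (t - h) - t)) (sym (fromℕ-suc (suc n))) ⟩
  a₂ * ((fromℕ (suc (suc n)) - h) * (fromℕ (suc (suc n)) - h) - fromℕ (suc (suc n))) ∎
  where
  open ≡-Reasoning
  a₀ a₁ a₂ m : ℚ
  a₀ = E h n
  a₁ = E h (suc n)
  a₂ = E h (suc (suc n))
  m = fromℕ (suc n)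

spread : ℚ → ℕ → ℚ
spread h k = 1ℚ ÷₀ fromℕ (suc k) + ((fromℕ k - h) ÷₀ h) ^ℚ 2

spread-nonNeg : ∀ h k → 0ℚ ≤ spread h k
spread-nonNeg h k = 0≤+ (<⇒≤ (÷₀-pos (0<fromℕ 1) (0<fromℕ (suc k)))) (subst (0ℚ ≤_) (cong (D *_) (sym (*-identityʳ D))) (0≤p*p D))
  where D = (fromℕ k - h) ÷₀ h

module _ {h : ℚ} (0<h : 0ℚ < h) {k : ℕ} (k≤ρh : fromℕ k ≤ ρ * h) where
  private
    0≤h : 0ℚ ≤ h
    0≤h = <⇒≤ 0<h

    0<h² : 0ℚ < h * h
    0<h² = positive⁻¹ (h * h) {{pos*pos⇒pos h {{positive 0<h}} h {{positive 0<h}}}}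

  -- The ratio of consecutive weights is (m + 1)/h, and k ≤ 1.9 h keeps it below 1.9 for m < k.
  -- Going down from k, the Poisson weights grow no faster than the radius of the norm allows.
  E≤ρE : ∀ m → suc m ℕ.≤ k → E h m ≤ ρ * E h (suc m)
  E≤ρE m m<k = *-cancelʳ-≤-pos h {{positive 0<h}} (begin
    E h m * h                           ≡⟨ sym (expTerm-suc h m) ⟩
    E h (suc m) * fromℕ (suc m)         ≤⟨ *-monoˡ (E-nonNeg 0≤h (suc m)) (≤-trans (fromℕ-mono-≤ m<k) k≤ρh) ⟩
    E h (suc m) * (ρ * h)               ≡⟨ solve 3 (λ e r h → e :* (r :* h) := r :* e :* h) refl (E h (suc m)) ρ h ⟩
    ρ * E h (suc m) * h                 ∎)
    where open ≤-Reasoning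

  E≤ρ^E : ∀ i j → i ℕ.+ j ℕ.≤ k → E h j ≤ ρ ^ℚ i * E h (i ℕ.+ j)
  E≤ρ^E zero    j _    = ≤-reflexive (sym (*-identityˡ (E h j)))
  E≤ρ^E (suc i) j ij≤k = begin
    E h j                                    ≤⟨ E≤ρ^E i j (ℕ.<⇒≤ ij≤k) ⟩
    ρ ^ℚ i * E h (i ℕ.+ j)                   ≤⟨ *-monoˡ (^ℚ-nonNeg i 0≤ρ) (E≤ρE (i ℕ.+ j) ij≤k) ⟩
    ρ ^ℚ i * (ρ * E h (suc (i ℕ.+ j)))       ≡⟨ solve 3 (λ a b c → a :* (b :* c) := b :* a :* c) refl (ρ ^ℚ i) ρ (E h (suc (i ℕ.+ j))) ⟩
    ρ ^ℚ suc i * E h (suc i ℕ.+ j)           ∎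
    where open ≤-Reasoning

  private
    R X κ : ℚ
    κ = fromℕ k
    R = 1ℚ ÷₀ fromℕ (suc k)
    X = (κ - h) * (κ - h)

    0≤R : 0ℚ ≤ R
    0≤R = <⇒≤ (÷₀-pos (0<fromℕ 1) (0<fromℕ (suc k)))

    h²spread : h * h * spread h k ≡ h * h * R + X
    h²spread = begin
      h * h * (R + D * (D * 1ℚ))          ≡⟨ solve 3 (λ h r d → h :* h :* (r :+ d :* (d :* con 1ℚ)) := h :* h :* r :+ (d :* h) :* (d :* h)) refl h R D ⟩
      h * h * R + (D * h) * (D * h)       ≡⟨ cong (λ t → h * h * R + t * t) (÷₀-cancel-pos (κ - h) 0<h) ⟩
      h * h * R + X                       ∎
      where
      open ≡-Reasoning
      D = (κ - h) ÷₀ h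

    -- From k(k + 1) ≤ 2k² ≤ 7.22 h². It trades the term linear in j, left over by the second
    -- difference, for the summand 1/(k + 1) of `spread`.
    k≤8h²R : κ ≤ fromℕ 8 * (h * h * R)
    k≤8h²R = begin
      κ                                     ≡⟨ sym (*-identityʳ κ) ⟩
      κ * 1ℚ                                ≡⟨ cong (κ *_) (sym (÷₀-cancel-pos 1ℚ (0<fromℕ (suc k)))) ⟩
      κ * (R * fromℕ (suc k))               ≡⟨ cong (λ t → κ * (R * t)) (fromℕ-suc k) ⟩
      κ * (R * (1ℚ + κ))                    ≡⟨ solve 2 (λ k r → k :* (r :* (con 1ℚ :+ k)) := (k :+ k :* k) :* r) refl κ R ⟩
      (κ + κ * κ) * R                       ≤⟨ *-monoʳ 0≤R (+-monoˡ-≤ (κ * κ) κ≤κ²) ⟩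
      (κ * κ + κ * κ) * R                   ≤⟨ *-monoʳ 0≤R (+-mono-≤ κ²≤ κ²≤) ⟩
      (ρ * h * (ρ * h) + ρ * h * (ρ * h)) * R  ≤⟨ ≤-by ((+ 39 / 50) * (h * h * R)) (0≤* (nonNegative⁻¹ (+ 39 / 50)) (0≤* (0≤p*p h) 0≤R))
                                                  (solve 2 (λ h r → con (fromℕ 8) :* (h :* h :* r) := (con ρ :* h :* (con ρ :* h) :+ con ρ :* h :* (con ρ :* h)) :* r :+ con (+ 39 / 50) :* (h :* h :* r)) refl h R) ⟩
      fromℕ 8 * (h * h * R)                 ∎
      where
      open ≤-Reasoning
      m≤m*m : ∀ m → m ℕ.≤ m ℕ.* m
      m≤m*m zero    = ℕ.z≤n
      m≤m*m (suc m) = ℕ.m≤m*n (suc m) (suc m)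
      κ≤κ² : κ ≤ κ * κ
      κ≤κ² = subst (κ ≤_) (fromℕ-* k k) (fromℕ-mono-≤ (m≤m*m k))
      κ²≤ : κ * κ ≤ ρ * h * (ρ * h)
      κ²≤ = *-mono (0≤fromℕ k) (0≤* 0≤ρ 0≤h) k≤ρh k≤ρh

    -- Moving from j to k = i + j loses at most a factor (1 + i)², the polynomial part of the weight
    -- `w i`. The 16 is dictated by the term 2 i² · 8 h²/(k + 1).
    quadratic : ∀ i j → i ℕ.+ j ≡ k → let J = fromℕ j ; I = fromℕ i in
      ∣ (J - h) * (J - h) - J ∣ ≤ fromℕ 16 * ((1ℚ + I) * (1ℚ + I) * (h * h * R + X))
    quadratic i j i+j≡k = begin
      ∣ (J - h) * (J - h) - J ∣
        ≤⟨ ∣p-q∣≤∣p∣+∣q∣ ((J - h) * (J - h)) J ⟩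
      ∣ (J - h) * (J - h) ∣ + ∣ J ∣
        ≡⟨ cong₂ _+_ (0≤p⇒∣p∣≡p (0≤p*p (J - h))) (0≤p⇒∣p∣≡p (0≤fromℕ j)) ⟩
      (J - h) * (J - h) + J
        -- The parallelogram law for κ - h and I, with J = κ - I.
        ≤⟨ ≤-by ((κ - h + I) * (κ - h + I) + I) (0≤+ (0≤p*p (κ - h + I)) (0≤fromℕ i))
             (trans (cong (λ t → (t - h) * (t - h) + (t - h) * (t - h) + (I * I + I * I) + t) κ≡)
               (trans (solve 3 (λ i j h → ((i :+ j) :- h) :* ((i :+ j) :- h) :+ ((i :+ j) :- h) :* ((i :+ j) :- h) :+ (i :* i :+ i :* i) :+ (i :+ j)
                 := (j :- h) :* (j :- h) :+ j :+ (((i :+ j) :- h :+ i) :* ((i :+ j) :- h :+ i) :+ i)) refl I J h)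
                 (cong (λ t → (J - h) * (J - h) + J + ((t - h + I) * (t - h + I) + I)) (sym κ≡)))) ⟩
      X + X + (I * I + I * I) + κ
        -- Either i = 0, or k ≥ i ≥ 1.
        ≤⟨ +-monoˡ-≤ κ (+-monoʳ-≤ (X + X) (+-mono-≤ I²≤ I²≤)) ⟩
      X + X + (κ * (I * I) + κ * (I * I)) + κ
        ≡⟨ solve 3 (λ x k i → x :+ x :+ (k :* (i :* i) :+ k :* (i :* i)) :+ k := x :+ x :+ (con 1ℚ :+ (i :* i :+ i :* i)) :* k) refl X κ I ⟩
      X + X + (1ℚ + (I * I + I * I)) * κ
        ≤⟨ +-monoʳ-≤ (X + X) (*-monoˡ (0≤+ 0≤1 (0≤+ (0≤p*p I) (0≤p*p I))) k≤8h²R) ⟩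
      X + X + (1ℚ + (I * I + I * I)) * (fromℕ 8 * Q)
        ≤⟨ ≤-by (fromℕ 14 * X + (fromℕ 16 * X * (I + I) + fromℕ 16 * X * (I * I)) + fromℕ 8 * Q * (1ℚ + fromℕ 4 * I))
             (0≤+ (0≤+ (0≤* (0≤fromℕ 14) 0≤X) (0≤+ (0≤* 0≤16X (0≤+ 0≤I 0≤I)) (0≤* 0≤16X (0≤p*p I)))) (0≤* (0≤* (0≤fromℕ 8) 0≤Q) (0≤+ 0≤1 (0≤* (0≤fromℕ 4) 0≤I))))
             (solve 3 (λ x i q → con (fromℕ 16) :* ((con 1ℚ :+ i) :* (con 1ℚ :+ i) :* (q :+ x))
               := x :+ x :+ (con 1ℚ :+ (i :* i :+ i :* i)) :* (con (fromℕ 8) :* q)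
                  :+ (con (fromℕ 14) :* x :+ (con (fromℕ 16) :* x :* (i :+ i) :+ con (fromℕ 16) :* x :* (i :* i)) :+ con (fromℕ 8) :* q :* (con 1ℚ :+ con (fromℕ 4) :* i))) refl X I Q) ⟩
      fromℕ 16 * ((1ℚ + I) * (1ℚ + I) * (Q + X)) ∎
      where
      open ≤-Reasoning
      I J Q : ℚ
      I = fromℕ i
      J = fromℕ j
      Q = h * h * R
      0≤I : 0ℚ ≤ I
      0≤I = 0≤fromℕ i
      0≤X : 0ℚ ≤ X
      0≤X = 0≤p*p (κ - h)
      0≤Q : 0ℚ ≤ Q
      0≤Q = 0≤* (0≤p*p h) 0≤R
      0≤16X : 0ℚ ≤ fromℕ 16 * X
      0≤16X = 0≤* (0≤fromℕ 16) 0≤X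
      κ≡ : κ ≡ I + J
      κ≡ = trans (cong fromℕ (sym i+j≡k)) (fromℕ-+ i j)
        where
        fromℕ-+ : ∀ m n → fromℕ (m ℕ.+ n) ≡ fromℕ m + fromℕ n
        fromℕ-+ zero    n = sym (+-identityˡ (fromℕ n))
        fromℕ-+ (suc m) n = trans (fromℕ-suc (m ℕ.+ n)) (trans (cong (_+_ 1ℚ) (fromℕ-+ m n))
          (trans (sym (+-assoc 1ℚ (fromℕ m) (fromℕ n))) (cong (_+ fromℕ n) (sym (fromℕ-suc m)))))
      i²≤ : ∀ i → i ℕ.≤ k → i ℕ.* i ℕ.≤ k ℕ.* (i ℕ.* i)
      i²≤ zero    _   = ℕ.z≤n
      i²≤ (suc i) i<k = ℕ.m≤n*m (suc i ℕ.* suc i) k {{ℕ.>-nonZero (ℕ.≤-trans ℕ.z<s i<k)}}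
      I²≤ : I * I ≤ κ * (I * I)
      I²≤ = subst₂ _≤_ (fromℕ-* i i) (trans (fromℕ-* k (i ℕ.* i)) (cong (κ *_) (fromℕ-* i i)))
        (fromℕ-mono-≤ (i²≤ i (subst (i ℕ.≤_) i+j≡k (ℕ.m≤m+n i j))))

  ∇∇E-central : ∀ i j → i ℕ.+ j ≡ k → ∣ ∇ (∇ (E h)) j ∣ ≤ w i * (fromℕ 16 * (E h k * spread h k))
  ∇∇E-central i j i+j≡k = *-cancelˡ-≤-pos (h * h) {{positive 0<h²}} (begin
    h * h * ∣ G ∣
      ≡⟨ cong (_* ∣ G ∣) (sym (0≤p⇒∣p∣≡p (0≤p*p h))) ⟩
    ∣ h * h ∣ * ∣ G ∣
      ≡⟨ sym (∣p*q∣≡∣p∣*∣q∣ (h * h) G) ⟩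
    ∣ h * h * G ∣
      ≡⟨ cong ∣_∣ (∇∇E h j) ⟩
    ∣ E h j * ((J - h) * (J - h) - J) ∣
      ≤⟨ *-bound {E h j} (≤-trans (≤-reflexive (0≤p⇒∣p∣≡p (E-nonNeg 0≤h j))) Ej≤) (quadratic i j i+j≡k) ⟩
    ρ ^ℚ i * E h k * (fromℕ 16 * ((1ℚ + I) * (1ℚ + I) * (h * h * R + X)))
      ≡⟨ cong₂ (λ s t → ρ ^ℚ i * E h k * (fromℕ 16 * (s * s * t))) (sym (fromℕ-suc i)) (sym h²spread) ⟩
    ρ ^ℚ i * E h k * (fromℕ 16 * (fromℕ (suc i) * fromℕ (suc i) * (h * h * spread h k)))
      ≡⟨ solve 6 (λ r e a s q c → r :* e :* (c :* (a :* a :* (q :* s))) := q :* (a :* a :* r :* (c :* (e :* s)))) refl (ρ ^ℚ i) (E h k) (fromℕ (suc i)) (spread h k) (h * h) (fromℕ 16) ⟩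
    h * h * (w i * (fromℕ 16 * (E h k * spread h k))) ∎)
    where
    open ≤-Reasoning
    G I J : ℚ
    G = ∇ (∇ (E h)) j
    I = fromℕ i
    J = fromℕ j
    Ej≤ : E h j ≤ ρ ^ℚ i * E h k
    Ej≤ = subst (λ m → E h j ≤ ρ ^ℚ i * E h m) i+j≡k (E≤ρ^E i j (ℕ.≤-reflexive i+j≡k))

-- Second differences at radius 1.9, for the outer range

term≤∑ : ∀ {a} → (∀ i → 0ℚ ≤ a i) → ∀ {j n} → j ℕ.< n → a j ≤ ∑ a n
term≤∑ {a} 0≤a {zero}  {suc n} _         = p≤p+q (a 0) (∑-nonNeg n (0≤a ∘ suc))
term≤∑ {a} 0≤a {suc j} {suc n} (ℕ.s≤s j<n) = ≤-trans (term≤∑ (0≤a ∘ suc) j<n) (p≤q+p (∑ (tail a) n) (0≤a 0))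

E-scale : ∀ q h → E (q * h) ≗ λ j → q ^ℚ j * E h j
E-scale q h j = sym (E-unique (q * h) (λ j → q ^ℚ j * E h j) refl (λ n → begin
  q * q ^ℚ n * E h (suc n) * fromℕ (suc n)      ≡⟨ *-assoc (q * q ^ℚ n) (E h (suc n)) (fromℕ (suc n)) ⟩
  q * q ^ℚ n * (E h (suc n) * fromℕ (suc n))    ≡⟨ cong (q * q ^ℚ n *_) (expTerm-suc h n) ⟩
  q * q ^ℚ n * (E h n * h)                      ≡⟨ solve 4 (λ q s e h → q :* s :* (e :* h) := s :* e :* (q :* h)) refl q (q ^ℚ n) (E h n) h ⟩
  q ^ℚ n * E h n * (q * h)                      ∎) j)
  where open ≡-Reasoning

-- In the supremum norm at radius ρ, multiplication by 1 - z costs 1 + ρ = 2.9, rounded up to 3.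
∇-sup : ∀ {a X k} → (∀ j → j ℕ.≤ k → ρ ^ℚ j * ∣ a j ∣ ≤ X) → ∀ j → j ℕ.≤ k → ρ ^ℚ j * ∣ ∇ a j ∣ ≤ fromℕ 3 * X
∇-sup {a} {X} {k} a≤ zero j≤k = ≤-trans (a≤ 0 j≤k) (≤-by (fromℕ 2 * X) (0≤* (0≤fromℕ 2) (≤-trans (0≤* 0≤1 (0≤∣p∣ (a 0))) (a≤ 0 j≤k)))
  (solve 1 (λ x → con (fromℕ 3) :* x := x :+ con (fromℕ 2) :* x) refl X))
∇-sup {a} {X} {k} a≤ (suc j) j<k = begin
  ρ ^ℚ suc j * ∣ a (suc j) - a j ∣                            ≤⟨ *-monoˡ (^ℚ-nonNeg (suc j) 0≤ρ) (∣p-q∣≤∣p∣+∣q∣ (a (suc j)) (a j)) ⟩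
  ρ ^ℚ suc j * (∣ a (suc j) ∣ + ∣ a j ∣)                      ≡⟨ solve 4 (λ r s x y → r :* s :* (x :+ y) := r :* s :* x :+ r :* (s :* y)) refl ρ (ρ ^ℚ j) ∣ a (suc j) ∣ ∣ a j ∣ ⟩
  ρ ^ℚ suc j * ∣ a (suc j) ∣ + ρ * (ρ ^ℚ j * ∣ a j ∣)         ≤⟨ +-mono-≤ (a≤ (suc j) j<k) (*-monoˡ 0≤ρ (a≤ j (ℕ.<⇒≤ j<k))) ⟩
  X + ρ * X                                                   ≤⟨ ≤-by ((+ 1 / 10) * X) (0≤* (nonNegative⁻¹ (+ 1 / 10)) 0≤X) (solve 1 (λ x → con (fromℕ 3) :* x := x :+ con ρ :* x :+ con (+ 1 / 10) :* x) refl X) ⟩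
  fromℕ 3 * X                                                 ∎
  where
  open ≤-Reasoning
  0≤X : 0ℚ ≤ X
  0≤X = ≤-trans (0≤* (^ℚ-nonNeg (suc j) 0≤ρ) (0≤∣p∣ (a (suc j)))) (a≤ (suc j) j<k)

0<ρ^ : ∀ k → 0ℚ < ρ ^ℚ k
0<ρ^ zero    = 0<fromℕ 1
0<ρ^ (suc k) = positive⁻¹ (ρ * ρ ^ℚ k) {{pos*pos⇒pos ρ (ρ ^ℚ k) {{positive (0<ρ^ k)}}}}

-- ρʲ hʲ/j! is one term of the series for e^{ρh}, hence at most its partial sum; two differences
-- cost 3 · 3. The part ρⁱ of the weight turns ρʲ into ρᵏ.
∇∇E-tail : ∀ {h} → 0ℚ ≤ h → ∀ k i j → i ℕ.+ j ≡ k →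
  ∣ ∇ (∇ (E h)) j ∣ ≤ w i * (fromℕ 9 * (expSum (ρ * h) (suc k) * (1ℚ ÷₀ ρ ^ℚ k)))
∇∇E-tail {h} 0≤h k i j i+j≡k = *-cancelˡ-≤-pos (ρ ^ℚ j) {{positive (0<ρ^ j)}} (begin
  ρ ^ℚ j * ∣ G ∣
    ≤⟨ ∇-sup (∇-sup Eρ≤) j j≤k ⟩
  fromℕ 3 * (fromℕ 3 * X)
    ≡⟨ solve 1 (λ x → con (fromℕ 3) :* (con (fromℕ 3) :* x) := con (fromℕ 9) :* x :* con 1ℚ) refl X ⟩
  fromℕ 9 * X * 1ℚ
    ≡⟨ cong (fromℕ 9 * X *_) (sym (÷₀-cancel-pos 1ℚ (0<ρ^ k))) ⟩
  fromℕ 9 * X * (Y * ρ ^ℚ k)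
    ≡⟨ cong (λ t → fromℕ 9 * X * (Y * t)) (trans (cong (ρ ^ℚ_) (sym i+j≡k)) (^ℚ-+ ρ i j)) ⟩
  fromℕ 9 * X * (Y * (ρ ^ℚ i * ρ ^ℚ j))
    ≡⟨ solve 5 (λ n x y a b → n :* x :* (y :* (a :* b)) := b :* (con 1ℚ :* a :* (n :* (x :* y)))) refl (fromℕ 9) X Y (ρ ^ℚ i) (ρ ^ℚ j) ⟩
  ρ ^ℚ j * (1ℚ * ρ ^ℚ i * (fromℕ 9 * (X * Y)))
    ≤⟨ *-monoˡ (<⇒≤ (0<ρ^ j)) (*-monoʳ (0≤* (0≤fromℕ 9) (0≤* 0≤X (<⇒≤ (÷₀-pos (0<fromℕ 1) (0<ρ^ k))))) (*-monoʳ (^ℚ-nonNeg i 0≤ρ) 1≤)) ⟩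
  ρ ^ℚ j * (w i * (fromℕ 9 * (X * Y))) ∎)
  where
  open ≤-Reasoning
  G X Y : ℚ
  G = ∇ (∇ (E h)) j
  X = expSum (ρ * h) (suc k)
  Y = 1ℚ ÷₀ ρ ^ℚ k
  j≤k : j ℕ.≤ k
  j≤k = subst (j ℕ.≤_) i+j≡k (ℕ.m≤n+m j i)
  0≤Eρ : ∀ n → 0ℚ ≤ E (ρ * h) n
  0≤Eρ = E-nonNeg (0≤* 0≤ρ 0≤h)
  0≤X : 0ℚ ≤ X
  0≤X = subst (0ℚ ≤_) (sym (expSum≡∑ (ρ * h) (suc k))) (∑-nonNeg (suc k) 0≤Eρ)
  Eρ≤ : ∀ j → j ℕ.≤ k → ρ ^ℚ j * ∣ E h j ∣ ≤ X
  Eρ≤ j j≤k = subst₂ _≤_ (trans (E-scale ρ h j) (cong (ρ ^ℚ j *_) (sym (0≤p⇒∣p∣≡p (E-nonNeg 0≤h j))))) (sym (expSum≡∑ (ρ * h) (suc k)))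
    (term≤∑ 0≤Eρ (ℕ.s≤s j≤k))
  1≤ : 1ℚ ≤ fromℕ (suc i) * fromℕ (suc i)
  1≤ = subst (1ℚ ≤_) (fromℕ-* (suc i) (suc i)) (fromℕ-mono-≤ {1} {suc i ℕ.* suc i} (ℕ.s≤s ℕ.z≤n))

genFun-approx : ∀ ds {k N M} → 4 ℕ.≤ N → suc k ℕ.≤ N → 0ℚ ≤ M →
  (∀ i j → i ℕ.+ j ≡ k → ∣ ∇ (∇ (E (totalRate ds))) j ∣ ≤ w i * M) →
  ∣ genFun ds k - totalMass ds N * E (totalRate ds) k ∣ ≤ fromℕ 4 * K₀ * (totalMass ds N * (amplification ds * squares ds)) * M
genFun-approx ds {k} {N} {M} 4≤N k<N 0≤M G≤ = begin
  ∣ genFun ds k - totalMass ds N * E (totalRate ds) k ∣           ≡⟨ cong ∣_∣ (genFun-expansion ds N k) ⟩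
  ∣ (totalDefect ds N ⊛ ∇ (∇ (E (totalRate ds)))) k ∣             ≤⟨ ∣⊛∣≤∥∥* (totalDefect ds N) (∇ (∇ (E (totalRate ds)))) k M G≤ ⟩
  ∥ totalDefect ds N ∥ (suc k) * M                                ≤⟨ *-monoʳ 0≤M (∥totalDefect∥ ds 4≤N (suc k) k<N) ⟩
  fromℕ 4 * K₀ * (totalMass ds N * (amplification ds * squares ds)) * M ∎
  where open ≤-Reasoning

-- Distribution of U and W

≗⇒≈ᴿ : ∀ x y → (∀ n → seq x n ≡ seq y n) → x ≈ᴿ y
≗⇒≈ᴿ x y p ε 0<ε = 0 , λ n _ → subst (_≤ ε) (sym (cong ∣_∣ (trans (cong (_- seq y n) (p n)) (+-inverseʳ (seq y n))))) (<⇒≤ 0<ε)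

+ᴿ-cancelˡ : ∀ x y z → y +ᴿ x ≈ᴿ z → x ≈ᴿ z -ᴿ y
+ᴿ-cancelˡ x y z p = ≈ᴿ-trans x ((y +ᴿ x) -ᴿ y) (z -ᴿ y)
  (≗⇒≈ᴿ x ((y +ᴿ x) -ᴿ y) (λ n → solve 2 (λ a b → a := (b :+ a) :- b) refl (seq x n) (seq y n)))
  (+ᴿ-cong (y +ᴿ x) z (-ᴿ y) (-ᴿ y) p (≈ᴿ-refl (-ᴿ y)))

record HasProb (S : ProbabilitySpace) (A : Pred (ProbabilitySpace.Ω S) 0ℓ) (q : ℚ) : Set where
  constructor hasProb
  open ProbabilitySpace S
  field
    event : Event A
    prob≈ : ℙ A event ≈ᴿ fromℚ q

module _ {S : ProbabilitySpace} where
  open ProbabilitySpace S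

  hasProb-≡ : ∀ {A q r} → q ≡ r → HasProb S A q → HasProb S A r
  hasProb-≡ refl p = p

  ℙ-unique : ∀ {A B q} → A ≐ B → HasProb S A q → (b : Event B) → ℙ B b ≈ᴿ fromℚ q
  ℙ-unique {A} {B} {q} A≐B (hasProb a p) b = ≈ᴿ-trans (ℙ B b) (ℙ A a) (fromℚ q) (≈ᴿ-sym (ℙ A a) (ℙ B b) (ℙ-≐ A≐B a b)) p

  hasProb-≐ : ∀ {A B q} → A ≐ B → HasProb S A q → HasProb S B q
  hasProb-≐ A≐B p@(hasProb a _) = hasProb (event-≐ A≐B a) (ℙ-unique A≐B p (event-≐ A≐B a))

  hasProb-∪ : ∀ {A B q r} → A ⊥ B → HasProb S A q → HasProb S B r → HasProb S (A ∪ B) (q + r)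
  hasProb-∪ {A} {B} {q} {r} A⊥B (hasProb a p) (hasProb b p′) = hasProb (event-∪ a b)
    (≈ᴿ-trans (ℙ (A ∪ B) (event-∪ a b)) (ℙ A a +ᴿ ℙ B b) (fromℚ (q + r)) (ℙ-∪ a b A⊥B)
      (+ᴿ-cong (ℙ A a) (fromℚ q) (ℙ B b) (fromℚ r) p p′))

  -- `B` itself is not assumed to be an event, so the difference is built as A ∩ ∁ (A ∩ B).
  -- Decidability of `B` is what splits A constructively into its two parts.
  hasProb-∖ : ∀ {A B q r} → Decidable B → HasProb S A q → HasProb S (A ∩ B) r → HasProb S (A ∩ ∁ B) (q - r)
  hasProb-∖ {A} {B} {q} {r} B? (hasProb a p) (hasProb ab p′) = hasProb e
    (≈ᴿ-trans (ℙ (A ∩ ∁ B) e) (ℙ A a -ᴿ ℙ (A ∩ B) ab) (fromℚ (q - r))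
      (+ᴿ-cancelˡ (ℙ (A ∩ ∁ B) e) (ℙ (A ∩ B) ab) (ℙ A a)
        (≈ᴿ-sym (ℙ A a) (ℙ (A ∩ B) ab +ᴿ ℙ (A ∩ ∁ B) e)
          (≈ᴿ-trans (ℙ A a) (ℙ ((A ∩ B) ∪ (A ∩ ∁ B)) (event-∪ ab e)) (ℙ (A ∩ B) ab +ᴿ ℙ (A ∩ ∁ B) e)
            (ℙ-≐ (split , merge) a (event-∪ ab e)) (ℙ-∪ ab e (λ ((_ , b) , (_ , ¬b)) → ¬b b)))))
      (+ᴿ-cong (ℙ A a) (fromℚ q) (-ᴿ ℙ (A ∩ B) ab) (-ᴿ fromℚ r) p (-ᴿ-cong (ℙ (A ∩ B) ab) (fromℚ r) p′)))
    where
    e : Event (A ∩ ∁ B)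
    e = event-≐ ((λ (α , ¬αβ) → α , λ β → ¬αβ (α , β)) , (λ (α , ¬β) → α , ¬β ∘ proj₂)) (event-∩ a (event-∁ ab))
    split : ∀ {ω} → A ω → ((A ∩ B) ∪ (A ∩ ∁ B)) ω
    split {ω} α with B? ω
    ... | yes β = inj₁ (α , β)
    ... | no ¬β = inj₂ (α , ¬β)
    merge : ∀ {ω} → ((A ∩ B) ∪ (A ∩ ∁ B)) ω → A ω
    merge (inj₁ (α , _)) = α
    merge (inj₂ (α , _)) = α

  hasProb-∅ : ∀ {A q} → HasProb S A q → HasProb S ∅ 0ℚ
  hasProb-∅ {A} {q} p = hasProb-≐ ((λ (_ , ¬⊤) → ¬⊤ _) , λ ()) (hasProb-≡ (+-inverseʳ q)
    (hasProb-∖ {A} {U} (λ _ → yes _) p (hasProb-≐ ((λ α → α , _) , proj₁) p)))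

update : (ℕ → ℕ) → ℕ → ℕ → ℕ → ℕ
update x p s q with q ℕ.≟ p
... | yes _ = s
... | no  _ = x q

update-≡ : ∀ x p s → update x p s p ≡ s
update-≡ x p s with p ℕ.≟ p
... | yes _  = refl
... | no p≢p = ⊥-elim (p≢p refl)

update-≢ : ∀ x p s {q} → p ≢ q → update x p s q ≡ x q
update-≢ x p s {q} p≢q with q ℕ.≟ p
... | yes q≡p = ⊥-elim (p≢q (sym q≡p))
... | no _    = refl

geometricMass : ℕ → ℕ → ℚ
geometricMass p k = recip p ^ℚ k * (1ℚ - recip p)

module _ {S : ProbabilitySpace} {T : List ℕ} (M : KubiliusModel S T) where
  open ProbabilitySpace S
  open RandomVariable
  open KubiliusModel M

  private
    x̂ : ℕ → Ω → ℕ
    x̂ p = value (X p)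

    -- Mutual independence speaks only of events that fix the values of finitely many variables. The
    -- inductions therefore carry a list I of primes already fixed, with values x, next to the list
    -- L still to be treated.
    Pinned : List ℕ → (ℕ → ℕ) → Pred Ω 0ℓ
    Pinned I x ω = All (λ i → x̂ i ω ≡ x i) I

    Π : List ℕ → (ℕ → ℕ) → ℚ
    Π I x = ∏ (λ i → geometricMass i (x i)) I

    record Admissible (I L : List ℕ) : Set where
      constructor admissible
      field
        uniqueI  : Unique I
        I⊆T      : All (_∈ T) I
        uniqueL  : Unique L
        L⊆T      : All (_∈ T) L
        disjoint : All (λ p → All (p ≢_) I) L

    pin : ∀ {I p L} → Admissible I (p ∷ L) → Admissible (p ∷ I) L
    pin (admissible uI I⊆T (p∉L ∷ uL) (p∈T ∷ L⊆T) (p∉I ∷ disj)) =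
      admissible (p∉I ∷ uI) (p∈T ∷ I⊆T) uL L⊆T (All.zipWith (λ (p≢q , q∉I) → (λ q≡p → p≢q (sym q≡p)) ∷ q∉I) (p∉L , disj))

    drop : ∀ {I p L} → Admissible I (p ∷ L) → Admissible I L
    drop (admissible uI I⊆T (_ ∷ uL) (_ ∷ L⊆T) (_ ∷ disj)) = admissible uI I⊆T uL L⊆T disj

    hasProb-pinned : ∀ I x → Unique I → All (_∈ T) I → HasProb S (Pinned I x) (Π I x)
    hasProb-pinned I x uI I⊆T = hasProb (event-All X x I)
      (≈ᴿ-trans (ℙ (Pinned I x) (event-All X x I)) (productᴿ (map (λ i → ℙ[ X i ≡ x i ]) I)) (fromℚ (Π I x))
        (independent I uI (All.lookup I⊆T) x) (product≈ I I⊆T))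
      where
      product≈ : ∀ I → All (_∈ T) I → productᴿ (map (λ i → ℙ[ X i ≡ x i ]) I) ≈ᴿ fromℚ (Π I x)
      product≈ []      []            = ≈ᴿ-refl 1ᴿ
      product≈ (i ∷ I) (i∈T ∷ I⊆T) = *ᴿ-cong (ℙ[ X i ≡ x i ]) (fromℚ (geometricMass i (x i)))
        (productᴿ (map (λ i → ℙ[ X i ≡ x i ]) I)) (fromℚ (Π I x)) (law i i∈T (x i)) (product≈ I I⊆T)

    pinned-update : ∀ {I p} x s → All (p ≢_) I → Pinned I (update x p s) ≐ Pinned I x
    pinned-update x s []             = (λ { [] → [] }) , (λ { [] → [] })
    pinned-update {i ∷ I} {p} x s (p≢i ∷ p∉I) =
        (λ { (e ∷ es) → trans e (update-≢ x p s p≢i) ∷ proj₁ (pinned-update x s p∉I) es })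
      , (λ { (e ∷ es) → trans e (sym (update-≢ x p s p≢i)) ∷ proj₂ (pinned-update x s p∉I) es })

    Π-update : ∀ {I p} x s → All (p ≢_) I → Π I (update x p s) ≡ Π I x
    Π-update x s []                    = refl
    Π-update {i ∷ I} {p} x s (p≢i ∷ p∉I) = cong₂ _*_ (cong (geometricMass i) (update-≢ x p s p≢i)) (Π-update x s p∉I)

    hasProb-pin : ∀ {I p L x s q} {B : Pred Ω 0ℓ} → Admissible I (p ∷ L) →
      HasProb S (Pinned (p ∷ I) (update x p s) ∩ B) (Π (p ∷ I) (update x p s) * q) →
      HasProb S (Pinned I x ∩ ((λ ω → x̂ p ω ≡ s) ∩ B)) (Π I x * (geometricMass p s * q))
    hasProb-pin {I} {p} {L} {x} {s} {q} {B} adm h = hasProb-≡ value≡ (hasProb-≐ (to , from) h)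
      where
      p∉I : All (p ≢_) I
      p∉I = All.head (Admissible.disjoint adm)
      Before After : Pred Ω 0ℓ
      Before = Pinned (p ∷ I) (update x p s) ∩ B
      After  = Pinned I x ∩ ((λ ω → x̂ p ω ≡ s) ∩ B)
      to : ∀ {ω} → Before ω → After ω
      to (e ∷ es , b) = proj₁ (pinned-update x s p∉I) es , trans e (update-≡ x p s) , b
      from : ∀ {ω} → After ω → Before ω
      from (es , e , b) = trans e (sym (update-≡ x p s)) ∷ proj₂ (pinned-update x s p∉I) es , b
      value≡ : Π (p ∷ I) (update x p s) * q ≡ Π I x * (geometricMass p s * q)
      value≡ = trans (cong₂ (λ a b → geometricMass p a * b * q) (update-≡ x p s) (Π-update x s p∉I))
        (solve 3 (λ a b c → a :* b :* c := b :* (a :* c)) refl (geometricMass p s) (Π I x) q)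

    hasProb-[] : ∀ {I} x → Admissible I [] → ∀ k → HasProb S (Pinned I x ∩ (λ _ → 0 ≡ k)) (Π I x * δ k)
    hasProb-[] {I} x (admissible uI I⊆T _ _ _) zero = hasProb-≡ (sym (*-identityʳ (Π I x)))
      (hasProb-≐ ((λ es → es , refl) , proj₁) (hasProb-pinned I x uI I⊆T))
    hasProb-[] {I} x (admissible uI I⊆T _ _ _) (suc k) = hasProb-≡ (sym (*-zeroʳ (Π I x)))
      (hasProb-≐ ((λ ()) , λ ()) (hasProb-∅ (hasProb-pinned I x uI I⊆T)))

    total : List ℕ → Ω → ℕ
    total L ω = sum (map (λ p → x̂ p ω) L)

    count : List ℕ → Ω → ℕ
    count L ω = length (filter (λ p → 1 ℕ.≤? x̂ p ω) L)

    hasProb-total : ∀ {L} (2≤L : All (2 ℕ.≤_) L) I x → Admissible I L → ∀ k →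
      HasProb S (Pinned I x ∩ (λ ω → total L ω ≡ k)) (Π I x * genFun (factors geometricFactor 2≤L) k)
    hasProb-total [] I x adm k = hasProb-[] x adm k
    hasProb-total (_∷_ {p} {L} 2≤p 2≤L) I x adm k = hasProb-≡ (cong (Π I x *_) (⊛-cong {b = F} shift₀ (λ _ → refl) k))
      (hasProb-≐ ((λ (es , _ , e) → es , trans e (ℕ.+-identityʳ k)) , (λ (es , e) → es , ℕ.z≤n , trans e (sym (ℕ.+-identityʳ k)))) (upward 0 k))
      where
      F : Series
      F = genFun (factors geometricFactor 2≤L)
      shift : ℕ → Series
      shift s i = geometricMass p (i ℕ.+ s)
      shift₀ : shift 0 ≗ geometricMass p
      shift₀ i = cong (geometricMass p) (ℕ.+-identityʳ i)
      AtLeast : ℕ → ℕ → Pred Ω 0ℓ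
      AtLeast s n ω = s ℕ.≤ x̂ p ω × x̂ p ω ℕ.+ total L ω ≡ n ℕ.+ s
      atom : ∀ s m → HasProb S (Pinned I x ∩ ((λ ω → x̂ p ω ≡ s) ∩ (λ ω → total L ω ≡ m))) (Π I x * (geometricMass p s * F m))
      atom s m = hasProb-pin adm (hasProb-total 2≤L (p ∷ I) (update x p s) (pin adm) m)
      -- The sum n + s is constant in the recursion: each step splits off X_p = s, just as `⊛`
      -- splits off the head of the shifted law. Only finite additivity is used.
      upward : ∀ s n → HasProb S (Pinned I x ∩ AtLeast s n) (Π I x * (shift s ⊛ F) n)
      upward s zero = hasProb-≐ (to , from) (atom s 0)
        where
        to : ∀ {ω} → (Pinned I x ∩ ((λ ω → x̂ p ω ≡ s) ∩ (λ ω → total L ω ≡ 0))) ω → (Pinned I x ∩ AtLeast s 0) ω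
        to (es , e , t) = es , ℕ.≤-reflexive (sym e) , trans (cong₂ ℕ._+_ e t) (ℕ.+-identityʳ s)
        from : ∀ {ω} → (Pinned I x ∩ AtLeast s 0) ω → (Pinned I x ∩ ((λ ω → x̂ p ω ≡ s) ∩ (λ ω → total L ω ≡ 0))) ω
        from {ω} (es , s≤ , e) = es , x≡s , ℕ.+-cancelˡ-≡ s (total L ω) 0 (trans (cong (ℕ._+ total L ω) (sym x≡s)) (trans e (sym (ℕ.+-identityʳ s))))
          where
          x≡s : x̂ p ω ≡ s
          x≡s = ℕ.≤-antisym (ℕ.≤-trans (ℕ.m≤m+n (x̂ p ω) (total L ω)) (ℕ.≤-reflexive e)) s≤
      upward s (suc n) = hasProb-≡ value≡ (hasProb-≐ (to , from) (hasProb-∪ apart (atom s (suc n)) (upward (suc s) n)))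
        where
        Split : Pred Ω 0ℓ
        Split = (Pinned I x ∩ ((λ ω → x̂ p ω ≡ s) ∩ (λ ω → total L ω ≡ suc n))) ∪ (Pinned I x ∩ AtLeast (suc s) n)
        apart : (Pinned I x ∩ ((λ ω → x̂ p ω ≡ s) ∩ (λ ω → total L ω ≡ suc n))) ⊥ (Pinned I x ∩ AtLeast (suc s) n)
        apart ((_ , e , _) , (_ , s< , _)) = ℕ.<⇒≢ s< (sym e)
        to : ∀ {ω} → Split ω → (Pinned I x ∩ AtLeast s (suc n)) ω
        to (inj₁ (es , e , t)) = es , ℕ.≤-reflexive (sym e) , trans (cong₂ ℕ._+_ e t) (ℕ.+-comm s (suc n))
        to (inj₂ (es , s< , e)) = es , ℕ.<⇒≤ s< , trans e (ℕ.+-suc n s)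
        from : ∀ {ω} → (Pinned I x ∩ AtLeast s (suc n)) ω → Split ω
        from {ω} (es , s≤ , e) with ℕ.m≤n⇒m<n∨m≡n s≤
        ... | inj₁ s<   = inj₂ (es , s< , trans e (sym (ℕ.+-suc n s)))
        ... | inj₂ s≡x = inj₁ (es , sym s≡x , ℕ.+-cancelˡ-≡ s (total L ω) (suc n) (trans (cong (ℕ._+ total L ω) s≡x) (trans e (ℕ.+-comm (suc n) s))))
        value≡ : Π I x * (geometricMass p s * F (suc n)) + Π I x * (shift (suc s) ⊛ F) n ≡ Π I x * (shift s ⊛ F) (suc n)
        value≡ = trans (sym (*-distribˡ-+ (Π I x) (geometricMass p s * F (suc n)) ((shift (suc s) ⊛ F) n)))
          (cong (λ t → Π I x * (geometricMass p s * F (suc n) + t)) (⊛-cong {b = F} (λ i → cong (geometricMass p) (ℕ.+-suc i s)) (λ _ → refl) n))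

    -- X_p ≥ 1 comprises infinitely many values, so its contribution is found by subtracting the
    -- case X_p = 0 from the event that leaves X_p free. This takes the induction hypothesis both
    -- with p pinned and with p dropped.
    hasProb-count : ∀ {L} (2≤L : All (2 ℕ.≤_) L) I x → Admissible I L → ∀ k →
      HasProb S (Pinned I x ∩ (λ ω → count L ω ≡ k)) (Π I x * genFun (factors bernoulliFactor 2≤L) k)
    hasProb-count [] I x adm k = hasProb-[] x adm k
    hasProb-count (_∷_ {p} {L} 2≤p 2≤L) I x adm = step
      where
      F : Series
      F = genFun (factors bernoulliFactor 2≤L)
      f : Series
      f = bernoulliGF p 2≤p
      Null : Pred Ω 0ℓ
      Null ω = x̂ p ω ≡ 0
      Count : ℕ → Pred Ω 0ℓ
      Count m ω = count L ω ≡ m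
      count-null : ∀ {ω} → Null ω → count (p ∷ L) ω ≡ count L ω
      count-null {ω} e = cong length (filter-reject (λ p → 1 ℕ.≤? x̂ p ω) {p} {L} (λ 1≤x → ℕ.<⇒≢ 1≤x (sym e)))
      count-hit : ∀ {ω} → x̂ p ω ≢ 0 → count (p ∷ L) ω ≡ suc (count L ω)
      count-hit {ω} x≢0 = cong length (filter-accept (λ p → 1 ℕ.≤? x̂ p ω) {p} {L} (ℕ.n≢0⇒n>0 x≢0))
      null : ∀ m → HasProb S (Pinned I x ∩ (Null ∩ Count m)) (Π I x * (geometricMass p 0 * F m))
      null m = hasProb-pin adm (hasProb-count 2≤L (p ∷ I) (update x p 0) (pin adm) m)
      hit : ∀ m → HasProb S ((Pinned I x ∩ Count m) ∩ ∁ Null) (Π I x * F m - Π I x * (geometricMass p 0 * F m))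
      hit m = hasProb-∖ {A = Pinned I x ∩ Count m} {B = Null} (λ ω → x̂ p ω ℕ.≟ 0) (hasProb-count 2≤L I x (drop adm) m)
        (hasProb-≐ ((λ (es , e , c) → (es , c) , e) , (λ ((es , c) , e) → es , e , c)) (null m))
      step : ∀ k → HasProb S (Pinned I x ∩ (λ ω → count (p ∷ L) ω ≡ k)) (Π I x * (f ⊛ F) k)
      step zero = hasProb-≡ (cong (λ t → Π I x * (t * F 0)) (*-identityˡ (1ℚ - recip p))) (hasProb-≐ (to , from) (null 0))
        where
        to : ∀ {ω} → (Pinned I x ∩ (Null ∩ Count 0)) ω → (Pinned I x ∩ (λ ω → count (p ∷ L) ω ≡ 0)) ω
        to (es , e , c) = es , trans (count-null e) c
        from : ∀ {ω} → (Pinned I x ∩ (λ ω → count (p ∷ L) ω ≡ 0)) ω → (Pinned I x ∩ (Null ∩ Count 0)) ω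
        from {ω} (es , c) with x̂ p ω ℕ.≟ 0
        ... | yes e   = es , e , trans (sym (count-null e)) c
        ... | no x≢0 with () ← trans (sym c) (count-hit x≢0)
      step (suc k) = hasProb-≡ value≡ (hasProb-≐ (to , from) (hasProb-∪ (λ ((_ , e , _) , (_ , x≢0)) → x≢0 e) (null (suc k)) (hit k)))
        where
        Split : Pred Ω 0ℓ
        Split = (Pinned I x ∩ (Null ∩ Count (suc k))) ∪ ((Pinned I x ∩ Count k) ∩ ∁ Null)
        to : ∀ {ω} → Split ω → (Pinned I x ∩ (λ ω → count (p ∷ L) ω ≡ suc k)) ω
        to (inj₁ (es , e , c))     = es , trans (count-null e) c
        to (inj₂ ((es , c) , x≢0)) = es , trans (count-hit x≢0) (cong suc c)
        from : ∀ {ω} → (Pinned I x ∩ (λ ω → count (p ∷ L) ω ≡ suc k)) ω → Split ω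
        from {ω} (es , c) with x̂ p ω ℕ.≟ 0
        ... | yes e  = inj₁ (es , e , trans (sym (count-null e)) c)
        ... | no x≢0 = inj₂ ((es , ℕ.suc-injective (trans (sym (count-hit x≢0)) c)) , x≢0)
        tail-f : tail f ≗ recip p · δ
        tail-f zero    = sym (*-identityʳ (recip p))
        tail-f (suc i) = sym (*-zeroʳ (recip p))
        value≡ : Π I x * (geometricMass p 0 * F (suc k)) + (Π I x * F k - Π I x * (geometricMass p 0 * F k)) ≡ Π I x * (f ⊛ F) (suc k)
        value≡ = trans
          (solve 4 (λ π r a b → π :* (con 1ℚ :* (con 1ℚ :- r) :* a) :+ (π :* b :- π :* (con 1ℚ :* (con 1ℚ :- r) :* b)) := π :* ((con 1ℚ :- r) :* a :+ r :* b)) refl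
            (Π I x) (recip p) (F (suc k)) (F k))
          (cong (λ t → Π I x * ((1ℚ - recip p) * F (suc k) + t))
            (sym (trans (⊛-cong {b = F} tail-f (λ _ → refl) k) (trans (⊛-scaleˡ (recip p) δ F k) (cong (recip p *_) (⊛-identityˡ F k))))))

    whole : Unique T → Admissible [] T
    whole uT = admissible [] [] uT (All.tabulate (λ i∈T → i∈T)) (All.tabulate (λ _ → []))

  ℙ[Wᵀ≡_]≈ : ∀ k (2≤T : All (2 ℕ.≤_) T) → Unique T → ℙ[ Wᵀ M ≡ k ] ≈ᴿ fromℚ (genFun (factors geometricFactor 2≤T) k)
  ℙ[Wᵀ≡ k ]≈ 2≤T uT = ℙ-unique (proj₂ , (λ e → [] , e))
    (hasProb-≡ (*-identityˡ (genFun (factors geometricFactor 2≤T) k)) (hasProb-total 2≤T [] (λ _ → 0) (whole uT) k)) (measurable (Wᵀ M) k)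

  ℙ[Uᵀ≡_]≈ : ∀ k (2≤T : All (2 ℕ.≤_) T) → Unique T → ℙ[ Uᵀ M ≡ k ] ≈ᴿ fromℚ (genFun (factors bernoulliFactor 2≤T) k)
  ℙ[Uᵀ≡ k ]≈ 2≤T uT = ℙ-unique (proj₂ , (λ e → [] , e))
    (hasProb-≡ (*-identityˡ (genFun (factors bernoulliFactor 2≤T) k)) (hasProb-count 2≤T [] (λ _ → 0) (whole uT) k)) (measurable (Uᵀ M) k)

-- Comparison with the Poisson law

-- The truncation order N becomes the index of the Cauchy sequence, so an inequality for all large N
-- is already an inequality between reals.
massᴿ : List Factor → ℝ
massᴿ []       = 1ᴿ
massᴿ (d ∷ ds) = exp (- Factor.rate d) *ᴿ massᴿ ds

massᴿ-seq : ∀ ds n → seq (massᴿ ds) n ≡ totalMass ds n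
massᴿ-seq []       n = refl
massᴿ-seq (d ∷ ds) n = cong (expSum (- Factor.rate d) n *_) (massᴿ-seq ds n)

massᴿ≈exp : ∀ ds → massᴿ ds ≈ᴿ exp (- totalRate ds)
-- Index 0 is excluded because the empty partial sum is 0, not 1.
massᴿ≈exp [] ε 0<ε = 1 , λ { (suc n) _ → subst (_≤ ε) (sym (cong (λ x → ∣ 1ℚ - x ∣)
    (trans (expSum≡∑ (- 0ℚ) (suc n)) (trans (∑-cong E-0 (suc n)) (cong (_+_ 1ℚ) (zeros n)))))) (<⇒≤ 0<ε) }
  where
  zeros : ∀ n → ∑ (λ _ → 0ℚ) n ≡ 0ℚ
  zeros zero    = refl
  zeros (suc n) = trans (+-identityˡ (∑ (λ _ → 0ℚ) n)) (zeros n)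
massᴿ≈exp (d ∷ ds) = ≈ᴿ-trans (exp (- r) *ᴿ massᴿ ds) (exp (- r) *ᴿ exp (- h)) (exp (- (r + h)))
  (*ᴿ-congˡ (exp (- r)) (massᴿ ds) (exp (- h)) (massᴿ≈exp ds))
  (subst (λ q → exp (- r) *ᴿ exp (- h) ≈ᴿ exp q) (sym (neg-distrib-+ r h)) (exp-+ (- r) (- h)))
  where
  r = Factor.rate d
  h = totalRate ds

-- In order: 4K₀ from the norm of the total defect, 4^{4K} from the amplification, 4 from λ² ≤ 4/p²,
-- and 16 from `quadratic`, which also covers the 9 of the outer range.
constant : ℚ
constant = fromℕ 4 * K₀ * fromℕ 4 ^ℚ (K ℕ.* 4) * fromℕ 4 * fromℕ 16

constant-nonNeg : 0ℚ ≤ constant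
constant-nonNeg = 0≤* (0≤* (0≤* (0≤* (0≤fromℕ 4) 0≤K₀) (^ℚ-nonNeg (K ℕ.* 4) (0≤fromℕ 4))) (0≤fromℕ 4)) (0≤fromℕ 16)

constant-bound : ∀ {m a q s y n} → 0ℚ ≤ m → 0ℚ ≤ a → 0ℚ ≤ q → 0ℚ ≤ y → n ℕ.≤ 16 → a ≤ fromℕ 4 ^ℚ (K ℕ.* 4) → q ≤ fromℕ 4 * s →
  fromℕ 4 * K₀ * (m * (a * q)) * (fromℕ n * y) ≤ constant * s * (m * y)
constant-bound {m} {a} {q} {s} {y} {n} 0≤m 0≤a 0≤q 0≤y n≤16 a≤ q≤ = begin
  fromℕ 4 * K₀ * (m * (a * q)) * (fromℕ n * y)
    ≤⟨ *-mono (0≤* 0≤4K₀ (0≤* 0≤m (0≤* 0≤a 0≤q))) (0≤* (0≤fromℕ 16) 0≤y)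
         (*-monoˡ 0≤4K₀ (*-monoˡ 0≤m (*-mono 0≤a (≤-trans 0≤q q≤) a≤ q≤))) (*-monoʳ 0≤y (fromℕ-mono-≤ n≤16)) ⟩
  fromℕ 4 * K₀ * (m * (B * (fromℕ 4 * s))) * (fromℕ 16 * y)
    ≡⟨ solve 7 (λ k m b f s g y → k :* (m :* (b :* (f :* s))) :* (g :* y) := k :* b :* f :* g :* s :* (m :* y)) refl
         (fromℕ 4 * K₀) m B (fromℕ 4) s (fromℕ 16) y ⟩
  constant * s * (m * y) ∎
  where
  open ≤-Reasoning
  B : ℚ
  B = fromℕ 4 ^ℚ (K ℕ.* 4)
  0≤4K₀ : 0ℚ ≤ fromℕ 4 * K₀
  0≤4K₀ = 0≤* (0≤fromℕ 4) 0≤K₀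

-- `∇∇E-central` divides by h and so needs h > 0. If there are no factors, h = 0 and both laws are
-- the point mass at 0.
exact-or-positive : ∀ ds → (∀ k N → genFun ds k - E (totalRate ds) k * seq (massᴿ ds) N ≡ 0ℚ) ⊎ 0ℚ < totalRate ds
exact-or-positive []       = inj₁ λ k N → trans (cong (_-_ (δ k)) (trans (*-identityʳ (E 0ℚ k)) (E-0 k))) (+-inverseʳ (δ k))
exact-or-positive (d ∷ ds) = inj₂ (<-≤-trans (Factor.rate-pos d) (p≤p+q (Factor.rate d) (totalRate-nonNeg ds)))

Approximation : (T : List ℕ) (h : ℚ) (k : ℕ) (y z : ℝ) → Set
Approximation T h k y z =
    (fromℕ k ≤ (+ 19 / 10) * h →
      ∣ y -ᴿ z ∣ᴿ ≤ᴿ fromℚ constant *ᴿ fromℚ (H″ T) *ᴿ fromℚ (h ^ℚ k ÷₀ fromℕ (k !)) *ᴿ exp (- h)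
                       *ᴿ fromℚ (1ℚ ÷₀ fromℕ (suc k) + ((fromℕ k - h) ÷₀ h) ^ℚ 2))
  × ((+ 19 / 10) * h < fromℕ k →
      ∣ y -ᴿ z ∣ᴿ ≤ᴿ fromℚ constant *ᴿ fromℚ (H″ T) *ᴿ exp ((+ 9 / 10) * h) *ᴿ fromℚ (1ℚ ÷₀ (+ 19 / 10) ^ℚ k))

module _ (factor : ∀ p → 2 ℕ.≤ p → Factor)
         (rate²≤ : ∀ p 2≤p → Factor.rate (factor p 2≤p) * Factor.rate (factor p 2≤p) ≤ fromℕ 4 * recipSq p)
         {T : List ℕ} (2≤T : All (2 ℕ.≤_) T) (unique : Unique T) where
  private
    ds : List Factor
    ds = factors factor 2≤T
    h : ℚ
    h = totalRate ds
    0≤h : 0ℚ ≤ h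
    0≤h = totalRate-nonNeg ds
    q : ℚ
    q = H″ T

    approx : ∀ {k N n y} → 4 ℕ.≤ N → suc k ℕ.≤ N → 0ℚ ≤ y → n ℕ.≤ 16 →
      (∀ i j → i ℕ.+ j ≡ k → ∣ ∇ (∇ (E h)) j ∣ ≤ w i * (fromℕ n * y)) →
      ∣ genFun ds k - E h k * seq (massᴿ ds) N ∣ ≤ constant * q * (seq (massᴿ ds) N * y)
    approx {k} {N} {n} {y} 4≤N k<N 0≤y n≤16 G≤ = subst (λ m → ∣ genFun ds k - E h k * m ∣ ≤ constant * q * (m * y)) (sym (massᴿ-seq ds N))
      (≤-trans (≤-reflexive (cong (λ t → ∣ genFun ds k - t ∣) (*-comm (E h k) (totalMass ds N))))
        (≤-trans (genFun-approx ds 4≤N k<N (0≤* (0≤fromℕ n) 0≤y) G≤)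
          (constant-bound (totalMass-nonNeg ds 4≤N) (≤-trans 0≤1 (1≤amplification ds)) (squares-nonNeg ds) 0≤y n≤16
            (amplification≤ factor rate²≤ 2≤T unique) (squares≤ factor rate²≤ 2≤T))))

    0≤mass : ∀ {N} → 4 ℕ.≤ N → 0ℚ ≤ seq (massᴿ ds) N
    0≤mass {N} 4≤N = subst (0ℚ ≤_) (sym (massᴿ-seq ds N)) (totalMass-nonNeg ds 4≤N)

    0≤q : 0ℚ ≤ q
    0≤q = *-cancelˡ-≤-pos (fromℕ 4) {{positive (0<fromℕ 4)}} (≤-trans (squares-nonNeg ds) (squares≤ factor rate²≤ 2≤T))

    central : ∀ k N → 4 ℕ.≤ N → suc k ℕ.≤ N → fromℕ k ≤ ρ * h →
      ∣ genFun ds k - E h k * seq (massᴿ ds) N ∣ ≤ constant * q * E h k * seq (massᴿ ds) N * spread h k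
    central k N 4≤N k<N k≤ρh with exact-or-positive ds
    ... | inj₁ exact = subst (_≤ constant * q * E h k * seq (massᴿ ds) N * spread h k) (sym (cong ∣_∣ (exact k N)))
          (0≤* (0≤* (0≤* (0≤* constant-nonNeg 0≤q) (E-nonNeg 0≤h k)) (0≤mass 4≤N)) (spread-nonNeg h k))
    ... | inj₂ 0<h = ≤-trans
          (approx 4≤N k<N (0≤* (E-nonNeg 0≤h k) (spread-nonNeg h k)) ℕ.≤-refl (∇∇E-central 0<h k≤ρh))
          (≤-reflexive (solve 5 (λ c q m e s → c :* q :* (m :* (e :* s)) := c :* q :* e :* m :* s) refl
            constant q (seq (massᴿ ds) N) (E h k) (spread h k)))

    outer : ∀ k N → 4 ℕ.≤ N → suc k ℕ.≤ N →
      ∣ genFun ds k - E h k * seq (massᴿ ds) N ∣ ≤ constant * q * (seq (massᴿ ds) N * expSum (ρ * h) N) * (1ℚ ÷₀ ρ ^ℚ k)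
    outer k N 4≤N k<N = ≤-trans
      (approx 4≤N k<N (0≤* 0≤X 0≤Y) (ℕ.m≤m+n 9 7) (∇∇E-tail 0≤h k))
      (≤-trans (*-monoˡ (0≤* constant-nonNeg 0≤q) (*-monoˡ (0≤mass 4≤N) (*-monoʳ 0≤Y X≤)))
        (≤-reflexive (solve 5 (λ c q m x y → c :* q :* (m :* (x :* y)) := c :* q :* (m :* x) :* y) refl
          constant q (seq (massᴿ ds) N) (expSum (ρ * h) N) (1ℚ ÷₀ ρ ^ℚ k))))
      where
      0≤Y : 0ℚ ≤ 1ℚ ÷₀ ρ ^ℚ k
      0≤Y = <⇒≤ (÷₀-pos (0<fromℕ 1) (0<ρ^ k))
      0≤Eρ : ∀ n → 0ℚ ≤ E (ρ * h) n
      0≤Eρ = E-nonNeg (0≤* 0≤ρ 0≤h)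
      0≤X : 0ℚ ≤ expSum (ρ * h) (suc k)
      0≤X = subst (0ℚ ≤_) (sym (expSum≡∑ (ρ * h) (suc k))) (∑-nonNeg (suc k) 0≤Eρ)
      X≤ : expSum (ρ * h) (suc k) ≤ expSum (ρ * h) N
      X≤ = subst₂ _≤_ (sym (expSum≡∑ (ρ * h) (suc k))) (sym (expSum≡∑ (ρ * h) N)) (∑-monoˡ 0≤Eρ k<N)

  approximation : ∀ k y z → y ≈ᴿ fromℚ (genFun ds k) → z ≈ᴿ poissonLaw h k → Approximation T h k y z
  approximation k y z y≈ z≈ = first , second
    where
    m C e d d′ ℓ : ℝ
    m = massᴿ ds
    C = fromℚ constant *ᴿ fromℚ q
    e = fromℚ (E h k)
    d = fromℚ (spread h k)
    d′ = fromℚ (1ℚ ÷₀ ρ ^ℚ k)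
    ℓ = ∣ fromℚ (genFun ds k) -ᴿ e *ᴿ m ∣ᴿ
    ℓ≈ : ℓ ≈ᴿ ∣ y -ᴿ z ∣ᴿ
    ℓ≈ = ∣∣ᴿ-cong (fromℚ (genFun ds k) -ᴿ e *ᴿ m) (y -ᴿ z)
      (+ᴿ-cong (fromℚ (genFun ds k)) y (-ᴿ (e *ᴿ m)) (-ᴿ z) (≈ᴿ-sym y (fromℚ (genFun ds k)) y≈)
        (-ᴿ-cong (e *ᴿ m) z (≈ᴿ-trans (e *ᴿ m) (e *ᴿ exp (- h)) z (*ᴿ-congˡ e m (exp (- h)) (massᴿ≈exp ds)) (≈ᴿ-sym z (e *ᴿ exp (- h)) z≈))))
    first : fromℕ k ≤ ρ * h → ∣ y -ᴿ z ∣ᴿ ≤ᴿ C *ᴿ e *ᴿ exp (- h) *ᴿ d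
    first k≤ρh = ≤ᴿ-resp-≈ᴿ ℓ ∣ y -ᴿ z ∣ᴿ (C *ᴿ e *ᴿ m *ᴿ d) (C *ᴿ e *ᴿ exp (- h) *ᴿ d) ℓ≈
      (*ᴿ-cong (C *ᴿ e *ᴿ m) (C *ᴿ e *ᴿ exp (- h)) d d (*ᴿ-congˡ (C *ᴿ e) m (exp (- h)) (massᴿ≈exp ds)) (≈ᴿ-refl d))
      -- Order 4 secures the bounds on each mass, and order k + 1 the norm of the defect up to index
      -- k.
      (eventually-≤⇒≤ᴿ ℓ (C *ᴿ e *ᴿ m *ᴿ d) (4 ℕ.⊔ suc k) λ N N≥ →
        central k N (ℕ.m⊔n≤o⇒m≤o 4 (suc k) N≥) (ℕ.m⊔n≤o⇒n≤o 4 (suc k) N≥) k≤ρh)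
    second : ρ * h < fromℕ k → ∣ y -ᴿ z ∣ᴿ ≤ᴿ C *ᴿ exp ((+ 9 / 10) * h) *ᴿ d′
    second _ = ≤ᴿ-resp-≈ᴿ ℓ ∣ y -ᴿ z ∣ᴿ (C *ᴿ (m *ᴿ exp (ρ * h)) *ᴿ d′) (C *ᴿ exp ((+ 9 / 10) * h) *ᴿ d′) ℓ≈
      (*ᴿ-cong (C *ᴿ (m *ᴿ exp (ρ * h))) (C *ᴿ exp ((+ 9 / 10) * h)) d′ d′ (*ᴿ-congˡ C (m *ᴿ exp (ρ * h)) (exp ((+ 9 / 10) * h)) m*exp≈) (≈ᴿ-refl d′))
      (eventually-≤⇒≤ᴿ ℓ (C *ᴿ (m *ᴿ exp (ρ * h)) *ᴿ d′) (4 ℕ.⊔ suc k) λ N N≥ →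
        outer k N (ℕ.m⊔n≤o⇒m≤o 4 (suc k) N≥) (ℕ.m⊔n≤o⇒n≤o 4 (suc k) N≥))
      where
      m*exp≈ : m *ᴿ exp (ρ * h) ≈ᴿ exp ((+ 9 / 10) * h)
      m*exp≈ = ≈ᴿ-trans (m *ᴿ exp (ρ * h)) (exp (- h) *ᴿ exp (ρ * h)) (exp ((+ 9 / 10) * h))
        (*ᴿ-cong m (exp (- h)) (exp (ρ * h)) (exp (ρ * h)) (massᴿ≈exp ds) (≈ᴿ-refl (exp (ρ * h))))
        (subst (λ r → exp (- h) *ᴿ exp (ρ * h) ≈ᴿ exp r) (solve 1 (λ h → :- h :+ con ρ :* h := con (+ 9 / 10) :* h) refl h) (exp-+ (- h) (ρ * h)))

theorem4 : Σ ℝ λ C →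
    (T : List ℕ) → IsPrimeSet T →
    (S : ProbabilitySpace) (M : KubiliusModel S T) →
    (Y : RandomVariable S) (h : ℚ) →
    ((Y ≡ Uᵀ M × h ≡ H T) ⊎ (Y ≡ Wᵀ M × h ≡ H′ T)) →
    (S′ : ProbabilitySpace) (Z : RandomVariable S′) → HasLaw Z (poissonLaw h) →
    (k : ℕ) →
    (fromℕ k ≤ (+ 19 / 10) * h →
    ∣ ℙ[ Y ≡ k ] -ᴿ ℙ[ Z ≡ k ] ∣ᴿ
    ≤ᴿ C *ᴿ fromℚ (H″ T) *ᴿ fromℚ (h ^ℚ k ÷₀ fromℕ (k !)) *ᴿ exp (- h)
    *ᴿ fromℚ (1ℚ ÷₀ fromℕ (suc k) + ((fromℕ k - h) ÷₀ h) ^ℚ 2))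
    × ((+ 19 / 10) * h < fromℕ k →
    ∣ ℙ[ Y ≡ k ] -ᴿ ℙ[ Z ≡ k ] ∣ᴿ
    ≤ᴿ C *ᴿ fromℚ (H″ T) *ᴿ exp ((+ 9 / 10) * h) *ᴿ fromℚ (1ℚ ÷₀ (+ 19 / 10) ^ℚ k))
theorem4 = fromℚ constant , cases
  where
  cases : ∀ T → IsPrimeSet T → ∀ S (M : KubiliusModel S T) Y h →
    ((Y ≡ Uᵀ M × h ≡ H T) ⊎ (Y ≡ Wᵀ M × h ≡ H′ T)) →
    ∀ S′ (Z : RandomVariable S′) → HasLaw Z (poissonLaw h) → ∀ k → Approximation T h k ℙ[ Y ≡ k ] ℙ[ Z ≡ k ]
  cases T primeSet S M Y h kind S′ Z lawZ k = by kind
    where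
    open IsPrimeSet primeSet
    2≤T : All (2 ℕ.≤_) T
    2≤T = All.map (λ {p} prime → ℕ.nonTrivial⇒n>1 p {{prime⇒nonTrivial prime}}) primes
    law : ∀ {r} → r ≡ h → ℙ[ Z ≡ k ] ≈ᴿ poissonLaw r k
    law refl = lawZ k
    by : ((Y ≡ Uᵀ M × h ≡ H T) ⊎ (Y ≡ Wᵀ M × h ≡ H′ T)) → Approximation T h k ℙ[ Y ≡ k ] ℙ[ Z ≡ k ]
    by (inj₁ (refl , h≡)) = subst (λ r → Approximation T r k ℙ[ Y ≡ k ] ℙ[ Z ≡ k ]) rate≡
      (approximation bernoulliFactor recip²≤ 2≤T distinct k ℙ[ Y ≡ k ] ℙ[ Z ≡ k ] (ℙ[Uᵀ≡_]≈ M k 2≤T distinct) (law rate≡))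
      where rate≡ = trans (totalRate-bernoulli 2≤T) (sym h≡)
    by (inj₂ (refl , h≡)) = subst (λ r → Approximation T r k ℙ[ Y ≡ k ] ℙ[ Z ≡ k ]) rate≡
      (approximation geometricFactor recipPred²≤ 2≤T distinct k ℙ[ Y ≡ k ] ℙ[ Z ≡ k ] (ℙ[Wᵀ≡_]≈ M k 2≤T distinct) (law rate≡))
      where rate≡ = trans (totalRate-geometric 2≤T) (sym h≡)
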